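{- The online algorithm \textsc{Divide \& Explore} (described in the context) is $3$-competitive for the collaborative tree exploration problem with energy-bounded agents, i.e. for every instance $I=\langle T,r,k,B\rangle$ we have $|\textsc{Opt}(I)| \le 3\,|\textsc{Alg}(I)|$, where $\textsc{Alg}$ denotes \textsc{Divide \& Explore}.
   Context: Problem. An instance is $I=\langle T,r,k,B\rangle$: $T$ is a finite undirected tree, initially unknown, rooted at $r$; $k$ agents start at $r$; each agent can traverse at most $B$ edges in total (energy budget $B$, one unit per edge traversal). At every vertex $v$ the incident edges carry locally distinct labels (port numbers) $0,\dots,\delta_v-1$, $\delta_v$ the degree of $v$; w.l.o.g. for $v\ne r$ the edge towards $r$ has label $0$. When an agent arrives at a new vertex it learns the port number of the edge through which it arrived and the degree of the vertex. Agents communicate globally: the current map of the explored part of the tree and all agent positions are instantly known to all agents. A vertex is explored once some agent has visited it. The goal is to maximize the number of distinct vertices visited by the agents. For an algorithm $\textsc{Alg}$, $|\textsc{Alg}(I)|$ is the number of distinct vertices it visits on $I$, and $|\textsc{Opt}(I)|$ is the maximum number of distinct vertices that $k$ agents with budget $B$ starting at $r$ can visit when $T$ is known in advance. $\textsc{Alg}$ is $\rho$-competitive if $\sup_I |\textsc{Opt}(I)|/|\textsc{Alg}(I)|\le\rho$. Notation. $d(v)$ is the depth of $v$ in $T$; $T(v)$ is the subtree of $T$ induced by $v$ and all vertices below $v$; for a subtree $S$, $r_S$ is its vertex of smallest depth. L-DFS$(S,u)$: an agent moves along a shortest path to $u$, and then, while it has energy and $S$ is not completely explored: if the part of $S$ below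 its current vertex is completely explored it traverses the edge with label $0$, otherwise it traverses the edge of $S$ to an unexplored vertex with the smallest label $l>0$. R-DFS$(S,u)$ is the same with the largest label $l>0$. The L-DFS sequence of a subtree $S$ is the sequence of directed edges obtained by performing a complete depth-first traversal of $S$ from $r_S$ always choosing the smallest label $l>0$, directing each edge in the direction it is traversed (each edge appears once in each direction); the R-DFS sequence is defined analogously with the largest label. The leftmost (resp. rightmost) unexplored vertex of $S$ is the unexplored vertex incident to the first edge of the L-DFS (resp. R-DFS) sequence of $S$ that leads to an unexplored vertex. Algorithm \textsc{Divide \& Explore}. Agents are used one after another. Maintain a set $\mathcal T$ of edge-disjoint subtrees, initially $\mathcal T=\{T\}$. The first agent performs L-DFS$(T,r)$, the second R-DFS$(T,r)$. Then, while $T$ contains an unexplored vertex and an unused agent is at $r$: (1) for every $S\in\mathcal T$ containing an unexplored vertex, set $r_0:=r_S$ and, while $r_0$ has exactly one child leading to an unexplored vertex and $r_0$ has no unexplored child, replace $r_0$ by that child; then replace $S$ in $\mathcal T$ by $T(r_0)$. (2) Let $S\in\mathcal T$ be a subtree containing an unexplored vertex minimizing $d(r_S)$, and $v_L,v_R$ its leftmost and rightmost unexplored vertices. If $d(v_L)-d(r_S)\le\max\{1,(B-d(r_S))/3\}$, one agent performs L-DFS$(S,v_L)$; else if $d(v_R)-d(r_S)\le\max\{1,(B-d(r_S))/3\}$, one agent performs R-DFS$(S,v_R)$; otherwise let $v$ be the child of $r_S$ leading to $v_R$, $S^{(1)}$ the subtree of $S$ induced by all vertices not in $T(v)$, $S^{(2)}$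 the subtree of $S$ induced by the vertices of $T(v)$ and $r_S$; replace $S$ in $\mathcal T$ by $S^{(1)},S^{(2)}$, and one agent performs R-DFS$(S^{(1)},r_S)$ and another agent L-DFS$(S^{(2)},r_S)$. -}

module Defs where

open import Data.Bool using (Bool; true; false; if_then_else_; not; _∧_; _∨_)
open import Data.Nat using (ℕ; zero; suc; _+_; _*_; _∸_; _≤_; _⊔_; _≡ᵇ_; _≤ᵇ_)
open import Data.List using (List; []; _∷_; _++_; _∷ʳ_; length; map; concat; reverse; upTo; filterᵇ; deduplicateᵇ; take)
open import Data.Bool.ListAction using (any; all)
open import Data.List.Properties using (≡-dec)
import Data.Nat as N
open import Data.Maybe using (Maybe; just; nothing; Is-just)
open import Data.Product using (_×_; _,_; ∃-syntax; proj₁; proj₂)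
open import Data.Sum using (_⊎_)
open import Data.Vec using (Vec; toList)
open import Relation.Nullary.Decidable using (⌊_⌋)
open import Relation.Binary.PropositionalEquality using (_≡_)

-- Trees with port numbers.
-- A rooted tree is a rose tree whose children are ordered by their port
-- labels: at the root r the i-th child (0-based) is reached through
-- port i; at a vertex v ≠ r port 0 leads to the parent and the i-th
-- child (0-based) is reached through port i+1.  Only the relative order
-- of the labels matters to the algorithm, so this loses no generality.

data Tree : Set where
  node : List Tree → Tree

-- A vertex is addressed by its path from the root: the list of 0-based
-- child indices.  Its depth d(v) is the length of the path.
Vertex : Set
Vertex = List ℕ

depth : Vertex → ℕ
depth = length

nth : {A : Set} → ℕ → List A → Maybe A
nth _ [] = nothing
nth zero (x ∷ xs) = just x
nth (suc n) (x ∷ xs) = nth n xs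

sub : Tree → Vertex → Maybe Tree
sub t [] = just t
sub (node ts) (i ∷ p) with nth i ts
... | nothing = nothing
... | just t = sub t p

at : Tree → Vertex → Tree
at t p with sub t p
... | just s = s
... | nothing = node []

nkids : Tree → ℕ
nkids (node ts) = length ts

Valid : Tree → Vertex → Set
Valid t v = Is-just (sub t v)

_==_ : Vertex → Vertex → Bool
u == v = ⌊ ≡-dec N._≟_ u v ⌋

_∈ᵇ_ : Vertex → List Vertex → Bool
v ∈ᵇ E = any (λ x → x == v) E

_∈ℕ_ : ℕ → List ℕ → Bool
i ∈ℕ xs = any (λ x → x ≡ᵇ i) xs

parent : Vertex → Vertex
parent p = reverse (dropOne (reverse p))
  where
  dropOne : List ℕ → List ℕ
  dropOne [] = []
  dropOne (_ ∷ xs) = xs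

DEdge : Set
DEdge = Vertex × Vertex   -- directed edge (from , to)

mutual
  vertsT : Vertex → Tree → List Vertex
  vertsT p (node ts) = p ∷ vertsK (λ _ → true) p 0 ts

  vertsK : (ℕ → Bool) → Vertex → ℕ → List Tree → List Vertex
  vertsK ok p i [] = []
  vertsK ok p i (t ∷ ts) =
    (if ok i then vertsT (p ∷ʳ i) t else []) ++ vertsK ok p (suc i) ts

mutual
  lseqT : Vertex → Tree → List DEdge
  lseqT p (node ts) = lseqK (λ _ → true) p 0 ts

  lseqK : (ℕ → Bool) → Vertex → ℕ → List Tree → List DEdge
  lseqK ok p i [] = []
  lseqK ok p i (t ∷ ts) =
    (if ok i
       then ((p , p ∷ʳ i) ∷ lseqT (p ∷ʳ i) t ++ ((p ∷ʳ i , p) ∷ []))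
       else [])
    ++ lseqK ok p (suc i) ts

mutual
  rseqT : Vertex → Tree → List DEdge
  rseqT p (node ts) = rseqK (λ _ → true) p 0 ts

  rseqK : (ℕ → Bool) → Vertex → ℕ → List Tree → List DEdge
  rseqK ok p i [] = []
  rseqK ok p i (t ∷ ts) =
    rseqK ok p (suc i) ts ++
    (if ok i
       then ((p , p ∷ʳ i) ∷ rseqT (p ∷ʳ i) t ++ ((p ∷ʳ i , p) ∷ []))
       else [])

-- Subtrees of T of the shape used by the algorithm: a top vertex r_S
-- together with a set of its children (given by their 0-based indices,
-- in increasing order); S consists of r_S and the full subtrees T(c) of
-- the selected children c.

record Sub : Set where
  constructor mkSub
  field
    top  : Vertex
    kids : List ℕ
open Sub public

kidsOf : Tree → Vertex → List ℕ
kidsOf T v = upTo (nkids (at T v))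

fullSub : Tree → Vertex → Sub
fullSub T v = mkSub v (kidsOf T v)

unexplored : List Vertex → Vertex → Bool
unexplored E v = not (v ∈ᵇ E)

vertsS : Tree → Sub → List Vertex
vertsS T S with at T (top S)
... | node ts = top S ∷ vertsK (λ i → i ∈ℕ kids S) (top S) 0 ts

lseqS : Tree → Sub → List DEdge
lseqS T S with at T (top S)
... | node ts = lseqK (λ i → i ∈ℕ kids S) (top S) 0 ts

rseqS : Tree → Sub → List DEdge
rseqS T S with at T (top S)
... | node ts = rseqK (λ i → i ∈ℕ kids S) (top S) 0 ts

hasUnexpl : List Vertex → List Vertex → Bool
hasUnexpl E vs = any (unexplored E) vs

firstUnexpl : List Vertex → List DEdge → Maybe Vertex
firstUnexpl E [] = nothing
firstUnexpl E ((_ , w) ∷ es) = if unexplored E w then just w else firstUnexpl E es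

leftmost rightmost : Tree → List Vertex → Sub → Maybe Vertex
leftmost T E S = firstUnexpl E (lseqS T S)
rightmost T E S = firstUnexpl E (rseqS T S)

kidsIn : Tree → Sub → Vertex → List ℕ
kidsIn T S v = if v == top S then kids S else kidsOf T v

belowIn : Tree → Sub → Vertex → List Vertex
belowIn T S v = if v == top S then vertsS T S else vertsT v (at T v)

leadingKids : Tree → List Vertex → Sub → Vertex → List ℕ
leadingKids T E S v =
  filterᵇ (λ i → hasUnexpl E (vertsT (v ∷ʳ i) (at T (v ∷ʳ i)))) (kidsIn T S v)

headM : {A : Set} → List A → Maybe A
headM [] = nothing
headM (x ∷ _) = just x

-- One agent.  Explored set = list of visited vertices.

-- move along the shortest path from the root to a vertex, one edge per
-- energy unit; returns (position , remaining energy , explored set)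
walkDown : List ℕ → Vertex → ℕ → List Vertex → Vertex × ℕ × List Vertex
walkDown [] cur e E = cur , e , E
walkDown (i ∷ is) cur zero E = cur , zero , E
walkDown (i ∷ is) cur (suc e) E = walkDown is (cur ∷ʳ i) e ((cur ∷ʳ i) ∷ E)

dfs : Tree → Bool → Sub → Vertex → ℕ → List Vertex → List Vertex
dfs T left S cur zero E = E
dfs T left S cur (suc e) E =
  if not (hasUnexpl E (vertsS T S)) then E
  else if not (hasUnexpl E (belowIn T S cur)) then dfs T left S (parent cur) e E
  else go (headM (if left then leadingKids T E S cur
                          else reverse (leadingKids T E S cur)))
  where
  go : Maybe ℕ → List Vertex
  go nothing = E
  go (just i) = dfs T left S (cur ∷ʳ i) e ((cur ∷ʳ i) ∷ E)

runDFS : Tree → ℕ → Bool → Sub → Vertex → List Vertex → List Vertex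
runDFS T B left S u E with walkDown u [] B ([] ∷ E)
... | pos , e , E' = dfs T left S pos e E'

descend : Tree → List Vertex → ℕ → Sub → Sub
descend T E zero S = S
descend T E (suc f) S with leadingKids T E S (top S)
... | c ∷ [] =
  if all (λ i → not (unexplored E (top S ∷ʳ i))) (kids S)
  then descend T E f (fullSub T (top S ∷ʳ c))
  else S
... | _ = S

size : Tree → ℕ
sizeF : List Tree → ℕ
size (node ts) = suc (sizeF ts)
sizeF [] = zero
sizeF (t ∷ ts) = size t + sizeF ts

-- A tie-breaking rule: given the explored set and the current list 𝒯,
-- returns an index into the list of indices of minimizers of d(r_S)
-- (out of range: the first minimizer is taken).  The theorem is stated
-- for every such rule, i.e. for arbitrary tie-breaking.
TieBreak : Set
TieBreak = List Vertex → List Sub → ℕ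

indexed : {A : Set} → ℕ → List A → List (ℕ × A)
indexed i [] = []
indexed i (x ∷ xs) = (i , x) ∷ indexed (suc i) xs

minimum : List ℕ → ℕ
minimum [] = 0
minimum (x ∷ []) = x
minimum (x ∷ y ∷ xs) = x N.⊓ minimum (y ∷ xs)

replaceAt : ℕ → List Sub → List Sub → List Sub
replaceAt _ new [] = []
replaceAt zero new (x ∷ xs) = new ++ xs
replaceAt (suc n) new (x ∷ xs) = x ∷ replaceAt n new xs

-- 3 (d(w) - d(r_S)) ≤ max{3 , B - d(r_S)}, i.e.
-- d(w) - d(r_S) ≤ max{1 , (B - d(r_S))/3}
closeEnough : ℕ → Sub → Vertex → Bool
closeEnough B S w = (3 * (depth w ∸ depth (top S))) ≤ᵇ (3 ⊔ (B ∸ depth (top S)))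

prepare : Tree → List Vertex → List Sub → List Sub
prepare T E 𝒯 =
  map (λ S → if hasUnexpl E (vertsS T S) then descend T E (size T) S else S) 𝒯

minsOf : Tree → List Vertex → List Sub → List ℕ
minsOf T E 𝒯 =
  map proj₁ (filterᵇ (λ p → depth (top (proj₂ p)) ≡ᵇ dmin) cands)
  where
  cands : List (ℕ × Sub)
  cands = filterᵇ (λ p → hasUnexpl E (vertsS T (proj₂ p))) (indexed 0 𝒯)
  dmin : ℕ
  dmin = minimum (map (λ p → depth (top (proj₂ p))) cands)

pick : ℕ → List ℕ → Maybe ℕ
pick n ms with nth n ms
... | just j = just j
... | nothing = headM ms

-- the main loop; m = number of unused agents (all at r)
mutual
  loop : Tree → ℕ → TieBreak → ℕ → List Vertex → List Sub → List Vertex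
  loop T B tb zero E 𝒯 = E
  loop T B tb (suc m) E 𝒯 =
    if not (hasUnexpl E (vertsT [] T)) then E
    else choose T B tb m E (prepare T E 𝒯)

  -- step (2); m = number of unused agents other than the one about to go
  choose : Tree → ℕ → TieBreak → ℕ → List Vertex → List Sub → List Vertex
  choose T B tb m E 𝒯 with pick (tb E 𝒯) (minsOf T E 𝒯)
  ... | nothing = E
  ... | just j with nth j 𝒯
  ...   | nothing = E
  ...   | just S = act T B tb m E 𝒯 j S (leftmost T E S) (rightmost T E S)

  act : Tree → ℕ → TieBreak → ℕ → List Vertex → List Sub → ℕ → Sub
        → Maybe Vertex → Maybe Vertex → List Vertex
  act T B tb m E 𝒯 j S nothing mR = E
  act T B tb m E 𝒯 j S (just vL) mR =
    if closeEnough B S vL then loop T B tb m (runDFS T B true S vL E) 𝒯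
    else act₂ T B tb m E 𝒯 j S mR

  act₂ : Tree → ℕ → TieBreak → ℕ → List Vertex → List Sub → ℕ → Sub
         → Maybe Vertex → List Vertex
  act₂ T B tb m E 𝒯 j S nothing = E
  act₂ T B tb m E 𝒯 j S (just vR) =
    if closeEnough B S vR then loop T B tb m (runDFS T B false S vR E) 𝒯
    else divide T B tb m E 𝒯 j S (nth (depth (top S)) vR)

  -- v = the child of r_S leading to v_R (given by its index)
  divide : Tree → ℕ → TieBreak → ℕ → List Vertex → List Sub → ℕ → Sub
           → Maybe ℕ → List Vertex
  divide T B tb m E 𝒯 j S nothing = E
  divide T B tb m E 𝒯 j S (just v) =
    second T B tb m (runDFS T B false S₁ (top S) E) S₂
           (replaceAt j (S₁ ∷ S₂ ∷ []) 𝒯)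
    where
    S₁ S₂ : Sub
    S₁ = mkSub (top S) (filterᵇ (λ i → not (i ≡ᵇ v)) (kids S))
    S₂ = mkSub (top S) (v ∷ [])

  second : Tree → ℕ → TieBreak → ℕ → List Vertex → Sub → List Sub → List Vertex
  second T B tb zero E S₂ 𝒯 = E
  second T B tb (suc m) E S₂ 𝒯 = loop T B tb m (runDFS T B true S₂ (top S₂) E) 𝒯

-- The set of vertices explored by Divide & Explore with k agents
-- (as a list possibly with repetitions).
divideExplore : Tree → ℕ → ℕ → TieBreak → List Vertex
divideExplore T zero B tb = []
divideExplore T (suc zero) B tb = runDFS T B true (fullSub T []) [] []
divideExplore T (suc (suc m)) B tb =
  loop T B tb m
    (runDFS T B false (fullSub T []) [] (runDFS T B true (fullSub T []) [] []))
    (fullSub T [] ∷ [])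

count : List Vertex → ℕ
count E = length (deduplicateᵇ _==_ E)

algValue : Tree → ℕ → ℕ → TieBreak → ℕ
algValue T k B tb = count (divideExplore T k B tb)

Adj : Tree → Vertex → Vertex → Set
Adj T u w = Valid T u × Valid T w × ∃[ i ] (w ≡ u ∷ʳ i ⊎ u ≡ w ∷ʳ i)

data Chain (T : Tree) : Vertex → List Vertex → Set where
  done : ∀ {v} → Chain T v []
  step : ∀ {v w ws} → Adj T v w → Chain T w ws → Chain T v (w ∷ ws)

Route : Tree → ℕ → List Vertex → Set
Route T B ws = Chain T [] ws × length ws ≤ B

optValueOf : {k : ℕ} → Vec (List Vertex) k → ℕ
optValueOf ws = count (concat (map ([] ∷_) (toList ws)))

{-# OPTIONS --safe #-}

-- Charge every round to the chosen subtree S: an agent sent into S has the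
-- allowance g = B - d(r_S).
--
-- Lower bound on Alg.  Call an explored vertex of S active if S still has an
-- unexplored vertex below it.  Every active vertex has nothing unexplored on its
-- left or nothing unexplored on its right, so a depth-first agent that steps down
-- to an explored vertex has all unexplored vertices of S below it, and r_S will
-- descend past that vertex.  Giving 6 credits to each explored vertex and storing
-- 2 (B - d(r_S)) + 3 |active vertices below r_S| in each unfinished subtree, each
-- move of an agent earns 3 credits, and 2 g are left over for each agent: a close
-- run has energy at least 2 g / 3 left, and an agent that stops early releases the
-- store of the subtree it finishes.  A division needs a second store 2 g, paid
-- by its two fresh runs.  A step of r_S frees 5 credits; 3 pay for the move to an
-- explored vertex and 2 for adding the vertex to the set Q of ancestors of tops.
-- Hence 3 |Alg| ≥ |Q| + Σ g.
--
-- Upper bound on Opt.  A route that leaves the part explored by the first m agents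
-- passes through the top of an unfinished subtree, hence visits at most g_{m+1}
-- vertices outside Q.  Since the allowances decrease, matching routes with agents
-- gives |Opt| ≤ |Q| + Σ g; if more than m routes stay in the part explored by the
-- first m agents, that part itself is counted, each agent having added at most g.

module Submission where

open import Defs
open import Data.Nat using (ℕ; _*_; _≤_)
open import Data.List using (List)
open import Data.Vec using (Vec)
open import Data.Vec.Relation.Unary.All using (All)

open import Data.Bool using (Bool; true; false; if_then_else_; not) renaming (T to IsTrue)
open import Data.Bool.ListAction using (any; all)
open import Data.Bool.Properties using (T-≡; T?)
open import Data.Empty using (⊥; ⊥-elim)
open import Data.List using ([]; _∷_; _++_; _∷ʳ_; length; map; concat; reverse; filter; filterᵇ; deduplicateᵇ; initLast; _∷ʳ′_)
open import Data.List.Membership.Propositional using (_∈_; _∉_; find)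
open import Data.List.Membership.Propositional.Properties
open import Data.List.Properties using (≡-dec; length-++; ++-assoc; ++-identityʳ; ++-cancelˡ; ∷-injective; ∷ʳ-injectiveˡ; unfold-reverse; reverse-++; reverse-involutive; length-filter)
open import Data.List.Relation.Binary.Pointwise using (Pointwise; []; _∷_)
open import Data.List.Relation.Binary.Subset.Propositional using (_⊆_)
import Data.List.Relation.Unary.All as All
import Data.List.Relation.Unary.All.Properties as All
open import Data.List.Relation.Unary.All using ([]; _∷_) renaming (All to Allᴸ)
open import Data.List.Relation.Unary.AllPairs using (AllPairs; []; _∷_)
import Data.List.Relation.Unary.AllPairs.Properties as AllPairs
open import Data.List.Relation.Unary.Any using (Any; here; there)
import Data.List.Relation.Unary.Any.Properties as Any
open import Data.List.Relation.Unary.Unique.Propositional using (Unique)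
open import Data.Maybe using (Maybe; just; nothing; Is-just)
import Data.Maybe.Relation.Unary.Any as Maybe
open import Data.Nat using (zero; suc; _+_; _∸_; _⊔_; _<_; z≤n; s≤s; _≡ᵇ_; _≤?_; _≟_)
open import Data.Nat.Properties hiding (_≤?_; _≟_)
open import Data.Nat.Tactic.RingSolver using (solve-∀)
open import Data.Product using (_×_; _,_; ∃-syntax; proj₁; proj₂)
open import Data.Sum using (_⊎_; inj₁; inj₂; [_,_]′)
open import Data.Unit using (tt)
open import Data.Vec using (toList)
import Data.Vec.Properties as Vec
import Data.Vec.Relation.Unary.All.Properties as Vec
open import Function using (_∘_; id; Equivalence)
open import Relation.Binary.Definitions using (tri<; tri≈; tri>)
open import Relation.Binary.PropositionalEquality using (_≡_; _≢_; refl; sym; trans; cong; cong₂; subst; subst₂)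
open import Relation.Nullary using (¬_; ¬?; Dec; yes; no; contradiction)
open import Relation.Unary using (Decidable)


-- The threshold of one third is where two demands meet. A run to a frontier at distance at most
-- about `g/3` keeps energy `2g/3`, and at 3 credits per move this restores the store `2 g` just
-- spent on its allowance. A division must raise a surplus of `g` from each new part: a run that
-- spends its whole energy earns `3 g`, of which the store keeps `2 g`, while a run that finishes
-- its part early releases 3 credits for each active vertex on the path to a frontier deeper than
-- about `g/3`. The obstacle is timing. An agent steps down to an explored vertex before `r_S`
-- descends past it, so these moves are paid by a loan: an explored vertex `p` with everything
-- pending below it records how far the search has run ahead, and the store may be short by 3 per
-- level between `r_S` and `p`. The descent cannot stop above the depth of `p`, so each preparation
-- settles the loan in full. All amounts are doubled so that a move is worth the integer 3 instead
-- of 3/2.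

_≟ⱽ_ : (u v : Vertex) → Dec (u ≡ v)
_≟ⱽ_ = ≡-dec _≟_

open import Data.List.Membership.DecPropositional _≟ⱽ_ using (_∈?_)


T⇒true : ∀ {b} → IsTrue b → b ≡ true
T⇒true = Equivalence.to T-≡

true⇒T : ∀ {b} → b ≡ true → IsTrue b
true⇒T = Equivalence.from T-≡

not-true⇒false : ∀ {b} → not b ≡ true → b ≡ false
not-true⇒false {false} _ = refl

false≢true : ∀ {b} → b ≡ false → b ≡ true → ⊥
false≢true refl ()

-- Counting distinct vertices

unique-⊆-length : {A : Set} {xs ys : List A} → Unique xs → xs ⊆ ys → length xs ≤ length ys
unique-⊆-length {xs = []} _ _ = z≤n
unique-⊆-length {xs = x ∷ xs} {ys} (x≢ ∷ u) sub with ∈-∃++ (sub (here refl))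
... | ys₁ , ys₂ , refl = begin
  suc (length xs)             ≤⟨ s≤s (unique-⊆-length u sub′) ⟩
  suc (length (ys₁ ++ ys₂))   ≡⟨ cong suc (length-++ ys₁) ⟩
  suc (length ys₁ + length ys₂) ≡⟨ +-suc (length ys₁) (length ys₂) ⟨
  length ys₁ + suc (length ys₂) ≡⟨ length-++ ys₁ ⟨
  length (ys₁ ++ x ∷ ys₂)     ∎
  where
  open ≤-Reasoning
  sub′ : xs ⊆ ys₁ ++ ys₂
  sub′ z∈ with ∈-++⁻ ys₁ (sub (there z∈))
  ... | inj₁ z∈₁ = ∈-++⁺ˡ z∈₁
  ... | inj₂ (here refl) = contradiction refl (All.lookup x≢ z∈)
  ... | inj₂ (there z∈₂) = ∈-++⁺ʳ ys₁ z∈₂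

==-refl : ∀ v → (v == v) ≡ true
==-refl v with v ≟ⱽ v
... | yes _ = refl
... | no v≢v = contradiction refl v≢v

==-≢ : ∀ {u v} → u ≢ v → (u == v) ≡ false
==-≢ {u} {v} u≢v with u ≟ⱽ v
... | yes u≡v = contradiction u≡v u≢v
... | no _ = refl

==-true : ∀ {u v} → (u == v) ≡ true → u ≡ v
==-true {u} {v} eq with u ≟ⱽ v
... | yes p = p
==-true () | no _

dedup-unique : ∀ xs → Unique (deduplicateᵇ _==_ xs)
dedup-unique [] = []
dedup-unique (x ∷ xs) =
  All.map (λ {y} ¬xy x≡y → ¬xy (true⇒T (subst (λ z → (x == z) ≡ true) x≡y (==-refl x))))
          (All.all-filter _ (deduplicateᵇ _==_ xs))
  ∷ AllPairs.filter⁺ _ (dedup-unique xs)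

∈-dedup⁺ : ∀ {v xs} → v ∈ xs → v ∈ deduplicateᵇ _==_ xs
∈-dedup⁺ {v} {x ∷ xs} (here refl) = here refl
∈-dedup⁺ {v} {x ∷ xs} (there v∈) with x ≟ⱽ v
... | yes refl = here refl
... | no x≢v = there (∈-filter⁺ _ (∈-dedup⁺ v∈) λ t → x≢v (==-true (T⇒true t)))

∈-dedup⁻ : ∀ {v xs} → v ∈ deduplicateᵇ _==_ xs → v ∈ xs
∈-dedup⁻ {v} {x ∷ xs} (here refl) = here refl
∈-dedup⁻ {v} {x ∷ xs} (there v∈) = there (∈-dedup⁻ (proj₁ (∈-filter⁻ _ v∈)))

count≤length : ∀ {xs ys} → xs ⊆ ys → count xs ≤ length ys
count≤length {xs} sub = unique-⊆-length (dedup-unique xs) (sub ∘ ∈-dedup⁻)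

count-mono : ∀ {xs ys} → xs ⊆ ys → count xs ≤ count ys
count-mono {xs} sub = unique-⊆-length (dedup-unique xs) (∈-dedup⁺ ∘ sub ∘ ∈-dedup⁻)

count-grows : ∀ {v xs ys} → v ∉ xs → v ∈ ys → xs ⊆ ys → suc (count xs) ≤ count ys
count-grows {v} {xs} {ys} v∉ v∈ sub = unique-⊆-length {xs = v ∷ deduplicateᵇ _==_ xs}
  (All.tabulate (λ z∈ v≡z → v∉ (∈-dedup⁻ (subst (_∈ _) (sym v≡z) z∈))) ∷ dedup-unique xs)
  λ { (here refl) → ∈-dedup⁺ v∈ ; (there z∈) → ∈-dedup⁺ (sub (∈-dedup⁻ z∈)) }

_\\_ : List Vertex → Vertex → List Vertex
A \\ x = filter (λ y → ¬? (y ≟ⱽ x)) A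

∈-\\⁺ : ∀ {A x y} → y ∈ A → y ≢ x → y ∈ A \\ x
∈-\\⁺ = ∈-filter⁺ _

length-\\ : ∀ {A x} → x ∈ A → suc (length (A \\ x)) ≤ length A
length-\\ {y ∷ A} {x} x∈ with y ≟ⱽ x | x∈
... | yes refl | _ = s≤s (length-filter _ A)
... | no y≢x | here refl = contradiction refl y≢x
... | no y≢x | there x∈A = s≤s (length-\\ x∈A)

-- Reflection of the Boolean tests

any-true : {A : Set} (p : A → Bool) (xs : List A) → any p xs ≡ true → ∃[ x ] x ∈ xs × p x ≡ true
any-true p (x ∷ xs) eq with p x in px
... | true = x , here refl , px
... | false with any-true p xs eq
...   | y , y∈ , py = y , there y∈ , py

any-false : {A : Set} (p : A → Bool) (xs : List A) → any p xs ≡ false → ∀ {x} → x ∈ xs → p x ≡ false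
any-false p (x ∷ xs) eq y∈ with p x in px
any-false p (x ∷ xs) () y∈ | true
any-false p (x ∷ xs) eq (here refl) | false = px
any-false p (x ∷ xs) eq (there y∈) | false = any-false p xs eq y∈

any-intro : {A : Set} (p : A → Bool) {xs : List A} {x : A} → x ∈ xs → p x ≡ true → any p xs ≡ true
any-intro p {xs} x∈ px with any p xs in eq
... | true = refl
... | false = ⊥-elim (false≢true (any-false p xs eq x∈) px)

all-true : {A : Set} (p : A → Bool) (xs : List A) → all p xs ≡ true → ∀ {x} → x ∈ xs → p x ≡ true
all-true p (x ∷ xs) eq y∈ with p x in px
all-true p (x ∷ xs) eq (here refl) | true = px
all-true p (x ∷ xs) eq (there y∈) | true = all-true p xs eq y∈

all-false : {A : Set} (p : A → Bool) (xs : List A) → all p xs ≡ false → ∃[ x ] x ∈ xs × p x ≡ false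
all-false p (x ∷ xs) eq with p x in px
... | false = x , here refl , px
... | true with all-false p xs eq
...   | y , y∈ , py = y , there y∈ , py

∈ᵇ-true : ∀ {v E} → (v ∈ᵇ E) ≡ true → v ∈ E
∈ᵇ-true {v} {E} eq with any-true _ E eq
... | x , x∈ , x==v = subst (_∈ E) (==-true x==v) x∈

∈ᵇ-intro : ∀ {v E} → v ∈ E → (v ∈ᵇ E) ≡ true
∈ᵇ-intro {v} v∈ = any-intro _ v∈ (==-refl v)

unexplored-true : ∀ {E v} → unexplored E v ≡ true → v ∉ E
unexplored-true eq v∈ = false≢true (not-true⇒false eq) (∈ᵇ-intro v∈)

unexplored-false : ∀ {E v} → unexplored E v ≡ false → v ∈ E
unexplored-false {E} {v} eq with v ∈ᵇ E in b
... | true = ∈ᵇ-true b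
unexplored-false () | false

unexplored-intro : ∀ {E v} → v ∉ E → unexplored E v ≡ true
unexplored-intro {E} {v} v∉ with unexplored E v in eq
... | true = refl
... | false = contradiction (unexplored-false {E} {v} eq) v∉

hasUnexpl-true : ∀ {E} vs → hasUnexpl E vs ≡ true → ∃[ v ] v ∈ vs × v ∉ E
hasUnexpl-true {E} vs eq with any-true (unexplored E) vs eq
... | v , v∈ , u = v , v∈ , unexplored-true {E} {v} u

hasUnexpl-false : ∀ {E} vs → hasUnexpl E vs ≡ false → vs ⊆ E
hasUnexpl-false {E} vs eq {v} v∈ = unexplored-false {E} {v} (any-false (unexplored E) vs eq v∈)

hasUnexpl-intro : ∀ {E vs v} → v ∈ vs → v ∉ E → hasUnexpl E vs ≡ true
hasUnexpl-intro {E} v∈ v∉ = any-intro (unexplored E) v∈ (unexplored-intro v∉)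

≡ᵇ-true : ∀ m n → (m ≡ᵇ n) ≡ true → m ≡ n
≡ᵇ-true m n eq = ≡ᵇ⇒≡ m n (true⇒T eq)

≡ᵇ-intro : ∀ {m n} → m ≡ n → (m ≡ᵇ n) ≡ true
≡ᵇ-intro {m} {n} eq = T⇒true (≡⇒≡ᵇ m n eq)

∈ℕ-true : ∀ {i xs} → (i ∈ℕ xs) ≡ true → i ∈ xs
∈ℕ-true {i} {xs} eq with any-true _ xs eq
... | x , x∈ , e = subst (_∈ xs) (≡ᵇ-true x i e) x∈

∈ℕ-intro : ∀ {i xs} → i ∈ xs → (i ∈ℕ xs) ≡ true
∈ℕ-intro {i} i∈ = any-intro _ i∈ (≡ᵇ-intro {i} refl)

∈-filterᵇ⁺ : {A : Set} (p : A → Bool) {xs : List A} {x : A} → x ∈ xs → p x ≡ true → x ∈ filterᵇ p xs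
∈-filterᵇ⁺ p x∈ px = ∈-filter⁺ (T? ∘ p) x∈ (true⇒T px)

∈-filterᵇ⁻ : {A : Set} (p : A → Bool) {xs : List A} {x : A} → x ∈ filterᵇ p xs → x ∈ xs × p x ≡ true
∈-filterᵇ⁻ p x∈ with ∈-filter⁻ (T? ∘ p) x∈
... | x∈′ , t = x∈′ , T⇒true t

-- Addresses and subtrees

∷ʳ-++ : {A : Set} (p : List A) (x : A) (q : List A) → (p ∷ʳ x) ++ q ≡ p ++ x ∷ q
∷ʳ-++ p x q = ++-assoc p (x ∷ []) q

length-∷ʳ′ : {A : Set} (p : List A) (x : A) → length (p ∷ʳ x) ≡ suc (length p)
length-∷ʳ′ p x = trans (length-++ p) (+-comm (length p) 1)

++-absurd : {A : Set} (p : List A) {x : A} {q : List A} → p ≢ p ++ x ∷ q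
++-absurd (y ∷ p) eq = ++-absurd p (proj₂ (∷-injective eq))

nth-< : {A : Set} (i : ℕ) (xs : List A) {x : A} → nth i xs ≡ just x → i < length xs
nth-< zero (x ∷ xs) eq = s≤s z≤n
nth-< (suc i) (x ∷ xs) eq = s≤s (nth-< i xs eq)

nth-∈ : {X : Set} {x : X} (j : ℕ) {xs : List X} → nth j xs ≡ just x → x ∈ xs
nth-∈ zero {x ∷ xs} refl = here refl
nth-∈ (suc j) {x ∷ xs} e = there (nth-∈ j e)

nth-exists : {A : Set} (i : ℕ) (xs : List A) → i < length xs → ∃[ x ] nth i xs ≡ just x
nth-exists zero (x ∷ xs) _ = x , refl
nth-exists (suc i) (x ∷ xs) (s≤s lt) = nth-exists i xs lt

nth-++ : {A : Set} (xs : List A) {x : A} {ys : List A} → nth (length xs) (xs ++ x ∷ ys) ≡ just x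
nth-++ [] = refl
nth-++ (x ∷ xs) = nth-++ xs

sub-∷ : ∀ {ts t} i p → nth i ts ≡ just t → sub (node ts) (i ∷ p) ≡ sub t p
sub-∷ i p eq rewrite eq = refl

Valid-∷⁻ : ∀ ts i p → Valid (node ts) (i ∷ p) → ∃[ t ] nth i ts ≡ just t × Valid t p
Valid-∷⁻ ts i p v with nth i ts
... | just t = t , refl , v
Valid-∷⁻ ts i p () | nothing

Valid-∷⁺ : ∀ ts i p {t} → nth i ts ≡ just t → Valid t p → Valid (node ts) (i ∷ p)
Valid-∷⁺ ts i p eq v = subst Is-just (sym (sub-∷ {ts} i p eq)) v

Valid-[] : ∀ {t} → Valid t []
Valid-[] = Maybe.just tt

Valid⇒sub : ∀ {t p} → Valid t p → ∃[ s ] sub t p ≡ just s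
Valid⇒sub {t} {p} v with sub t p
... | just s = s , refl
Valid⇒sub () | nothing

sub-++ : ∀ {t s} p q → sub t p ≡ just s → sub t (p ++ q) ≡ sub s q
sub-++ [] q refl = refl
sub-++ {node ts} (i ∷ p) q eq with nth i ts
... | just t = sub-++ p q eq
sub-++ {node ts} (i ∷ p) q () | nothing

Valid-++⁻ : ∀ t p q → Valid t (p ++ q) → Valid t p
Valid-++⁻ t [] q v = Valid-[] {t}
Valid-++⁻ (node ts) (i ∷ p) q v with Valid-∷⁻ ts i (p ++ q) v
... | t , eq , v′ = Valid-∷⁺ ts i p eq (Valid-++⁻ t p q v′)

sub⇒at : ∀ {t p s} → sub t p ≡ just s → at t p ≡ s
sub⇒at eq rewrite eq = refl

Valid-at : ∀ t p q → Valid t p → Valid (at t p) q → Valid t (p ++ q)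
Valid-at t p q vp vq with Valid⇒sub {t} {p} vp
... | s , eq = subst Is-just (sym (sub-++ p q eq)) (subst (λ s → Valid s q) (sub⇒at {t} {p} eq) vq)

Valid-at⁻ : ∀ t p q → Valid t (p ++ q) → Valid (at t p) q
Valid-at⁻ t p q v with Valid⇒sub {t} {p} (Valid-++⁻ t p q v)
... | s , eq = subst (λ s → Valid s q) (sym (sub⇒at {t} {p} eq)) (subst Is-just (sub-++ p q eq) v)

nth-size : ∀ i ts {t} → nth i ts ≡ just t → size t ≤ sizeF ts
nth-size zero (t ∷ ts) refl = m≤m+n (size t) (sizeF ts)
nth-size (suc i) (t ∷ ts) eq = ≤-trans (nth-size i ts eq) (m≤n+m (sizeF ts) (size t))

Valid-depth : ∀ t p → Valid t p → depth p < size t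
Valid-depth (node ts) [] v = s≤s z≤n
Valid-depth (node ts) (i ∷ p) v with Valid-∷⁻ ts i p v
... | t , eq , v′ = s≤s (≤-trans (Valid-depth t p v′) (nth-size i ts eq))

mutual
  ∈-vertsT⁻ : ∀ {p w} t → w ∈ vertsT p t → ∃[ q ] w ≡ p ++ q × Valid t q
  ∈-vertsT⁻ {p} (node ts) (here refl) = [] , sym (++-identityʳ p) , Valid-[] {node ts}
  ∈-vertsT⁻ {p} (node ts) (there w∈) with ∈-vertsK⁻ (λ _ → true) p 0 ts w∈
  ... | j , t , q , eq , _ , w≡ , v = j ∷ q , w≡ , Valid-∷⁺ ts j q eq v

  ∈-vertsK⁻ : ∀ ok p i ts {w} → w ∈ vertsK ok p i ts →
              ∃[ j ] ∃[ t ] ∃[ q ] nth j ts ≡ just t × ok (i + j) ≡ true × w ≡ p ++ (i + j) ∷ q × Valid t q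
  ∈-vertsK⁻ ok p i (t ∷ ts) {w} w∈ with ok i in oki | ∈-++⁻ (if ok i then vertsT (p ∷ʳ i) t else []) w∈
  ... | true | inj₁ w∈₁ with ∈-vertsT⁻ t w∈₁
  ...   | q , w≡ , v = 0 , t , q , refl , subst (λ k → ok k ≡ true) (sym (+-identityʳ i)) oki ,
            trans w≡ (trans (∷ʳ-++ p i q) (cong (λ k → p ++ k ∷ q) (sym (+-identityʳ i)))) , v
  ∈-vertsK⁻ ok p i (t ∷ ts) w∈ | _ | inj₂ w∈₂ with ∈-vertsK⁻ ok p (suc i) ts w∈₂
  ...   | j , t′ , q , eq , okj , w≡ , v = suc j , t′ , q , eq , subst (λ k → ok k ≡ true) (sym (+-suc i j)) okj ,
            trans w≡ (cong (λ k → p ++ k ∷ q) (sym (+-suc i j))) , v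

mutual
  ∈-vertsT⁺ : ∀ {p} t q → Valid t q → (p ++ q) ∈ vertsT p t
  ∈-vertsT⁺ {p} (node ts) [] v = here (++-identityʳ p)
  ∈-vertsT⁺ {p} (node ts) (j ∷ q) v with Valid-∷⁻ ts j q v
  ... | t , eq , v′ = there (∈-vertsK⁺ (λ _ → true) p 0 ts j q eq refl v′)

  ∈-vertsK⁺ : ∀ ok p i ts j q {t} → nth j ts ≡ just t → ok (i + j) ≡ true → Valid t q →
              (p ++ (i + j) ∷ q) ∈ vertsK ok p i ts
  ∈-vertsK⁺ ok p i (t ∷ ts) zero q refl okj v rewrite +-identityʳ i | okj =
    ∈-++⁺ˡ (subst (_∈ vertsT (p ∷ʳ i) t) (∷ʳ-++ p i q) (∈-vertsT⁺ t q v))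
  ∈-vertsK⁺ ok p i (t ∷ ts) (suc j) q eq okj v rewrite +-suc i j =
    ∈-++⁺ʳ (if ok i then vertsT (p ∷ʳ i) t else []) (∈-vertsK⁺ ok p (suc i) ts j q eq okj v)

Valid-child⁻ : ∀ t p i q → Valid t (p ++ i ∷ q) → i < nkids (at t p)
Valid-child⁻ t p i q v with at t p | Valid-at⁻ t p (i ∷ q) v
... | node ts | v′ with Valid-∷⁻ ts i q v′
...   | s , eq , _ = nth-< i ts eq

Valid-child⁺ : ∀ t p i → Valid t p → i < nkids (at t p) → Valid t (p ∷ʳ i)
Valid-child⁺ t p i v lt with at t p | Valid-at t p (i ∷ []) v
... | node ts | f with nth-exists i ts lt
...   | s , eq = f (Valid-∷⁺ ts i [] eq (Valid-[] {s}))

-- The ancestor order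

_⊑_ : Vertex → Vertex → Set
u ⊑ v = ∃[ q ] v ≡ u ++ q

⊑-refl : ∀ {u} → u ⊑ u
⊑-refl {u} = [] , sym (++-identityʳ u)

⊑-trans : ∀ {u v w} → u ⊑ v → v ⊑ w → u ⊑ w
⊑-trans {u} (p , refl) (q , refl) = p ++ q , ++-assoc u p q

⊑-depth : ∀ {u v} → u ⊑ v → depth u ≤ depth v
⊑-depth {u} (q , refl) = subst (depth u ≤_) (sym (length-++ u)) (m≤m+n _ _)

⊑-compare : ∀ {u v w} → u ⊑ w → v ⊑ w → depth u ≤ depth v → u ⊑ v
⊑-compare {[]} {v} _ _ _ = v , refl
⊑-compare {x ∷ u} {y ∷ v} (p , refl) (q , eq) (s≤s le) with ∷-injective eq
... | refl , eq′ with ⊑-compare {u} {v} (p , refl) (q , eq′) le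
...   | r , refl = r , refl

⊑-∷ʳ⁻ : ∀ {u v i} → u ⊑ (v ∷ʳ i) → u ≡ v ∷ʳ i ⊎ u ⊑ v
⊑-∷ʳ⁻ {[]} {v} _ = inj₂ (v , refl)
⊑-∷ʳ⁻ {x ∷ []} {[]} (q , refl) = inj₁ refl
⊑-∷ʳ⁻ {x ∷ y ∷ u} {[]} (q , ())
⊑-∷ʳ⁻ {x ∷ u} {y ∷ v} (q , eq) with ∷-injective eq
... | refl , eq′ with ⊑-∷ʳ⁻ {u} {v} (q , eq′)
...   | inj₁ refl = inj₁ refl
...   | inj₂ (r , refl) = inj₂ (r , refl)

⊑-∷ʳ : ∀ {v i} → v ⊑ (v ∷ʳ i)
⊑-∷ʳ {v} {i} = i ∷ [] , refl

child-⋢ : ∀ {u v i q} → u ≡ v ++ i ∷ q → ¬ (u ⊑ v)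
child-⋢ {u} {v} {i} {q} eq u⊑v = <-irrefl refl (begin-strict
  depth v               <⟨ m<m+n (depth v) {suc (length q)} (s≤s z≤n) ⟩
  depth v + suc (length q) ≡⟨ trans (cong length eq) (length-++ v) ⟨
  depth u               ≤⟨ ⊑-depth u⊑v ⟩
  depth v               ∎)
  where open ≤-Reasoning

-- A direction is a Boolean as in dfs: true is left, false is right.

Prec : Bool → ℕ → ℕ → Set
Prec true i j = i < j
Prec false i j = j < i

Prec-irrefl : ∀ dir {i} → ¬ Prec dir i i
Prec-irrefl true = <-irrefl refl
Prec-irrefl false = <-irrefl refl

-- There is no case for an empty path: the two paths must diverge at some common position, so
-- neither vertex is an ancestor of the other.
data Before (dir : Bool) : Vertex → Vertex → Set where
  here  : ∀ {i j p q} → Prec dir i j → Before dir (i ∷ p) (j ∷ q)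
  there : ∀ {i p q} → Before dir p q → Before dir (i ∷ p) (i ∷ q)

Before-flip : ∀ {dir u v} → Before dir u v → Before (not dir) v u
Before-flip {true} (here lt) = here lt
Before-flip {false} (here lt) = here lt
Before-flip (there b) = there (Before-flip b)

Before-ext : ∀ {dir u v} p q → Before dir u v → Before dir (u ++ p) (v ++ q)
Before-ext p q (here lt) = here lt
Before-ext p q (there b) = there (Before-ext p q b)

Before-⊑ : ∀ {dir u u′ v v′} → u ⊑ u′ → v ⊑ v′ → Before dir u v → Before dir u′ v′
Before-⊑ (p , refl) (q , refl) b = Before-ext p q b

Before-++ : ∀ {dir u v} r → Before dir u v → Before dir (r ++ u) (r ++ v)
Before-++ [] b = b
Before-++ (i ∷ r) b = there (Before-++ r b)

Before-++⁻ : ∀ {dir u v} r → Before dir (r ++ u) (r ++ v) → Before dir u v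
Before-++⁻ [] b = b
Before-++⁻ {dir} (i ∷ r) (here lt) = contradiction lt (Prec-irrefl dir)
Before-++⁻ (i ∷ r) (there b) = Before-++⁻ r b

Before-heads : ∀ {dir i j p q} → Before dir (i ∷ p) (j ∷ q) → i ≢ j → Prec dir i j
Before-heads (here lt) _ = lt
Before-heads (there _) i≢i = contradiction refl i≢i

Before-∷ʳ⁻ : ∀ {dir w} u {i} → Before dir w (u ∷ʳ i) →
             Before dir w u ⊎ (∃[ j ] ∃[ q ] w ≡ u ++ j ∷ q × Prec dir j i)
Before-∷ʳ⁻ [] (here {p = p} lt) = inj₂ (_ , p , refl , lt)
Before-∷ʳ⁻ [] (there ())
Before-∷ʳ⁻ (x ∷ u) (here lt) = inj₁ (here lt)
Before-∷ʳ⁻ (x ∷ u) (there b) with Before-∷ʳ⁻ u b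
... | inj₁ b′ = inj₁ (there b′)
... | inj₂ (j , q , refl , lt) = inj₂ (j , q , refl , lt)

data Position (dir : Bool) (u v : Vertex) : Set where
  above  : u ⊑ v → Position dir u v
  below  : v ⊑ u → Position dir u v
  before : Before dir u v → Position dir u v
  after  : Before dir v u → Position dir u v

position : ∀ dir u v → Position dir u v
position dir [] v = above (v , refl)
position dir (i ∷ u) [] = below (i ∷ u , refl)
position dir (i ∷ u) (j ∷ v) with <-cmp i j
position true (i ∷ u) (j ∷ v) | tri< lt _ _ = before (here lt)
position true (i ∷ u) (j ∷ v) | tri> _ _ gt = after (here gt)
position false (i ∷ u) (j ∷ v) | tri< lt _ _ = after (here lt)
position false (i ∷ u) (j ∷ v) | tri> _ _ gt = before (here gt)
position dir (i ∷ u) (i ∷ v) | tri≈ _ refl _ with position dir u v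
... | above (q , refl) = above (q , refl)
... | below (q , refl) = below (q , refl)
... | before b = before (there b)
... | after b = after (there b)

-- Turns a difference of depths into a list of distinct vertices, so that depths can be compared
-- with lengths of lists by `unique-⊆-length`.
branch : Vertex → List ℕ → List Vertex
branch t [] = []
branch t (i ∷ c) = (t ∷ʳ i) ∷ branch (t ∷ʳ i) c

∈-branch⁻ : ∀ t c {v} → v ∈ branch t c → ∃[ c₁ ] ∃[ c₂ ] ∃[ i ] c ≡ (i ∷ c₁) ++ c₂ × v ≡ t ++ i ∷ c₁
∈-branch⁻ t (i ∷ c) (here refl) = [] , c , i , refl , refl
∈-branch⁻ t (i ∷ c) (there v∈) with ∈-branch⁻ (t ∷ʳ i) c v∈
... | c₁ , c₂ , j , refl , refl = j ∷ c₁ , c₂ , i , refl , ∷ʳ-++ t i _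

length-branch : ∀ t c → length (branch t c) ≡ length c
length-branch t [] = refl
length-branch t (i ∷ c) = cong suc (length-branch (t ∷ʳ i) c)

branch-unique : ∀ t c → Unique (branch t c)
branch-unique t [] = []
branch-unique t (i ∷ c) = All.tabulate fresh ∷ branch-unique (t ∷ʳ i) c
  where
  fresh : ∀ {v} → v ∈ branch (t ∷ʳ i) c → t ∷ʳ i ≢ v
  fresh v∈ eq with ∈-branch⁻ (t ∷ʳ i) c v∈
  ... | c₁ , c₂ , j , _ , refl = ++-absurd (t ∷ʳ i) eq

-- The first unexplored vertex of a depth-first sequence

-- V holds the addresses, relative to p, of the vertices reached by the sequence.
FirstSpec : Bool → List Vertex → Vertex → (Vertex → Set) → Maybe Vertex → Set
FirstSpec dir E p V nothing = ∀ r → V r → p ++ r ∈ E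
FirstSpec dir E p V (just v) = ∃[ r ] ∃[ x ]
  V (r ∷ʳ x) × v ≡ p ++ (r ∷ʳ x) × v ∉ E × p ++ r ∈ E × (∀ r′ → V r′ → Before dir r′ (r ∷ʳ x) → p ++ r′ ∈ E)

FirstSpec-⇔ : ∀ {dir E p} {V W : Vertex → Set} m → (∀ r → V r → W r) → (∀ r → W r → V r) →
              FirstSpec dir E p V m → FirstSpec dir E p W m
FirstSpec-⇔ nothing f g s r w = s r (g r w)
FirstSpec-⇔ (just v) f g (r , x , Vr , eq , v∉ , r∈ , bef) = r , x , f _ Vr , eq , v∉ , r∈ , λ r′ w → bef r′ (g r′ w)

-- The second sequence matters only if the first meets nothing unexplored; otherwise the order
-- hypothesis prevents its vertices from preceding the one already found.
FirstSpec-++ : ∀ {dir E p} {V W : Vertex → Set} es fs →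
  (∀ r s → V r → W s → ¬ Before dir s r) →
  FirstSpec dir E p V (firstUnexpl E es) → FirstSpec dir E p W (firstUnexpl E fs) →
  FirstSpec dir E p (λ r → V r ⊎ W r) (firstUnexpl E (es ++ fs))
FirstSpec-++ {dir} {E} {p} {V} {W} [] fs ord s t with firstUnexpl E fs
... | nothing = λ r → λ { (inj₁ Vr) → s r Vr ; (inj₂ Wr) → t r Wr }
... | just v with t
...   | r , x , Wr , eq , v∉ , r∈ , bef = r , x , inj₂ Wr , eq , v∉ , r∈ ,
        λ r′ → λ { (inj₁ Vr′) _ → s r′ Vr′ ; (inj₂ Wr′) b → bef r′ Wr′ b }
FirstSpec-++ {dir} {E} ((_ , w) ∷ es) fs ord s t with unexplored E w
... | false = FirstSpec-++ es fs ord s t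
... | true with s
...   | r , x , Vr , eq , v∉ , r∈ , bef = r , x , inj₁ Vr , eq , v∉ , r∈ ,
        λ r′ → λ { (inj₁ Vr′) b → bef r′ Vr′ b ; (inj₂ Wr′) b → contradiction b (ord _ r′ Vr Wr′) }

Headed : ℕ → (Vertex → Set) → Vertex → Set
Headed i V r = ∃[ q ] r ≡ i ∷ q × V q

-- An unexplored child is itself the answer, so the recursive specification is needed only for an
-- explored child, where the requirement of an explored parent is met. The closing edge leads back
-- to the explored `p` and never yields an answer.
FirstSpec-block : ∀ {dir E p t} i es → p ∈ E →
  (p ∷ʳ i ∈ E → FirstSpec dir E (p ∷ʳ i) (Valid t) (firstUnexpl E es)) →
  FirstSpec dir E p (Headed i (Valid t)) (firstUnexpl E ((p , p ∷ʳ i) ∷ es ++ (p ∷ʳ i , p) ∷ []))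
FirstSpec-block {dir} {E} {p} {t} i es p∈ ih with unexplored E (p ∷ʳ i) in u
... | true = [] , i , ([] , refl , Valid-[] {t}) , refl , unexplored-true {E} u ,
      subst (_∈ E) (sym (++-identityʳ p)) p∈ ,
      λ { r′ (q , refl , _) (here lt) → contradiction lt (Prec-irrefl dir) ; r′ (q , refl , _) (there ()) }
... | false = FirstSpec-⇔ {V = λ r → Headed i (Valid t) r ⊎ ⊥} (firstUnexpl E (es ++ (p ∷ʳ i , p) ∷ []))
      (λ { r (inj₁ x) → x }) (λ _ → inj₁) (FirstSpec-++ es _ (λ _ _ _ ()) (shift _ (ih (unexplored-false {E} u))) last)
  where
  shift : ∀ m → FirstSpec dir E (p ∷ʳ i) (Valid t) m → FirstSpec dir E p (Headed i (Valid t)) m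
  shift nothing s r (q , refl , v) = subst (_∈ E) (∷ʳ-++ p i q) (s q v)
  shift (just v) (r , x , Vr , eq , v∉ , r∈ , bef) =
    i ∷ r , x , (r ∷ʳ x , refl , Vr) , trans eq (∷ʳ-++ p i _) , v∉ , subst (_∈ E) (∷ʳ-++ p i r) r∈ ,
    λ { r′ (q , refl , Vq) (here lt) → contradiction lt (Prec-irrefl dir)
      ; r′ (q , refl , Vq) (there b) → subst (_∈ E) (∷ʳ-++ p i q) (bef q Vq b) }
  last : FirstSpec dir E p (λ _ → ⊥) (firstUnexpl E ((p ∷ʳ i , p) ∷ []))
  last with unexplored E p in v
  ... | false = λ _ ()
  ... | true = contradiction p∈ (unexplored-true {E} v)

KidPath : (ℕ → Bool) → ℕ → List Tree → Vertex → Set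
KidPath ok i ts r = ∃[ j ] ∃[ t ] ∃[ q ] nth j ts ≡ just t × ok (i + j) ≡ true × r ≡ (i + j) ∷ q × Valid t q

KidPath-head : ∀ ok i t ts → ok i ≡ true → ∀ r → Headed i (Valid t) r → KidPath ok i (t ∷ ts) r
KidPath-head ok i t ts oki r (q , eq , v) =
  0 , t , q , refl , subst (λ k → ok k ≡ true) (sym (+-identityʳ i)) oki ,
  trans eq (cong (_∷ q) (sym (+-identityʳ i))) , v

KidPath-tail : ∀ ok i t ts r → KidPath ok (suc i) ts r → KidPath ok i (t ∷ ts) r
KidPath-tail ok i t ts r (j , s , q , n , okj , eq , v) =
  suc j , s , q , n , subst (λ k → ok k ≡ true) (sym (+-suc i j)) okj , trans eq (cong (_∷ q) (sym (+-suc i j))) , v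

KidPath-split : ∀ ok i t ts r → KidPath ok i (t ∷ ts) r → (ok i ≡ true × Headed i (Valid t) r) ⊎ KidPath ok (suc i) ts r
KidPath-split ok i t ts r (zero , s , q , refl , okj , eq , v) =
  inj₁ (subst (λ k → ok k ≡ true) (+-identityʳ i) okj , q , trans eq (cong (_∷ q) (+-identityʳ i)) , v)
KidPath-split ok i t ts r (suc j , s , q , n , okj , eq , v) =
  inj₂ (j , s , q , n , subst (λ k → ok k ≡ true) (+-suc i j) okj , trans eq (cong (_∷ q) (+-suc i j)) , v)

KidPath-valid : ∀ p E ts → p ∈ E → ∀ dir m → FirstSpec dir E p (KidPath (λ _ → true) 0 ts) m →
                FirstSpec dir E p (Valid (node ts)) m
KidPath-valid p E ts p∈ dir nothing s [] v = subst (_∈ E) (sym (++-identityʳ p)) p∈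
KidPath-valid p E ts p∈ dir nothing s (i ∷ q) v with Valid-∷⁻ ts i q v
... | t , n , v′ = s (i ∷ q) (i , t , q , n , refl , refl , v′)
KidPath-valid p E ts p∈ dir (just v) (r , x , (j , t , q , n , _ , eq′ , v′) , eq , v∉ , r∈ , bef) =
  r , x , subst (Valid (node ts)) (sym eq′) (Valid-∷⁺ ts j q n v′) , eq , v∉ , r∈ ,
  λ { [] _ () ; (i ∷ q) v b → let (t , n , v″) = Valid-∷⁻ ts i q v in bef (i ∷ q) (i , t , q , n , refl , refl , v″) b }

mutual
  lseqT-first : ∀ {E} p t → p ∈ E → FirstSpec true E p (Valid t) (firstUnexpl E (lseqT p t))
  lseqT-first {E} p (node ts) p∈ = KidPath-valid p E ts p∈ true (firstUnexpl E (lseqT p (node ts))) (lseqK-first (λ _ → true) p 0 ts p∈)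

  lseqK-first : ∀ {E} ok p i ts → p ∈ E → FirstSpec true E p (KidPath ok i ts) (firstUnexpl E (lseqK ok p i ts))
  lseqK-first ok p i [] p∈ r (_ , _ , _ , () , _)
  lseqK-first {E} ok p i (t ∷ ts) p∈ with ok i in oki
  ... | true = FirstSpec-⇔ (firstUnexpl E (((p , p ∷ʳ i) ∷ lseqT (p ∷ʳ i) t ++ (p ∷ʳ i , p) ∷ []) ++ lseqK ok p (suc i) ts))
      (λ r → [ KidPath-head ok i t ts oki r , KidPath-tail ok i t ts r ]′)
      (λ r k → [ inj₁ ∘ proj₂ , inj₂ ]′ (KidPath-split ok i t ts r k))
      (FirstSpec-++ ((p , p ∷ʳ i) ∷ lseqT (p ∷ʳ i) t ++ (p ∷ʳ i , p) ∷ []) (lseqK ok p (suc i) ts) ord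
        (FirstSpec-block {t = t} i (lseqT (p ∷ʳ i) t) p∈ (lseqT-first (p ∷ʳ i) t)) (lseqK-first ok p (suc i) ts p∈))
    where
    ord : ∀ r s → Headed i (Valid t) r → KidPath ok (suc i) ts s → ¬ Before true s r
    ord r s (q , refl , _) (j , _ , q′ , _ , _ , refl , _) b = <-asym (Before-heads b (<⇒≢ (s≤s (m≤m+n i j)) ∘ sym)) (s≤s (m≤m+n i j))
  ... | false = FirstSpec-⇔ (firstUnexpl E (lseqK ok p (suc i) ts)) (KidPath-tail ok i t ts)
      (λ r k → [ (λ x → ⊥-elim (false≢true oki (proj₁ x))) , id ]′ (KidPath-split ok i t ts r k))
      (lseqK-first ok p (suc i) ts p∈)

mutual
  rseqT-first : ∀ {E} p t → p ∈ E → FirstSpec false E p (Valid t) (firstUnexpl E (rseqT p t))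
  rseqT-first {E} p (node ts) p∈ = KidPath-valid p E ts p∈ false (firstUnexpl E (rseqT p (node ts))) (rseqK-first (λ _ → true) p 0 ts p∈)

  rseqK-first : ∀ {E} ok p i ts → p ∈ E → FirstSpec false E p (KidPath ok i ts) (firstUnexpl E (rseqK ok p i ts))
  rseqK-first ok p i [] p∈ r (_ , _ , _ , () , _)
  rseqK-first {E} ok p i (t ∷ ts) p∈ with ok i in oki
  ... | true = FirstSpec-⇔ (firstUnexpl E (rseqK ok p (suc i) ts ++ ((p , p ∷ʳ i) ∷ rseqT (p ∷ʳ i) t ++ (p ∷ʳ i , p) ∷ [])))
      (λ r → [ KidPath-tail ok i t ts r , KidPath-head ok i t ts oki r ]′)
      (λ r k → [ inj₂ ∘ proj₂ , inj₁ ]′ (KidPath-split ok i t ts r k))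
      (FirstSpec-++ (rseqK ok p (suc i) ts) ((p , p ∷ʳ i) ∷ rseqT (p ∷ʳ i) t ++ (p ∷ʳ i , p) ∷ []) ord
        (rseqK-first ok p (suc i) ts p∈) (FirstSpec-block {t = t} i (rseqT (p ∷ʳ i) t) p∈ (rseqT-first (p ∷ʳ i) t)))
    where
    ord : ∀ r s → KidPath ok (suc i) ts r → Headed i (Valid t) s → ¬ Before false s r
    ord r s (j , _ , q′ , _ , _ , refl , _) (q , refl , _) b = <-asym (Before-heads b (<⇒≢ (s≤s (m≤m+n i j)))) (s≤s (m≤m+n i j))
  ... | false = FirstSpec-⇔ (firstUnexpl E (rseqK ok p (suc i) ts ++ [])) (KidPath-tail ok i t ts)
      (λ r k → [ (λ x → ⊥-elim (false≢true oki (proj₁ x))) , id ]′ (KidPath-split ok i t ts r k))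
      (subst (λ es → FirstSpec false E p (KidPath ok (suc i) ts) (firstUnexpl E es)) (sym (++-identityʳ (rseqK ok p (suc i) ts))) (rseqK-first ok p (suc i) ts p∈))

-- Subtrees relative to the explored set: pending and active vertices

module Exploration (T : Tree) (B : ℕ) where

  -- The top is excluded: a division leaves it in both parts.
  In : Sub → Vertex → Set
  In S w = ∃[ i ] ∃[ q ] w ≡ top S ++ i ∷ q × i ∈ kids S × Valid T w

  Pos : Sub → Vertex → Set
  Pos S v = v ≡ top S ⊎ In S v

  record WellFormed (S : Sub) : Set where
    field
      top-valid  : Valid T (top S)
      sorted     : AllPairs _<_ (kids S)
      kids-valid : ∀ {i} → i ∈ kids S → Valid T (top S ∷ʳ i)
  open WellFormed

  Closed : List Vertex → Set
  Closed E = ∀ {u v} → u ⊑ v → v ∈ E → u ∈ E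

  Pending : Sub → List Vertex → Vertex → Set
  Pending S E w = In S w × w ∉ E

  Finished : Sub → List Vertex → Set
  Finished S E = ∀ w → In S w → w ∈ E

  Active : Sub → List Vertex → Vertex → Set
  Active S E v = In S v × v ∈ E × ∃[ w ] Pending S E w × v ⊑ w

  -- The active vertices are never listed exactly. A list containing them is enough, since only its
  -- length enters the credit and every vertex may be paid for before it is known to be active.
  Covers : Sub → List Vertex → List Vertex → Set
  Covers S E A = ∀ {v} → Active S E v → v ∈ A

  Done : Sub → List Vertex → Bool → Vertex → Set
  Done S E dir v = ∀ w → Pending S E w → ¬ Before dir w v

  AllBelow : Sub → List Vertex → Vertex → Set
  AllBelow S E p = ∀ w → Pending S E w → p ⊑ w

  In-below : ∀ {S u w} → In S u → u ⊑ w → Valid T w → In S w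
  In-below {S} (i , q , refl , i∈ , _) (r , refl) v = i , q ++ r , ++-assoc (top S) (i ∷ q) r , i∈ , v

  In-above : ∀ {S i q₁ q₂} → In S (top S ++ i ∷ (q₁ ++ q₂)) → In S (top S ++ i ∷ q₁)
  In-above {S} {i} {q₁} {q₂} (j , q , eq , j∈ , v) with ++-cancelˡ (top S) _ _ eq
  ... | refl = i , q₁ , refl , j∈ , Valid-++⁻ T (top S ++ i ∷ q₁) q₂ (subst (Valid T) (sym (++-assoc (top S) (i ∷ q₁) q₂)) v)

  top⊑In : ∀ {S w} → In S w → top S ⊑ w
  top⊑In (i , q , eq , _) = i ∷ q , eq

  top⊑Pos : ∀ {S w} → Pos S w → top S ⊑ w
  top⊑Pos (inj₁ refl) = ⊑-refl
  top⊑Pos (inj₂ w∈) = top⊑In w∈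

  In≢top : ∀ {S w} → In S w → w ≢ top S
  In≢top {S} (i , q , eq , _) refl = ++-absurd (top S) eq

  In-valid : ∀ {S w} → In S w → Valid T w
  In-valid (_ , _ , _ , _ , v) = v

  Pending-mono : ∀ {S E E′ w} → E ⊆ E′ → Pending S E′ w → Pending S E w
  Pending-mono sub (w∈ , w∉) = w∈ , λ w∈E → w∉ (sub w∈E)

  Done-mono : ∀ {S E E′ dir v} → E ⊆ E′ → Done S E dir v → Done S E′ dir v
  Done-mono sub d w p = d w (Pending-mono sub p)

  Done-above : ∀ {S E dir u v} → u ⊑ v → Done S E dir v → Done S E dir u
  Done-above u⊑v d w p b = d w p (Before-⊑ ⊑-refl u⊑v b)

  AllBelow-mono : ∀ {S E E′ p} → E ⊆ E′ → AllBelow S E p → AllBelow S E′ p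
  AllBelow-mono sub a w p = a w (Pending-mono sub p)

  ∈-vertsS⁻ : ∀ {S w} → WellFormed S → w ∈ vertsS T S → Pos S w
  ∈-vertsS⁻ {S} {w} wf w∈ with at T (top S) in eq
  ∈-vertsS⁻ wf (here refl) | node ts = inj₁ refl
  ∈-vertsS⁻ {S} wf (there w∈) | node ts with ∈-vertsK⁻ _ (top S) 0 ts w∈
  ... | j , t , q , n , ok , refl , v = inj₂ (j , q , refl , ∈ℕ-true ok ,
        Valid-at T (top S) (j ∷ q) (top-valid wf) (subst (λ s → Valid s (j ∷ q)) (sym eq) (Valid-∷⁺ ts j q n v)))

  ∈-vertsS⁺ : ∀ {S w} → In S w → w ∈ vertsS T S
  ∈-vertsS⁺ {S} (i , q , refl , i∈ , v) with at T (top S) | Valid-at⁻ T (top S) (i ∷ q) v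
  ... | node ts | v′ with Valid-∷⁻ ts i q v′
  ...   | t , n , v″ = there (∈-vertsK⁺ _ (top S) 0 ts i q n (∈ℕ-intro i∈) v″)

  ∈-vertsAt⁻ : ∀ {v w} → Valid T v → w ∈ vertsT v (at T v) → v ⊑ w × Valid T w
  ∈-vertsAt⁻ {v} val w∈ with ∈-vertsT⁻ (at T v) w∈
  ... | q , refl , vq = (q , refl) , Valid-at T v q val vq

  ∈-vertsAt⁺ : ∀ {v w} → v ⊑ w → Valid T w → w ∈ vertsT v (at T v)
  ∈-vertsAt⁺ {v} (q , refl) val = ∈-vertsT⁺ (at T v) q (Valid-at⁻ T v q val)

  finished : ∀ {S E} → hasUnexpl E (vertsS T S) ≡ false → Finished S E
  finished {S} eq w w∈ = hasUnexpl-false (vertsS T S) eq (∈-vertsS⁺ w∈)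

  unfinished : ∀ {S E} → WellFormed S → top S ∈ E → hasUnexpl E (vertsS T S) ≡ true → ∃[ w ] Pending S E w
  unfinished {S} wf t∈ eq with hasUnexpl-true (vertsS T S) eq
  ... | w , w∈ , w∉ with ∈-vertsS⁻ wf w∈
  ...   | inj₁ refl = contradiction t∈ w∉
  ...   | inj₂ w∈S = w , w∈S , w∉

  below-pending : ∀ {S E cur} → WellFormed S → Pos S cur → cur ∈ E →
    hasUnexpl E (belowIn T S cur) ≡ true → ∃[ w ] Pending S E w × cur ⊑ w
  below-pending {S} {E} {cur} wf pos c∈ eq with cur == top S in e
  ... | true with ==-true e
  ...   | refl with unfinished wf c∈ eq
  ...     | w , p = w , p , top⊑In (proj₁ p)
  below-pending {S} {E} {cur} wf (inj₁ refl) c∈ eq | false = ⊥-elim (false≢true e (==-refl (top S)))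
  below-pending {S} {E} {cur} wf (inj₂ c∈S) c∈ eq | false with hasUnexpl-true (vertsT cur (at T cur)) eq
  ... | w , w∈ , w∉ with ∈-vertsAt⁻ (In-valid c∈S) w∈
  ...   | c⊑w , val = w , (In-below c∈S c⊑w val , w∉) , c⊑w

  below-explored : ∀ {S E cur} → hasUnexpl E (belowIn T S cur) ≡ false →
    ∀ {w} → Pending S E w → ¬ (cur ⊑ w)
  below-explored {S} {E} {cur} eq {w} (w∈ , w∉) c⊑w with cur == top S
  ... | true = w∉ (finished eq w w∈)
  ... | false = w∉ (hasUnexpl-false (vertsT cur (at T cur)) eq (∈-vertsAt⁺ c⊑w (In-valid w∈)))

  kidsOf-sorted : ∀ v → AllPairs _<_ (kidsOf T v)
  kidsOf-sorted v = AllPairs.applyUpTo⁺₁ id _ (λ i<j _ → i<j)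

  kidsIn-top : ∀ S → kidsIn T S (top S) ≡ kids S
  kidsIn-top S rewrite ==-refl (top S) = refl

  kidsIn-below : ∀ {S v} → In S v → kidsIn T S v ≡ kidsOf T v
  kidsIn-below v∈ rewrite ==-≢ (In≢top v∈) = refl

  kidsIn-sorted : ∀ {S v} → WellFormed S → Pos S v → AllPairs _<_ (kidsIn T S v)
  kidsIn-sorted {S} wf (inj₁ refl) rewrite kidsIn-top S = sorted wf
  kidsIn-sorted {S} {v} wf (inj₂ v∈) rewrite kidsIn-below v∈ = kidsOf-sorted v

  kidsIn-In : ∀ {S v i} → WellFormed S → Pos S v → i ∈ kidsIn T S v → In S (v ∷ʳ i)
  kidsIn-In {S} {v} {i} wf (inj₁ refl) i∈ rewrite kidsIn-top S = i , [] , refl , i∈ , kids-valid wf i∈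
  kidsIn-In {S} {v} {i} wf (inj₂ v∈) i∈ rewrite kidsIn-below v∈ =
    In-below v∈ ⊑-∷ʳ (Valid-child⁺ T v i (In-valid v∈) (∈-upTo⁻ i∈))

  ∈-kidsIn : ∀ {S v j q} → Pos S v → In S (v ++ j ∷ q) → j ∈ kidsIn T S v
  ∈-kidsIn {S} (inj₁ refl) (i , q , eq , i∈ , _) rewrite kidsIn-top S with ++-cancelˡ (top S) _ _ eq
  ... | refl = i∈
  ∈-kidsIn {S} {v} {j} {q} (inj₂ v∈) w∈ rewrite kidsIn-below v∈ = ∈-upTo⁺ (Valid-child⁻ T v j q (In-valid w∈))

  leading⁻ : ∀ {S E v i} → WellFormed S → Pos S v → i ∈ leadingKids T E S v →
             In S (v ∷ʳ i) × ∃[ w ] Pending S E w × (v ∷ʳ i) ⊑ w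
  leading⁻ {S} {E} {v} {i} wf pos i∈ with ∈-filterᵇ⁻ (λ i → hasUnexpl E (vertsT (v ∷ʳ i) (at T (v ∷ʳ i)))) i∈
  ... | i∈K , h with kidsIn-In wf pos i∈K | hasUnexpl-true (vertsT (v ∷ʳ i) (at T (v ∷ʳ i))) h
  ...   | vi∈ | w , w∈ , w∉ with ∈-vertsAt⁻ (In-valid vi∈) w∈
  ...     | le , val = vi∈ , w , (In-below vi∈ le val , w∉) , le

  leading⁺ : ∀ {S E v j q} → Pos S v → Pending S E (v ++ j ∷ q) → j ∈ leadingKids T E S v
  leading⁺ {S} {E} {v} {j} {q} pos (w∈ , w∉) =
    ∈-filterᵇ⁺ _ (∈-kidsIn pos w∈)
      (hasUnexpl-intro (∈-vertsAt⁺ (q , sym (∷ʳ-++ v j q)) (In-valid w∈)) w∉)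

  leading-sorted : ∀ {S E v} → WellFormed S → Pos S v → AllPairs _<_ (leadingKids T E S v)
  leading-sorted wf pos = AllPairs.filter⁺ _ (kidsIn-sorted wf pos)

  -- One depth-first search and its amortised cost

  ordered : Bool → List ℕ → List ℕ
  ordered left xs = if left then xs else reverse xs

  head-last : ∀ xs {i} → AllPairs _<_ xs → headM (reverse xs) ≡ just i → i ∈ xs × (∀ {j} → j ∈ xs → j ≤ i)
  head-last (x ∷ []) _ refl = here refl , λ { (here refl) → ≤-refl }
  head-last (x ∷ y ∷ xs) {i} (x< ∷ s) eq with head-last (y ∷ xs) s (trans (sym (headM-++ (reverse (y ∷ xs)) ne)) (trans (cong headM (sym (unfold-reverse x (y ∷ xs)))) eq))
    where
    headM-++ : ∀ (zs : List ℕ) {w ws} → zs ≢ [] → headM (zs ++ w ∷ ws) ≡ headM zs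
    headM-++ [] ne = contradiction refl ne
    headM-++ (z ∷ zs) _ = refl
    ne : reverse (y ∷ xs) ≢ []
    ne e with trans (sym (reverse-involutive (y ∷ xs))) (cong reverse e)
    ... | ()
  ... | i∈ , max = there i∈ , λ { (here refl) → <⇒≤ (All.lookup x< i∈) ; (there j∈) → max j∈ }

  next-kid : ∀ dir xs {i} → AllPairs _<_ xs → headM (ordered dir xs) ≡ just i →
             i ∈ xs × (∀ {j} → j ∈ xs → ¬ Prec dir j i)
  next-kid true (x ∷ xs) (x< ∷ _) refl = here refl , λ { (here refl) → <-irrefl refl ; (there j∈) → <-asym (All.lookup x< j∈) }
  next-kid false xs s eq with head-last xs s eq
  ... | i∈ , max = i∈ , λ j∈ → ≤⇒≯ (max j∈)

  no-next-kid : ∀ dir xs → headM (ordered dir xs) ≡ nothing → ∀ {j} → j ∉ xs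
  no-next-kid true (x ∷ xs) () j∈
  no-next-kid false xs eq j∈ with reverse xs | Any.reverse⁺ j∈
  ... | z ∷ zs | _ with eq
  ...   | ()

  parent-∷ʳ : ∀ u x → parent (u ∷ʳ x) ≡ u
  parent-∷ʳ u x rewrite reverse-++ u (x ∷ []) = reverse-involutive u

  Pos-parent : ∀ {S v} → In S v → ∃[ u ] ∃[ x ] v ≡ u ∷ʳ x × Pos S u
  Pos-parent {S} (i , q , refl , i∈ , val) with initLast q
  ... | [] = top S , i , refl , inj₁ refl
  ... | q′ ∷ʳ′ x = top S ++ i ∷ q′ , x , sym (++-assoc (top S) (i ∷ q′) (x ∷ [])) ,
        inj₂ (In-above {S} {i} {q′} {x ∷ []} (i , q′ ∷ʳ x , refl , i∈ , val))

  -- The depth of p pays for the steps of the agent down to explored vertices.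
  -- F holds the active vertices left by runs in the other direction.
  record Searching (dir : Bool) (F : Vertex → Set) (S : Sub) (E A : List Vertex) (p cur : Vertex) : Set where
    field
      closed    : Closed E
      pos       : Pos S cur
      cur∈      : cur ∈ E
      -- Not implied by `covers`: a vertex on the current path may have nothing pending below it. It
      -- is still charged for, and the charge is returned when the agent leaves it upwards.
      path      : ∀ {v} → In S v → v ⊑ cur → v ∈ A
      covers    : Covers S E A
      cur-done  : Done S E dir cur
      sides     : ∀ {v} → Active S E v → v ⊑ cur ⊎ F v
      far-done  : ∀ {v} → F v → Done S E (not dir) v
      all-below : AllBelow S E p
      p⊑cur     : p ⊑ cur

  -- The inequality is the balance of the run: six times the count, plus three times the depth of
  -- the marker `p`, minus three times the length of the list, grows by at least 3 for each of the
  -- `e` moves. The marker moves only onto vertices satisfying `F`, hence not at all if `F` is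
  -- empty. The bound on its depth ensures that the loan never exceeds the store.
  Progress : (Vertex → Set) → Sub → List Vertex → Vertex → ℕ → List Vertex → List Vertex → Set
  Progress F S A p e E E′ = ∃[ A′ ] ∃[ p′ ] Covers S E′ A′ × AllBelow S E′ p′ × p′ ∈ E′ × (p′ ≡ p ⊎ ∃[ v ] F v) ×
    depth p′ ≤ depth (top S) + length A′ ×
    6 * count E + 3 * e + 3 * length A′ + 3 * depth p ≤ 6 * count E′ + 3 * length A + 3 * depth p′

  record Searched (dir : Bool) (S : Sub) (e D : ℕ) (E E′ : List Vertex) : Set where
    field
      extends : E ⊆ E′
      closed  : Closed E′
      fresh   : List Vertex
      fresh-≤ : length fresh ≤ e
      new     : ∀ {v} → v ∈ E′ → v ∈ E ⊎ (v ∈ fresh × In S v)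
      shallow : ∀ {v} → v ∈ E′ → v ∈ E ⊎ depth v ≤ D
      new-done : ∀ {v} → v ∈ E′ → v ∈ E ⊎ Done S E′ dir v

  stay : ∀ {dir S e D E} → Closed E → Searched dir S e D E E
  stay cl = record { extends = id ; closed = cl ; fresh = [] ; fresh-≤ = z≤n ; new = inj₁ ; shallow = inj₁ ; new-done = inj₁ }

  branch⊆ : ∀ {S A c} → Pos S (top S ++ c) → (∀ {v} → In S v → v ⊑ (top S ++ c) → v ∈ A) → branch (top S) c ⊆ A
  branch⊆ {S} {A} {c} pos path v∈ with ∈-branch⁻ (top S) c v∈
  ... | c₁ , c₂ , i , refl , refl with pos
  ...   | inj₁ eq = contradiction (sym eq) (++-absurd (top S))
  ...   | inj₂ c∈ = path (In-above {S} {i} {c₁} {c₂} c∈) (c₂ , sym (++-assoc (top S) (i ∷ c₁) c₂))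

  path-length : ∀ {S A cur} → Pos S cur → (∀ {v} → In S v → v ⊑ cur → v ∈ A) → depth cur ≤ depth (top S) + length A
  path-length {S} {A} pos path with top⊑Pos pos
  ... | c , refl = begin
    depth (top S ++ c)                       ≡⟨ length-++ (top S) ⟩
    depth (top S) + length c                 ≡⟨ cong (depth (top S) +_) (length-branch (top S) c) ⟨
    depth (top S) + length (branch (top S) c) ≤⟨ +-monoʳ-≤ (depth (top S)) (unique-⊆-length (branch-unique (top S) c) (branch⊆ pos path)) ⟩
    depth (top S) + length A                 ∎
    where open ≤-Reasoning

  -- A vertex left upwards drops out of the list, and the 3 credits held for it pay for the move.
  up-arith : ∀ c c′ e a a₁ a′ p p′ → suc a₁ ≤ a → 6 * c + 3 * e + 3 * a′ + 3 * p ≤ 6 * c′ + 3 * a₁ + 3 * p′ →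
             6 * c + 3 * suc e + 3 * a′ + 3 * p ≤ 6 * c′ + 3 * a + 3 * p′
  up-arith c c′ e a a₁ a′ p p′ le h = begin
    6 * c + 3 * suc e + 3 * a′ + 3 * p    ≡⟨ lhs c e a′ p ⟩
    6 * c + 3 * e + 3 * a′ + 3 * p + 3    ≤⟨ +-monoˡ-≤ 3 h ⟩
    6 * c′ + 3 * a₁ + 3 * p′ + 3          ≡⟨ rhs c′ a₁ p′ ⟩
    6 * c′ + 3 * suc a₁ + 3 * p′          ≤⟨ +-monoˡ-≤ (3 * p′) (+-monoʳ-≤ (6 * c′) (*-monoʳ-≤ 3 le)) ⟩
    6 * c′ + 3 * a + 3 * p′               ∎
    where
    open ≤-Reasoning
    lhs : ∀ c e a p → 6 * c + 3 * suc e + 3 * a + 3 * p ≡ 6 * c + 3 * e + 3 * a + 3 * p + 3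
    lhs = solve-∀
    rhs : ∀ c a p → 6 * c + 3 * a + 3 * p + 3 ≡ 6 * c + 3 * suc a + 3 * p
    rhs = solve-∀

  -- Of the 6 credits of a new vertex, 3 pay for the move and 3 are set aside for its place in the
  -- list.
  new-arith : ∀ c c₁ c′ e a a′ p p′ → suc c ≤ c₁ → 6 * c₁ + 3 * e + 3 * a′ + 3 * p ≤ 6 * c′ + 3 * suc a + 3 * p′ →
              6 * c + 3 * suc e + 3 * a′ + 3 * p ≤ 6 * c′ + 3 * a + 3 * p′
  new-arith c c₁ c′ e a a′ p p′ le h = +-cancelʳ-≤ 3 _ _ (begin
    6 * c + 3 * suc e + 3 * a′ + 3 * p + 3  ≡⟨ lhs c e a′ p ⟩
    6 * suc c + 3 * e + 3 * a′ + 3 * p      ≤⟨ +-monoˡ-≤ (3 * p) (+-monoˡ-≤ (3 * a′) (+-monoˡ-≤ (3 * e) (*-monoʳ-≤ 6 le))) ⟩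
    6 * c₁ + 3 * e + 3 * a′ + 3 * p         ≤⟨ h ⟩
    6 * c′ + 3 * suc a + 3 * p′             ≡⟨ rhs c′ a p′ ⟩
    6 * c′ + 3 * a + 3 * p′ + 3             ∎)
    where
    open ≤-Reasoning
    lhs : ∀ c e a p → 6 * c + 3 * suc e + 3 * a + 3 * p + 3 ≡ 6 * suc c + 3 * e + 3 * a + 3 * p
    lhs = solve-∀
    rhs : ∀ c a p → 6 * c + 3 * suc a + 3 * p ≡ 6 * c + 3 * a + 3 * p + 3
    rhs = solve-∀

  -- Neither a new vertex nor the list can pay here; the marker goes at least one level deeper, and
  -- the loan taken on this level covers the move.
  shared-arith : ∀ c c₁ c′ e a a′ p p₁ p′ → c ≤ c₁ → suc p ≤ p₁ → 6 * c₁ + 3 * e + 3 * a′ + 3 * p₁ ≤ 6 * c′ + 3 * a + 3 * p′ →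
                 6 * c + 3 * suc e + 3 * a′ + 3 * p ≤ 6 * c′ + 3 * a + 3 * p′
  shared-arith c c₁ c′ e a a′ p p₁ p′ le le′ h = begin
    6 * c + 3 * suc e + 3 * a′ + 3 * p   ≡⟨ lhs c e a′ p ⟩
    6 * c + 3 * e + 3 * a′ + 3 * suc p   ≤⟨ +-mono-≤ (+-monoˡ-≤ (3 * a′) (+-monoˡ-≤ (3 * e) (*-monoʳ-≤ 6 le))) (*-monoʳ-≤ 3 le′) ⟩
    6 * c₁ + 3 * e + 3 * a′ + 3 * p₁     ≤⟨ h ⟩
    6 * c′ + 3 * a + 3 * p′              ∎
    where
    open ≤-Reasoning
    lhs : ∀ c e a p → 6 * c + 3 * suc e + 3 * a + 3 * p ≡ 6 * c + 3 * e + 3 * a + 3 * suc p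
    lhs = solve-∀

  Closed-∷ : ∀ {E u i} → Closed E → u ∈ E → Closed ((u ∷ʳ i) ∷ E)
  Closed-∷ cl u∈ {w} w⊑ (here refl) with ⊑-∷ʳ⁻ w⊑
  ... | inj₁ refl = here refl
  ... | inj₂ w⊑u = there (cl w⊑u u∈)
  Closed-∷ cl u∈ w⊑ (there v∈) = there (cl w⊑ v∈)

  Active-∷⁻ : ∀ {S E u v} → Active S (u ∷ E) v → v ≡ u ⊎ Active S E v
  Active-∷⁻ (v∈ , here refl , _) = inj₁ refl
  Active-∷⁻ (v∈ , there v∈E , w , p , le) = inj₂ (v∈ , v∈E , w , Pending-mono there p , le)

  module _ {dir : Bool} {F : Vertex → Set} {S : Sub} (wf : WellFormed S) where
    open Searching

    child-done : ∀ {E cur i} → Pos S cur → Done S E dir cur →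
      (∀ {j} → j ∈ leadingKids T E S cur → ¬ Prec dir j i) → Done S E dir (cur ∷ʳ i)
    child-done {cur = cur} pos d first w p b with Before-∷ʳ⁻ cur b
    ... | inj₁ b′ = d w p b′
    ... | inj₂ (j , q , refl , lt) = first (leading⁺ pos p) lt

    step-up : ∀ {E A p u x} → Searching dir F S E A p (u ∷ʳ x) → Pos S u → ∃[ w ] Pending S E w →
      (∀ {w} → Pending S E w → ¬ ((u ∷ʳ x) ⊑ w)) → Searching dir F S E (A \\ (u ∷ʳ x)) p u
    step-up {E} {A} {p} {u} {x} s pos-u (w₀ , pend₀) none = record
      { closed = closed s
      ; pos = pos-u
      ; cur∈ = closed s ⊑-∷ʳ (cur∈ s)
      ; path = λ v∈ v⊑u → ∈-\\⁺ (path s v∈ (⊑-trans v⊑u ⊑-∷ʳ)) λ { refl → child-⋢ refl v⊑u }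
      ; covers = λ a → ∈-\\⁺ (covers s a) λ { refl → let (_ , _ , w , pend , le) = a in none pend le }
      ; cur-done = Done-above ⊑-∷ʳ (cur-done s)
      ; sides = λ a → [ (λ le → [ (λ { refl → let (_ , _ , w , pend , le′) = a in contradiction le′ (none pend) }) , inj₁ ]′ (⊑-∷ʳ⁻ {v = u} {x} le)) , inj₂ ]′ (sides s a)
      ; far-done = far-done s
      ; all-below = all-below s
      -- The marker cannot be the vertex being left: something is still pending, it lies below the
      -- marker, and nothing pending lies below that vertex.
      ; p⊑cur = [ (λ { refl → contradiction (all-below s w₀ pend₀) (none pend₀) }) , id ]′ (⊑-∷ʳ⁻ {v = u} {x} (p⊑cur s))
      }

    -- The list and the marker after the step are left open, because a new vertex enlarges the list
    -- while an explored one moves the marker.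
    step-down : ∀ {E A A′ p p′ cur i} → Searching dir F S E A p cur → In S (cur ∷ʳ i) →
      Done S E dir (cur ∷ʳ i) →
      A ⊆ A′ → cur ∷ʳ i ∈ A′ → AllBelow S E p′ → p′ ⊑ (cur ∷ʳ i) →
      Searching dir F S ((cur ∷ʳ i) ∷ E) A′ p′ (cur ∷ʳ i)
    step-down {cur = cur} {i} s v∈ v-done A⊆ v∈A ab p′⊑ = record
      { closed = Closed-∷ (closed s) (cur∈ s)
      ; pos = inj₂ v∈
      ; cur∈ = here refl
      ; path = λ w∈ w⊑ → [ (λ { refl → v∈A }) , (λ le → A⊆ (path s w∈ le)) ]′ (⊑-∷ʳ⁻ {v = cur} {i} w⊑)
      ; covers = λ a → [ (λ { refl → v∈A }) , (λ a′ → A⊆ (covers s a′)) ]′ (Active-∷⁻ a)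
      ; cur-done = Done-mono {S} {dir = dir} there v-done
      ; sides = λ a → [ (λ { refl → inj₁ ⊑-refl }) ,
                        (λ a′ → [ (λ le → inj₁ (⊑-trans le ⊑-∷ʳ)) , inj₂ ]′ (sides s a′)) ]′ (Active-∷⁻ a)
      ; far-done = λ f → Done-mono {S} {dir = not dir} there (far-done s f)
      ; all-below = AllBelow-mono {S} there ab
      ; p⊑cur = p′⊑
      }

    -- An explored vertex off the current path is done on the far side, and the
    -- next vertex of the search is done on the near side.
    shared-below : ∀ {E A p cur i} → Searching dir F S E A p cur → In S (cur ∷ʳ i) →
      (∀ {j} → j ∈ leadingKids T E S cur → ¬ Prec dir j i) → Active S E (cur ∷ʳ i) → AllBelow S E (cur ∷ʳ i)
    shared-below {cur = cur} {i} s v∈ first act w pend with position dir w (cur ∷ʳ i)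
    ... | above le = contradiction (closed s le (proj₁ (proj₂ act))) (proj₂ pend)
    ... | below le = le
    ... | before b = contradiction b (child-done (pos s) (cur-done s) first w pend)
    ... | after b with sides s act
    ...   | inj₁ le = contradiction le (child-⋢ refl)
    ...   | inj₂ f = contradiction (Before-flip b) (far-done s f w pend)

    extend : ∀ {e E cur i E′} → In S (cur ∷ʳ i) → Done S E dir (cur ∷ʳ i) →
      Searched dir S e (depth (cur ∷ʳ i) + e) ((cur ∷ʳ i) ∷ E) E′ → Searched dir S (suc e) (depth cur + suc e) E E′
    extend {e} {E} {cur} {i} {E′} v∈ v-done r = record
      { extends = λ z → Searched.extends r (there z)
      ; closed = Searched.closed r
      ; fresh = (cur ∷ʳ i) ∷ Searched.fresh r
      ; fresh-≤ = s≤s (Searched.fresh-≤ r)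
      ; new = λ z → [ (λ { (here refl) → inj₂ (here refl , v∈) ; (there z∈) → inj₁ z∈ }) , (λ (z∈ , z∈S) → inj₂ (there z∈ , z∈S)) ]′ (Searched.new r z)
      ; shallow = λ z → [ (λ { (here refl) → inj₂ (≤-trans (m≤m+n _ e) (≤-reflexive dep)) ; (there z∈) → inj₁ z∈ }) , (λ le → inj₂ (≤-trans le (≤-reflexive dep))) ]′ (Searched.shallow r z)
      ; new-done = λ z → [ (λ { (here refl) → inj₂ (Done-mono {S} {dir = dir} (λ z → Searched.extends r (there z)) v-done) ; (there z∈) → inj₁ z∈ }) , inj₂ ]′ (Searched.new-done r z)
      }
      where
      dep : depth (cur ∷ʳ i) + e ≡ depth cur + suc e
      dep = trans (cong (_+ e) (length-∷ʳ′ cur i)) (sym (+-suc (depth cur) e))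

    new-gain : ∀ {e E A p v E′} → v ∉ E → Progress F S (v ∷ A) p e (v ∷ E) E′ → Progress F S A p (suc e) E E′
    new-gain {e} {E} {A} {p} {v} {E′} v∉ (A′ , p′ , cov , ab , p∈ , o , len , ineq) = A′ , p′ , cov , ab , p∈ , o , len ,
      new-arith (count E) (count (v ∷ E)) (count E′) e (length A) (length A′) (depth p) (depth p′) (count-grows v∉ (here refl) there) ineq

    -- Induction on the energy. A run that stops because the subtree is finished needs no balance,
    -- since such a subtree holds no credit; every other move is of one of three kinds: up, down to
    -- a new vertex, or down to an explored one.
    dfs-search : ∀ e {E A p cur} → Searching dir F S E A p cur → top S ∈ E →
      let E′ = dfs T dir S cur e E in
      Searched dir S e (depth cur + e) E E′ × (Finished S E′ ⊎ Progress F S A p e E E′)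
    dfs-search zero {E} {A} {p} {cur} s t∈ = stay (closed s) , inj₂ (A , p , covers s , all-below s , closed s (p⊑cur s) (cur∈ s) , inj₁ refl ,
      ≤-trans (⊑-depth (p⊑cur s)) (path-length (pos s) (path s)) ,
      ≤-reflexive (eq (6 * count E) (3 * length A) (3 * depth p)))
      where
      eq : ∀ c a p → c + 0 + a + p ≡ c + a + p
      eq = solve-∀
    dfs-search (suc e) {E} {A} {p} {cur} s t∈ with hasUnexpl E (vertsS T S) in h₁
    ... | false = stay (closed s) , inj₁ (finished h₁)
    ... | true with unfinished wf t∈ h₁ | hasUnexpl E (belowIn T S cur) in h₂
    ... | w₀ , pend₀ | false with pos s
    ...   | inj₁ refl = contradiction (top⊑In (proj₁ pend₀)) (below-explored h₂ pend₀)
    ...   | inj₂ c∈ with Pos-parent c∈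
    ...     | u , x , refl , pos-u rewrite parent-∷ʳ u x
              with dfs-search e (step-up s pos-u (w₀ , pend₀) (below-explored h₂)) t∈
    ...       | r , out = weaken r , [ inj₁ , inj₂ ∘ gain ]′ out
      where
      weaken : ∀ {E′} → Searched dir S e (depth u + e) E E′ → Searched dir S (suc e) (depth (u ∷ʳ x) + suc e) E E′
      weaken r = record { Searched r ; fresh-≤ = m≤n⇒m≤1+n (Searched.fresh-≤ r)
                        ; shallow = λ v∈ → [ inj₁ , (λ le → inj₂ (≤-trans le (+-mono-≤ (⊑-depth (⊑-∷ʳ {u} {x})) (n≤1+n e)))) ]′ (Searched.shallow r v∈) }
      gain : ∀ {E′} → Progress F S (A \\ (u ∷ʳ x)) p e E E′ → Progress F S A p (suc e) E E′
      gain {E′} (A′ , p′ , cov , ab , p∈ , o , len , ineq) = A′ , p′ , cov , ab , p∈ , o , len ,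
        up-arith (count E) (count E′) e (length A) (length (A \\ (u ∷ʳ x))) (length A′) (depth p) (depth p′) (length-\\ (path s c∈ ⊑-refl)) ineq
    dfs-search (suc e) {E} {A} {p} {cur} s t∈ | true | w₀ , pend₀ | true
      with headM (ordered dir (leadingKids T E S cur)) in h₃
    ... | nothing = contradiction lead (no-next-kid dir _ h₃)
      where
      bp : ∃[ w ] Pending S E w × cur ⊑ w
      bp = below-pending {E = E} wf (pos s) (cur∈ s) h₂
      extra : ∃[ j ] ∃[ q ] proj₁ bp ≡ cur ++ j ∷ q
      extra with bp
      ... | w , pend , [] , eq = contradiction (subst (_∈ E) (trans (sym (++-identityʳ cur)) (sym eq)) (cur∈ s)) (proj₂ pend)
      ... | w , pend , j ∷ q , eq = j , q , eq
      lead : proj₁ extra ∈ leadingKids T E S cur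
      lead = leading⁺ (pos s) (subst (Pending S E) (proj₂ (proj₂ extra)) (proj₁ (proj₂ bp)))
    ... | just i with next-kid dir (leadingKids T E S cur) (leading-sorted {E = E} wf (pos s)) h₃
    ...   | i∈ , first with leading⁻ wf (pos s) i∈
    ...     | v∈ , w , pend , le with (cur ∷ʳ i) ∈? E
    ...       | no v∉ with dfs-search e (step-down {A′ = (cur ∷ʳ i) ∷ A} s v∈ (child-done (pos s) (cur-done s) first) there (here refl) (all-below s) (⊑-trans (p⊑cur s) ⊑-∷ʳ)) (there t∈)
    ...         | r , out = extend v∈ (child-done (pos s) (cur-done s) first) r , [ inj₁ , inj₂ ∘ new-gain {A = A} {p} v∉ ]′ out
    dfs-search (suc e) {E} {A} {p} {cur} s t∈ | true | w₀ , pend₀ | true | just i | i∈ , first | v∈ , w , pend , le | yes v∈E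
      with shared-below s v∈ first (v∈ , v∈E , w , pend , le)
    ... | ab with dfs-search e (step-down s v∈ (child-done (pos s) (cur-done s) first) id (covers s (v∈ , v∈E , w , pend , le)) ab ⊑-refl) (there t∈)
    ...   | r , out = extend v∈ (child-done (pos s) (cur-done s) first) r , [ inj₁ , inj₂ ∘ gain ]′ out
      where
      is-far : F (cur ∷ʳ i)
      is-far = [ (λ c → contradiction c (child-⋢ refl)) , id ]′ (sides s (v∈ , v∈E , w , pend , le))
      gain : ∀ {E′} → Progress F S A (cur ∷ʳ i) e ((cur ∷ʳ i) ∷ E) E′ → Progress F S A p (suc e) E E′
      gain {E′} (A′ , p′ , cov , ab , p∈ , _ , len , ineq) = A′ , p′ , cov , ab , p∈ , inj₂ (cur ∷ʳ i , is-far) , len ,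
        shared-arith (count E) (count ((cur ∷ʳ i) ∷ E)) (count E′) e (length A) (length A′) (depth p) (depth (cur ∷ʳ i)) (depth p′)
          (count-mono {E} there) (≤-trans (s≤s (⊑-depth (p⊑cur s))) (≤-reflexive (sym (length-∷ʳ′ cur i)))) ineq

  -- Descending to the branching vertex

  Sides : Sub → List Vertex → Set
  Sides S E = ∀ {v} → Active S E v → Done S E true v ⊎ Done S E false v

  -- The step `i` after `c` makes the pending vertices lie strictly below the child: if the child
  -- itself were unexplored, the top could not descend to it.
  Stuck : Sub → List Vertex → Set
  Stuck S E = ∀ c → ¬ (∀ w → Pending S E w → ∃[ i ] ∃[ q ] w ≡ top S ++ c ∷ i ∷ q)

  fullSub-WF : ∀ {v} → Valid T v → WellFormed (fullSub T v)
  fullSub-WF {v} val = record { top-valid = val ; sorted = kidsOf-sorted v ; kids-valid = λ {i} i∈ → Valid-child⁺ T v i val (∈-upTo⁻ i∈) }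

  In-fullSub : ∀ {v i q} → Valid T (v ++ i ∷ q) → In (fullSub T v) (v ++ i ∷ q)
  In-fullSub {v} {i} {q} val = i , q , refl , ∈-upTo⁺ (Valid-child⁻ T v i q val) , val

  record Descended (E A Q : List Vertex) (S S′ : Sub) : Set where
    field
      wf       : WellFormed S′
      top∈     : top S′ ∈ E
      {A′ Q′}  : List Vertex
      {s}      : ℕ
      covers   : Covers S′ E A′
      sides    : Sides S′ E
      Q⊆       : Q ⊆ Q′
      above∈   : ∀ {u} → u ⊑ top S′ → u ∈ Q′
      Q′-≤     : length Q′ ≤ s + length Q
      A′-≤     : s + length A′ ≤ length A
      top-depth : depth (top S′) ≡ s + depth (top S)
      stuck    : Stuck S′ E
      narrower : ∀ {w} → In S′ w → In S w
      keeps    : ∀ {w} → Pending S E w → In S′ w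

  sides-narrow : ∀ {S S′ E} → (∀ {w} → In S′ w → In S w) → Sides S E → Sides S′ E
  sides-narrow {S} {S′} {E} nar sd (v∈ , v∈E , w , (w∈ , w∉) , le) with sd (nar v∈ , v∈E , w , (nar w∈ , w∉) , le)
  ... | inj₁ d = inj₁ λ w (w∈ , w∉) → d w (nar w∈ , w∉)
  ... | inj₂ d = inj₂ λ w (w∈ , w∉) → d w (nar w∈ , w∉)

  module _ {E : List Vertex} (closed : Closed E) where

    descend-stop : ∀ {A Q S} → WellFormed S → top S ∈ E → Covers S E A → Sides S E →
      (∀ {u} → u ⊑ top S → u ∈ Q) → Stuck S E → Descended E A Q S S
    descend-stop wf t∈ cov sd ab st = record
      { wf = wf ; top∈ = t∈ ; covers = cov ; sides = sd ; Q⊆ = id ; above∈ = ab ; Q′-≤ = ≤-refl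
      ; A′-≤ = ≤-refl ; top-depth = refl ; stuck = st ; narrower = id ; keeps = proj₁ }

    -- The top stays a vertex of `T`, whose depth is below `size T`, so the fuel outlasts the
    -- descent. A child onto which the top moves is explored and has something pending below it; it
    -- was therefore active, and by becoming the top it leaves the list.
    descend-spec : ∀ f {A Q} S → size T ≤ f + depth (top S) → WellFormed S → top S ∈ E → ∃[ w ] Pending S E w →
      Covers S E A → Sides S E → (∀ {u} → u ⊑ top S → u ∈ Q) → Descended E A Q S (descend T E f S)
    descend-spec zero S fuel wf t∈ _ _ _ _ = contradiction (Valid-depth T (top S) (top-valid wf)) (≤⇒≯ fuel)
    descend-spec (suc f) {A} {Q} S fuel wf t∈ (w₀ , pend₀@((i₀ , q₀ , refl , _) , _)) cov sd ab
      with leadingKids T E S (top S) in eq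
    ... | [] = contradiction (subst (i₀ ∈_) eq (leading⁺ (inj₁ refl) pend₀)) λ ()
    ... | c ∷ c′ ∷ cs = descend-stop wf t∈ cov sd ab st
      where
      st : Stuck S E
      st d all-d with subst (AllPairs _<_) eq (leading-sorted {E = E} wf (inj₁ refl))
      ... | (c<c′ ∷ _) ∷ _ = <-irrefl (trans (only (subst (c ∈_) (sym eq) (here refl))) (sym (only (subst (c′ ∈_) (sym eq) (there (here refl)))))) c<c′
        where
        only : ∀ {j} → j ∈ leadingKids T E S (top S) → j ≡ d
        only {j} j∈ with leading⁻ wf (inj₁ refl) j∈
        ... | _ , w , pend , (q , e) with all-d w pend
        ...   | i , q′ , e′ = proj₁ (∷-injective (++-cancelˡ (top S) _ _ (trans (sym (∷ʳ-++ (top S) j q)) (trans (sym e) e′))))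
    ... | c ∷ [] with all (λ i → not (unexplored E (top S ∷ʳ i))) (kids S) in al
    ...   | false = descend-stop wf t∈ cov sd ab st
      where
      st : Stuck S E
      st d all-d with all-false _ (kids S) al
      ... | j , j∈ , u with all-d (top S ∷ʳ j) ((j , [] , refl , j∈ , kids-valid wf j∈) , λ z → false≢true u (cong not (cong not (∈ᵇ-intro z))))
      ...   | i , q , e with ++-cancelˡ (top S) _ _ e
      ...     | ()
    ...   | true with leading⁻ {E = E} wf (inj₁ refl) (subst (c ∈_) (sym eq) (here refl))
    ...     | v∈ , w , pend , le = record
        { wf = Descended.wf rec ; top∈ = Descended.top∈ rec ; covers = Descended.covers rec ; sides = Descended.sides rec
        ; Q⊆ = λ z → Descended.Q⊆ rec (there z) ; above∈ = Descended.above∈ rec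
        ; s = suc (Descended.s rec)
        ; Q′-≤ = ≤-trans (Descended.Q′-≤ rec) (≤-reflexive (+-suc (Descended.s rec) (length Q)))
        ; A′-≤ = ≤-trans (s≤s (Descended.A′-≤ rec)) (length-\\ (cov (v∈ , v∈E , w , pend , le)))
        ; top-depth = trans (Descended.top-depth rec) (trans (cong (Descended.s rec +_) (length-∷ʳ′ (top S) c)) (+-suc (Descended.s rec) (depth (top S))))
        ; stuck = Descended.stuck rec
        ; narrower = λ z → nar (Descended.narrower rec z)
        ; keeps = λ p → Descended.keeps rec (keep p , proj₂ p)
        }
      where
      v : Vertex
      v = top S ∷ʳ c
      v∈E : v ∈ E
      v∈E with In-parts v∈
        where
        In-parts : In S v → c ∈ kids S
        In-parts (i , q , e , i∈ , _) with ++-cancelˡ (top S) _ _ e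
        ... | refl = i∈
      ... | c∈ = unexplored-false {E} (not-true⇒false (all-true _ (kids S) al c∈))
      nar : ∀ {w} → In (fullSub T v) w → In S w
      nar (i , q , refl , i∈ , val) = In-below v∈ (i ∷ q , refl) val
      keep : ∀ {w} → Pending S E w → In (fullSub T v) w
      keep {w} pend@((i , q , refl , i∈ , val) , w∉) with subst (i ∈_) eq (leading⁺ (inj₁ refl) pend)
      keep {w} pend@((i , [] , refl , i∈ , val) , w∉) | here refl = contradiction v∈E w∉
      keep {w} pend@((i , j ∷ q , refl , i∈ , val) , w∉) | here refl =
        subst (In (fullSub T v)) (∷ʳ-++ (top S) i (j ∷ q)) (In-fullSub (subst (Valid T) (sym (∷ʳ-++ (top S) i (j ∷ q))) val))
      rec : Descended E (A \\ v) (v ∷ Q) (fullSub T v) (descend T E f (fullSub T v))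
      rec = descend-spec f (fullSub T v)
        (subst (size T ≤_) (trans (sym (+-suc f (depth (top S)))) (cong (f +_) (sym (length-∷ʳ′ (top S) c)))) fuel)
        (fullSub-WF (In-valid v∈)) v∈E (w , keep pend , proj₂ pend)
        (λ (x∈ , x∈E , y , (y∈ , y∉) , x⊑y) → ∈-\\⁺ (cov (nar x∈ , x∈E , y , (nar y∈ , y∉) , x⊑y)) (In≢top x∈))
        (sides-narrow nar sd)
        (λ u⊑ → [ (λ { refl → here refl }) , (λ u⊑t → there (ab u⊑t)) ]′ (⊑-∷ʳ⁻ {v = top S} {c} u⊑))

    -- If `p` were deeper than the top, all pending vertices would lie below the child towards `p`,
    -- and strictly so because `p` and its ancestors are explored; the top could then descend
    -- further. This is why a descent always repays the whole loan.
    stuck-depth : ∀ {S p} → Stuck S E → ∃[ w ] Pending S E w → AllBelow S E p → p ∈ E → depth p ≤ depth (top S)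
    stuck-depth {S} {p} st (w₀ , pend₀) ab p∈ with depth p ≤? depth (top S)
    ... | yes le = le
    ... | no gt with ⊑-compare (top⊑In (proj₁ pend₀)) (ab w₀ pend₀) (<⇒≤ (≰⇒> gt))
    ...   | [] , refl = contradiction (≤-reflexive (cong length (++-identityʳ (top S)))) gt
    ...   | c ∷ r , refl = contradiction go (st c)
      where
      go : ∀ w → Pending S E w → ∃[ i ] ∃[ q ] w ≡ top S ++ c ∷ i ∷ q
      go w pend with ab w pend
      ... | q , e with r ++ q in rq
      ...   | [] = contradiction (closed (q′ , p≡) p∈) (proj₂ pend)
        where
        q′ : List ℕ
        q′ = []
        p≡ : top S ++ c ∷ r ≡ w ++ []
        p≡ = trans (cong (λ z → top S ++ c ∷ z) (r≡[] r q rq)) (trans (sym (trans e (trans (++-assoc (top S) (c ∷ r) q) (cong (λ z → top S ++ c ∷ z) rq)))) (sym (++-identityʳ w)))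
          where
          r≡[] : ∀ (r q : List ℕ) → r ++ q ≡ [] → r ≡ []
          r≡[] [] q _ = refl
      ...   | i ∷ q″ = i , q″ , trans e (trans (++-assoc (top S) (c ∷ r) q) (cong (λ z → top S ++ c ∷ z) rq))

  -- One agent

  walk-reaches : ∀ is cur e E → length is ≤ e → ∃[ E′ ] walkDown is cur e E ≡ (cur ++ is , e ∸ length is , E′) ×
    E ⊆ E′ × (∀ {v} → v ∈ E′ → v ∈ E ⊎ v ⊑ (cur ++ is)) × (cur ∈ E → cur ++ is ∈ E′)
  walk-reaches [] cur e E le = E , cong (_, e , E) (sym (++-identityʳ cur)) , id , inj₁ , subst (_∈ E) (sym (++-identityʳ cur))
  walk-reaches (i ∷ is) cur (suc e) E (s≤s le) with walk-reaches is (cur ∷ʳ i) e ((cur ∷ʳ i) ∷ E) le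
  ... | E′ , eq , sub , new , reach =
    E′ , trans eq (cong (λ v → v , e ∸ length is , E′) (∷ʳ-++ cur i is)) , (λ z → sub (there z)) ,
    (λ v∈ → [ (λ { (here refl) → inj₂ (is , sym (∷ʳ-++ cur i is)) ; (there v∈E) → inj₁ v∈E }) ,
              (λ le → inj₂ (subst (_ ⊑_) (∷ʳ-++ cur i is) le)) ]′ (new v∈)) ,
    λ _ → subst (_∈ E′) (∷ʳ-++ cur i is) (reach (here refl))

  walk-stops : ∀ is cur e E → e < length is → ∃[ u ] ∃[ E′ ] walkDown is cur e E ≡ (u , 0 , E′) ×
    E ⊆ E′ × (∀ {v} → v ∈ E′ → v ∈ E ⊎ (v ⊑ (cur ++ is) × depth v ≤ depth cur + e))
  walk-stops (i ∷ is) cur zero E lt = cur , E , refl , id , inj₁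
  walk-stops (i ∷ is) cur (suc e) E (s≤s lt) with walk-stops is (cur ∷ʳ i) e ((cur ∷ʳ i) ∷ E) lt
  ... | u , E′ , eq , sub , new = u , E′ , eq , (λ z → sub (there z)) ,
    λ v∈ → [ (λ { (here refl) → inj₂ ((is , sym (∷ʳ-++ cur i is)) , ≤-trans (m≤m+n _ e) (≤-reflexive dep)) ; (there v∈E) → inj₁ v∈E }) ,
             (λ (le , d) → inj₂ (subst (_ ⊑_) (∷ʳ-++ cur i is) le , ≤-trans d (≤-reflexive dep))) ]′ (new v∈)
    where
    dep : depth (cur ∷ʳ i) + e ≡ depth cur + suc e
    dep = trans (cong (_+ e) (length-∷ʳ′ cur i)) (sym (+-suc (depth cur) e))

  runDFS-≡ : ∀ dir S u E {pos e E′} → walkDown u [] B ([] ∷ E) ≡ (pos , e , E′) → runDFS T B dir S u E ≡ dfs T dir S pos e E′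
  runDFS-≡ dir S u E eq rewrite eq = refl

  -- Walking through explored vertices prepends repeated entries to the list without changing the
  -- set. This lemma and the next ones transfer all notions between two lists with the same
  -- elements.
  Closed-≈ : ∀ {E E₀} → E ⊆ E₀ → E₀ ⊆ E → Closed E → Closed E₀
  Closed-≈ s t cl le v∈ = s (cl le (t v∈))

  Active-≈ : ∀ {S E E₀ v} → E ⊆ E₀ → E₀ ⊆ E → Active S E₀ v → Active S E v
  Active-≈ s t (v∈ , v∈E , w , p , le) = v∈ , t v∈E , w , Pending-mono s p , le

  Searching-≈ : ∀ {dir F S E E₀ A p cur} → E ⊆ E₀ → E₀ ⊆ E → Searching dir F S E A p cur → Searching dir F S E₀ A p cur
  Searching-≈ {dir} {F} {S} s t r = record
    { closed = Closed-≈ s t closed ; pos = pos ; cur∈ = s cur∈ ; path = path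
    ; covers = λ a → covers (Active-≈ s t a)
    ; cur-done = Done-mono {S} {dir = dir} s cur-done
    ; sides = λ a → sides (Active-≈ s t a)
    ; far-done = λ f → Done-mono {S} {dir = not dir} s (far-done f)
    ; all-below = AllBelow-mono {S} s all-below ; p⊑cur = p⊑cur }
    where open Searching r

  Searched-≈ : ∀ {dir S e D E E₀ E′} → E ⊆ E₀ → E₀ ⊆ E → Searched dir S e D E₀ E′ → Searched dir S e D E E′
  Searched-≈ s t r = record
    { extends = λ z → extends (s z) ; closed = closed ; fresh = fresh ; fresh-≤ = fresh-≤
    ; new = λ z → [ (λ x → inj₁ (t x)) , inj₂ ]′ (new z)
    ; shallow = λ z → [ (λ x → inj₁ (t x)) , inj₂ ]′ (shallow z)
    ; new-done = λ z → [ (λ x → inj₁ (t x)) , inj₂ ]′ (new-done z) }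
    where open Searched r

  Progress-≈ : ∀ {F S A p e E E₀ E′} → E ⊆ E₀ → Progress F S A p e E₀ E′ → Progress F S A p e E E′
  Progress-≈ {F} {S} {A} {p} {e} {E} {E₀} s (A′ , p′ , cov , ab , p∈ , o , len , ineq) = A′ , p′ , cov , ab , p∈ , o , len ,
    ≤-trans (+-monoˡ-≤ (3 * depth p) (+-monoˡ-≤ (3 * length A′) (+-monoˡ-≤ (3 * e) (*-monoʳ-≤ 6 (count-mono {E} s))))) ineq

  Outcome : Bool → (Vertex → Set) → Sub → List Vertex → ℕ → List Vertex → List Vertex → Set
  Outcome dir F S A e E E′ = Searched dir S e B E E′ × (Finished S E′ ⊎ Progress F S A (top S) e E E′)

  module _ {S : Sub} (wf : WellFormed S) {E A : List Vertex} (closed : Closed E) (root∈ : [] ∈ E) (t∈ : top S ∈ E)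
           (covers : Covers S E A) where

    below-top : AllBelow S E (top S)
    below-top w (w∈ , _) = top⊑In w∈

    run-from-top : ∀ dir {F} → depth (top S) ≤ B → (∀ {v} → Active S E v → F v) → (∀ {v} → F v → Done S E (not dir) v) →
      Outcome dir F S A (B ∸ depth (top S)) E (runDFS T B dir S (top S) E)
    run-from-top dir {F} d≤B far far-done with walk-reaches (top S) [] B ([] ∷ E) d≤B
    ... | E₀ , eq , sub , new , _ = subst (Outcome dir F S A e E) (sym (runDFS-≡ dir S (top S) E eq))
        (subst (λ D → Searched dir S e D E (dfs T dir S (top S) e E₀)) (m+[n∸m]≡n d≤B) (Searched-≈ s t (proj₁ res)) ,
         [ inj₁ , (λ p → inj₂ (Progress-≈ {F} {S} {A} {top S} {e} s p)) ]′ (proj₂ res))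
      where
      e : ℕ
      e = B ∸ depth (top S)
      s : E ⊆ E₀
      s z = sub (there z)
      t : E₀ ⊆ E
      t z = [ (λ { (here refl) → root∈ ; (there z∈) → z∈ }) , (λ le → closed le t∈) ]′ (new z)
      top-done : Done S E dir (top S)
      top-done w ((i , q , refl , _) , _) b with Before-++⁻ (top S) (subst (Before dir _) (sym (++-identityʳ (top S))) b)
      ... | ()
      res : Searched dir S e (depth (top S) + e) E₀ (dfs T dir S (top S) e E₀) ×
            (Finished S (dfs T dir S (top S) e E₀) ⊎ Progress F S A (top S) e E₀ (dfs T dir S (top S) e E₀))
      res = dfs-search wf e (Searching-≈ s t (record
        { closed = closed ; pos = inj₁ refl ; cur∈ = t∈ ; path = λ (i , q , e , _) le → contradiction le (child-⋢ e)
        ; covers = covers ; cur-done = top-done ; sides = λ a → inj₂ (far a) ; far-done = far-done ; all-below = below-top ; p⊑cur = ⊑-refl })) (s t∈)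

    -- The balance starts at the explored parent `u`, so that the last step of the walk already
    -- counts as a move to a new vertex. Hence the energy in the balance is `B ∸ depth u`.
    run-from-first : ∀ dir {u x} → In S (u ∷ʳ x) → u ∷ʳ x ∉ E → u ∈ E → Done S E dir (u ∷ʳ x) → Sides S E →
      Outcome dir (Done S E (not dir)) S A (B ∸ depth u) E (runDFS T B dir S (u ∷ʳ x) E)
    run-from-first dir {u} {x} v∈ v∉ u∈ v-done sides with depth (u ∷ʳ x) ≤? B
    ... | no v≰B with walk-stops (u ∷ʳ x) [] B ([] ∷ E) (≰⇒> v≰B)
    ...   | pos , E₀ , eq , sub , new = subst (Outcome dir (Done S E (not dir)) S A (B ∸ depth u) E) (sym (runDFS-≡ dir S (u ∷ʳ x) E eq))
        (subst (λ e → Outcome dir (Done S E (not dir)) S A e E E₀) (sym e≡0)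
          (Searched-≈ {E = E} s t (stay (Closed-≈ s t closed)) ,
           inj₂ (A , top S , (λ a → covers (Active-≈ s t a)) , AllBelow-mono {S} s below-top , s t∈ , inj₁ refl , m≤m+n _ _ ,
                 +-monoˡ-≤ (3 * depth (top S)) (+-monoˡ-≤ (3 * length A) (≤-trans (≤-reflexive (+-identityʳ _)) (*-monoʳ-≤ 6 (count-mono {E} s)))))))
      where
      -- An agent that cannot reach the target explores nothing, and the energy in the balance is
      -- zero by truncation.
      e≡0 : B ∸ depth u ≡ 0
      e≡0 = m≤n⇒m∸n≡0 (≤-pred (subst (suc B ≤_) (length-∷ʳ′ u x) (≰⇒> v≰B)))
      s : E ⊆ E₀
      s z = sub (there z)
      t : E₀ ⊆ E
      t z = [ (λ { (here refl) → root∈ ; (there z∈) → z∈ }) ,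
              (λ (le , d) → [ (λ { refl → contradiction d v≰B }) , (λ le′ → closed le′ u∈) ]′ (⊑-∷ʳ⁻ {v = u} {x} le)) ]′ (new z)
    run-from-first dir {u} {x} v∈ v∉ u∈ v-done sides | yes v≤B with walk-reaches (u ∷ʳ x) [] B ([] ∷ E) v≤B
    ... | E₀ , eq , sub , new , reach = subst (Outcome dir (Done S E (not dir)) S A (B ∸ depth u) E) (sym (runDFS-≡ dir S (u ∷ʳ x) E eq))
        (subst (λ e → Outcome dir (Done S E (not dir)) S A e E (dfs T dir S (u ∷ʳ x) (B ∸ depth (u ∷ʳ x)) E₀)) e≡
         (subst (λ D → Searched dir S (suc e) D E (dfs T dir S v e E₀)) D≡ (extend {dir} {Done S E (not dir)} wf v∈ v-done (Searched-≈ s t (proj₁ res))) ,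
          [ inj₁ , (λ p → inj₂ (new-gain {dir} {Done S E (not dir)} wf {e = e} {A = A} {p = top S} v∉ (Progress-≈ {Done S E (not dir)} {S} {v ∷ A} {top S} {e} s p))) ]′ (proj₂ res)))
      where
      v : Vertex
      v = u ∷ʳ x
      e : ℕ
      e = B ∸ depth v
      e≡ : suc e ≡ B ∸ depth u
      e≡ = trans (cong (λ k → suc (B ∸ k)) (length-∷ʳ′ u x)) (sym (+-∸-assoc 1 (subst (_≤ B) (length-∷ʳ′ u x) v≤B)))
      D≡ : depth u + suc e ≡ B
      D≡ = trans (+-suc (depth u) e) (trans (cong (_+ e) (sym (length-∷ʳ′ u x))) (m+[n∸m]≡n v≤B))
      s : v ∷ E ⊆ E₀
      s (here refl) = reach (here refl)
      s (there z) = sub (there z)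
      t : E₀ ⊆ v ∷ E
      t z = [ (λ { (here refl) → there root∈ ; (there z∈) → there z∈ }) ,
              (λ le → [ (λ { refl → here refl }) , (λ le′ → there (closed le′ u∈)) ]′ (⊑-∷ʳ⁻ {v = u} {x} le)) ]′ (new z)
      pos-u : Pos S u
      pos-u with Pos-parent v∈
      ... | u′ , x′ , eq′ , pos = subst (Pos S) (sym (∷ʳ-injectiveˡ u u′ eq′)) pos
      -- An explored `y` is not below the unexplored target. It does not precede the target, or the
      -- pending vertex below `y` would; it does not follow it either, since nothing pending
      -- precedes `y`. Only the path to `u` remains.
      near : ∀ {y} → Active S E y → Done S E dir y → y ⊑ u
      near {y} (y∈ , y∈E , w , pend , le) d with position dir y v
      ... | above y⊑v = [ (λ { refl → contradiction y∈E v∉ }) , id ]′ (⊑-∷ʳ⁻ {v = u} {x} y⊑v)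
      ... | below v⊑y = contradiction (closed v⊑y y∈E) v∉
      ... | before b = contradiction (Before-⊑ le ⊑-refl b) (v-done w pend)
      ... | after b = contradiction b (d v (v∈ , v∉))
      sides′ : ∀ dir → (∀ {y} → Active S E y → Done S E dir y → y ⊑ u) → ∀ {y} → Active S E y → y ⊑ u ⊎ Done S E (not dir) y
      sides′ true near a = [ (λ d → inj₁ (near a d)) , inj₂ ]′ (sides a)
      sides′ false near a = [ inj₂ , (λ d → inj₁ (near a d)) ]′ (sides a)
      res : Searched dir S e (depth v + e) E₀ (dfs T dir S v e E₀) ×
            (Finished S (dfs T dir S v e E₀) ⊎ Progress (Done S E (not dir)) S (v ∷ A) (top S) e E₀ (dfs T dir S v e E₀))
      res = dfs-search wf e (Searching-≈ s t (step-down wf {A = A} {A′ = v ∷ A} (record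
        { closed = closed ; pos = pos-u ; cur∈ = u∈
        ; path = λ y∈ y⊑u → covers (y∈ , closed y⊑u u∈ , v , (v∈ , v∉) , ⊑-trans y⊑u ⊑-∷ʳ)
        ; covers = covers ; cur-done = Done-above {S} {dir = dir} ⊑-∷ʳ v-done ; sides = sides′ dir near ; far-done = id
        ; all-below = below-top ; p⊑cur = top⊑Pos pos-u })
        v∈ v-done there (here refl) below-top (⊑-trans (top⊑Pos pos-u) ⊑-∷ʳ))) (s (there t∈))

  length-split : {A : Set} {P : A → Set} (P? : Decidable P) (xs : List A) →
                 length (filter P? xs) + length (filter (¬? ∘ P?) xs) ≡ length xs
  length-split P? [] = refl
  length-split P? (x ∷ xs) with P? x
  ... | yes _ = cong suc (length-split P? xs)
  ... | no _ = trans (+-suc _ _) (cong suc (length-split P? xs))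

  -- Routes

  chain-valid : ∀ {v ws} → Chain T v ws → ∀ {w} → w ∈ ws → Valid T w
  chain-valid (step (_ , val , _) _) (here refl) = val
  chain-valid (step _ c) (there w∈) = chain-valid c w∈

  -- A walk can enter the part of the tree below `p` only through `p`, unless it starts there.
  chain-ancestors : ∀ {v ws w p} → Chain T v ws → w ∈ ws → p ⊑ w → p ∈ ws ⊎ p ⊑ v
  chain-ancestors {p = p} (step {v} {w₁} {ws} adj c) w∈ p⊑w = [ inj₁ ∘ there , back adj ]′ (split w∈)
    where
    split : _ ∈ w₁ ∷ ws → p ∈ ws ⊎ p ⊑ w₁
    split (here refl) = inj₂ p⊑w
    split (there w∈) = chain-ancestors c w∈ p⊑w
    back : Adj T v w₁ → p ⊑ w₁ → p ∈ w₁ ∷ ws ⊎ p ⊑ v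
    back (_ , _ , i , inj₁ refl) le = [ inj₁ ∘ here , inj₂ ]′ (⊑-∷ʳ⁻ {v = v} {i} le)
    back (_ , _ , i , inj₂ refl) le = inj₂ (⊑-trans le ⊑-∷ʳ)

  -- On its way to `w` the route visits all `depth t` vertices other than the root on the path to
  -- `t`. They lie in `Q` and use up as many of its at most `B` entries, so at most `B ∸ depth t`
  -- entries are left for `N`.
  route-outside : ∀ {r w t Q} → Route T B r → w ∈ r → t ⊑ w → (∀ {u} → u ⊑ t → u ∈ Q) →
                  ∃[ N ] length N ≤ B ∸ depth t × r ⊆ Q ++ N
  route-outside {r} {w} {t} {Q} (chain , r≤B) w∈ t⊑w above∈ = N , N≤ , r⊆
    where
    P : List Vertex
    P = branch [] t
    N : List Vertex
    N = filter (¬? ∘ (_∈? P)) r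
    P⊑t : ∀ {v} → v ∈ P → v ⊑ t
    P⊑t v∈ with ∈-branch⁻ [] t v∈
    ... | c₁ , c₂ , i , refl , refl = c₂ , refl
    P⊆ : P ⊆ filter (_∈? P) r
    P⊆ {v} v∈ with chain-ancestors chain w∈ (⊑-trans (P⊑t v∈) t⊑w)
    ... | inj₁ v∈r = ∈-filter⁺ (_∈? P) v∈r v∈
    ... | inj₂ le with ∈-branch⁻ [] t v∈
    ...   | c₁ , c₂ , i , _ , refl = contradiction le λ { (_ , ()) }
    N≤ : length N ≤ B ∸ depth t
    N≤ = m+n≤o⇒n≤o∸m (depth t) (begin
      depth t + length N                       ≡⟨ cong (_+ length N) (length-branch [] t) ⟨
      length P + length N                      ≤⟨ +-monoˡ-≤ (length N) (unique-⊆-length (branch-unique [] t) P⊆) ⟩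
      length (filter (_∈? P) r) + length N     ≡⟨ length-split (_∈? P) r ⟩
      length r                                 ≤⟨ r≤B ⟩
      B                                        ∎)
      where
      open ≤-Reasoning
      m+n≤o⇒n≤o∸m : ∀ m {n o} → m + n ≤ o → n ≤ o ∸ m
      m+n≤o⇒n≤o∸m m {n} {o} le = m+n≤o⇒m≤o∸n n (subst (_≤ o) (+-comm m n) le)
    r⊆ : r ⊆ Q ++ N
    r⊆ {v} v∈ with v ∈? P
    ... | yes v∈P = ∈-++⁺ˡ (above∈ (P⊑t v∈P))
    ... | no v∉P = ∈-++⁺ʳ Q (∈-filter⁺ (¬? ∘ (_∈? P)) v∈ v∉P)

  -- Comparison with an arbitrary family of routes

  -- m agents with allowances summing to G, the last of them g, have explored E.
  record Compared (m : ℕ) (E : List Vertex) (G g : ℕ) (Q : List Vertex) : Set where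
    field
      explored : ∃[ X ] length X ≤ G × E ⊆ Q ++ X
      -- The term with `m ∸ length rs` reserves an allowance of at least `g` for every agent not yet
      -- matched with a route; later routes that leave the explored part draw on it.
      routes   : ∀ rs → length rs ≤ m → Allᴸ (Route T B) rs →
                 ∃[ X ] length X + (m ∸ length rs) * g ≤ G × (∀ {r v} → r ∈ rs → v ∈ r → v ∈ Q ++ X)

  ++-monoˡ : {A : Set} {Q Q′ X : List A} → Q ⊆ Q′ → Q ++ X ⊆ Q′ ++ X
  ++-monoˡ {Q = Q} {Q′} s v∈ = [ (λ z → ∈-++⁺ˡ (s z)) , ∈-++⁺ʳ Q′ ]′ (∈-++⁻ Q v∈)

  Compared-Q : ∀ {m E G g Q Q′} → Q ⊆ Q′ → Compared m E G g Q → Compared m E G g Q′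
  Compared-Q s c = record
    { explored = let (X , len , sub) = explored in X , len , λ z → ++-monoˡ s (sub z)
    ; routes = λ rs len rts → let (X , le , sub) = routes rs len rts in X , le , λ r∈ v∈ → ++-monoˡ s (sub r∈ v∈) }
    where open Compared c

  module _ {E Q : List Vertex} {g′ : ℕ}
           (far : ∀ {r} → Route T B r → ∃[ w ] (w ∈ r × w ∉ E) → ∃[ N ] length N ≤ g′ × r ⊆ Q ++ N) where

    split-routes : ∀ rs → Allᴸ (Route T B) rs → ∃[ rs₁ ] ∃[ X ] ∃[ n ]
      length rs₁ + n ≡ length rs × Allᴸ (Route T B) rs₁ × Allᴸ (_⊆ E) rs₁ × length X ≤ n * g′ ×
      (∀ {r v} → r ∈ rs → v ∈ r → (∃[ r′ ] r′ ∈ rs₁ × v ∈ r′) ⊎ v ∈ Q ++ X)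
    split-routes [] [] = [] , [] , 0 , refl , [] , [] , z≤n , λ ()
    split-routes (r ∷ rs) (rt ∷ rts) with split-routes rs rts | All.all? (_∈? E) r
    ... | rs₁ , X , n , len , rts₁ , sub₁ , lenX , cov | yes r⊆E =
      r ∷ rs₁ , X , n , cong suc len , rt ∷ rts₁ , (λ z → All.lookup r⊆E z) ∷ sub₁ , lenX ,
      λ { (here refl) v∈ → inj₁ (r , here refl , v∈)
        ; (there r∈) v∈ → [ (λ (r′ , r′∈ , v∈′) → inj₁ (r′ , there r′∈ , v∈′)) , inj₂ ]′ (cov r∈ v∈) }
    ... | rs₁ , X , n , len , rts₁ , sub₁ , lenX , cov | no r⊈E with find (All.¬All⇒Any¬ (_∈? E) r r⊈E)
    ...   | w , w∈ , w∉ with far rt (w , w∈ , w∉)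
    ...     | N , lenN , r⊆ = rs₁ , N ++ X , suc n , trans (+-suc _ n) (cong suc len) , rts₁ , sub₁ ,
      subst (_≤ suc n * g′) (sym (length-++ N)) (+-mono-≤ lenN lenX) ,
      λ { (here refl) v∈ → inj₂ ([ ∈-++⁺ˡ , (λ z → ∈-++⁺ʳ Q (∈-++⁺ˡ z)) ]′ (∈-++⁻ Q (r⊆ v∈)))
        ; (there r∈) v∈ → [ inj₁ , (λ z → inj₂ ([ ∈-++⁺ˡ , (λ z → ∈-++⁺ʳ Q (∈-++⁺ʳ N z)) ]′ (∈-++⁻ Q z))) ]′ (cov r∈ v∈) }

    -- The routes inside E are compared with the earlier agents. If there are
    -- more of them than earlier agents, E itself is compared instead.
    Compared-step : ∀ {m E′ G g N} → Compared m E G g Q → g′ ≤ g →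
      (∀ {v} → v ∈ E′ → v ∈ E ⊎ v ∈ N) → length N ≤ g′ → Compared (suc m) E′ (G + g′) g′ Q
    Compared-step {m} {E′} {G} {g} {N} c g′≤g new lenN = record { explored = expl ; routes = rout }
      where
      open Compared c
      expl : ∃[ X ] length X ≤ G + g′ × E′ ⊆ Q ++ X
      expl with explored
      ... | X , len , sub = X ++ N , subst (_≤ G + g′) (sym (length-++ X)) (+-mono-≤ len lenN) ,
        λ v∈ → [ (λ z → [ ∈-++⁺ˡ , (λ y → ∈-++⁺ʳ Q (∈-++⁺ˡ y)) ]′ (∈-++⁻ Q (sub z))) , (λ z → ∈-++⁺ʳ Q (∈-++⁺ʳ X z)) ]′ (new v∈)

      join : ∀ {rs₁ rs : List (List Vertex)} {X₁ X₂} →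
        (∀ {r v} → r ∈ rs₁ → v ∈ r → v ∈ Q ++ X₁) →
        (∀ {r v} → r ∈ rs → v ∈ r → (∃[ r′ ] r′ ∈ rs₁ × v ∈ r′) ⊎ v ∈ Q ++ X₂) →
        ∀ {r v} → r ∈ rs → v ∈ r → v ∈ Q ++ (X₁ ++ X₂)
      join {X₁ = X₁} s₁ s₂ r∈ v∈ with s₂ r∈ v∈
      ... | inj₁ (r′ , r′∈ , v∈′) = [ ∈-++⁺ˡ , (λ z → ∈-++⁺ʳ Q (∈-++⁺ˡ z)) ]′ (∈-++⁻ Q (s₁ r′∈ v∈′))
      ... | inj₂ z = [ ∈-++⁺ˡ , (λ z → ∈-++⁺ʳ Q (∈-++⁺ʳ X₁ z)) ]′ (∈-++⁻ Q z)

      -- The `l₁` routes inside `E` leave `m ∸ l₁` old agents and the new one free. Of these, `n`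
      -- are matched with the routes leaving `E`, and the others stay in reserve at the smaller rate
      -- `g′`.
      arith₁ : ∀ x₁ x₂ l₁ n → l₁ ≤ m → l₁ + n ≤ suc m → x₁ + (m ∸ l₁) * g ≤ G → x₂ ≤ n * g′ →
               (x₁ + x₂) + (suc m ∸ (l₁ + n)) * g′ ≤ G + g′
      arith₁ x₁ x₂ l₁ n l₁≤m le h₁ h₂ = begin
        (x₁ + x₂) + k * g′            ≤⟨ +-monoˡ-≤ (k * g′) (+-monoʳ-≤ x₁ h₂) ⟩
        (x₁ + n * g′) + k * g′        ≡⟨ eq₁ x₁ n k g′ ⟩
        x₁ + (n + k) * g′             ≡⟨ cong (λ z → x₁ + z * g′) n+k ⟩
        x₁ + suc (m ∸ l₁) * g′        ≡⟨ eq₂ x₁ (m ∸ l₁) g′ ⟩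
        (x₁ + (m ∸ l₁) * g′) + g′     ≤⟨ +-monoˡ-≤ g′ (+-monoʳ-≤ x₁ (*-monoʳ-≤ (m ∸ l₁) g′≤g)) ⟩
        (x₁ + (m ∸ l₁) * g) + g′      ≤⟨ +-monoˡ-≤ g′ h₁ ⟩
        G + g′                        ∎
        where
        open ≤-Reasoning
        k : ℕ
        k = suc m ∸ (l₁ + n)
        n+k : n + k ≡ suc (m ∸ l₁)
        n+k = trans (cong (n +_) (sym (∸-+-assoc (suc m) l₁ n)))
          (trans (m+[n∸m]≡n (m+n≤o⇒m≤o∸n n (subst (_≤ suc m) (+-comm l₁ n) le))) (+-∸-assoc 1 l₁≤m))
        eq₁ : ∀ x n k g → (x + n * g) + k * g ≡ x + (n + k) * g
        eq₁ = solve-∀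
        eq₂ : ∀ x k g → x + suc k * g ≡ (x + k * g) + g
        eq₂ = solve-∀

      rout : ∀ rs → length rs ≤ suc m → Allᴸ (Route T B) rs →
             ∃[ X ] length X + (suc m ∸ length rs) * g′ ≤ G + g′ × (∀ {r v} → r ∈ rs → v ∈ r → v ∈ Q ++ X)
      rout rs len rts with split-routes rs rts
      ... | rs₁ , X₂ , n , eq , rts₁ , sub₁ , lenX₂ , cov with length rs₁ ≤? m
      ...   | yes l₁≤m with routes rs₁ l₁≤m rts₁
      ...     | X₁ , h₁ , s₁ = X₁ ++ X₂ ,
        subst₂ (λ a b → a + (suc m ∸ b) * g′ ≤ G + g′) (sym (length-++ X₁)) eq
          (arith₁ (length X₁) (length X₂) (length rs₁) n l₁≤m (subst (_≤ suc m) (sym eq) len) h₁ lenX₂) , join s₁ cov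
      rout rs len rts | rs₁ , X₂ , n , eq , rts₁ , sub₁ , lenX₂ , cov | no l₁≰m with explored
      ...     | X₁ , lenX₁ , sub = X₁ ++ X₂ , le , join (λ r∈ v∈ → sub (All.lookup sub₁ r∈ v∈)) cov
        where
        l≡ : length rs ≡ suc m
        l≡ = ≤-antisym len (≤-trans (≰⇒> l₁≰m) (subst (length rs₁ ≤_) eq (m≤m+n _ n)))
        le : length (X₁ ++ X₂) + (suc m ∸ length rs) * g′ ≤ G + g′
        le = begin
          length (X₁ ++ X₂) + (suc m ∸ length rs) * g′  ≡⟨ cong₂ _+_ (length-++ X₁) (cong (_* g′) (trans (cong (suc m ∸_) l≡) (n∸n≡0 (suc m)))) ⟩
          (length X₁ + length X₂) + 0                   ≡⟨ +-identityʳ _ ⟩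
          length X₁ + length X₂                         ≤⟨ +-mono-≤ lenX₁ (≤-trans lenX₂ (≤-trans (*-monoˡ-≤ g′ n≤1) (≤-reflexive (+-identityʳ g′)))) ⟩
          G + g′                                        ∎
          where
          open ≤-Reasoning
          n≤1 : n ≤ 1
          n≤1 = ≤-trans (+-cancelˡ-≤ (suc m) _ _ (≤-trans (+-monoˡ-≤ n (≰⇒> l₁≰m)) (≤-trans (≤-reflexive (trans eq l≡)) (≤-reflexive (sym (+-identityʳ (suc m))))))) z≤n

  -- The credit held by the subtrees

  room : Sub → ℕ
  room S = B ∸ depth (top S)

  -- The store `a` may fall short of its full value by three times the depth of `p` below the top.
  -- This is the loan for moves to explored vertices, to be repaid when the top descends.
  record Live (E Q : List Vertex) (S : Sub) (a : ℕ) : Set where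
    field
      {A}       : List Vertex
      {p}       : Vertex
      covers    : Covers S E A
      sides     : Sides S E
      above∈    : ∀ {u} → u ⊑ top S → u ∈ Q
      all-below : AllBelow S E p
      p∈        : p ∈ E
      credit    : 2 * room S + 3 * depth (top S) + 3 * length A ≤ a + 3 * depth p

  record Ready (E Q : List Vertex) (S : Sub) (a : ℕ) : Set where
    field
      {A}    : List Vertex
      covers : Covers S E A
      sides  : Sides S E
      above∈ : ∀ {u} → u ⊑ top S → u ∈ Q
      stuck  : Stuck S E
      credit : 2 * room S + 3 * length A ≤ a

  record Status (P : List Vertex → List Vertex → Sub → ℕ → Set) (E Q : List Vertex) (S : Sub) (a : ℕ) : Set where
    constructor status
    field
      wf     : WellFormed S
      top∈   : top S ∈ E
      credit : Finished S E ⊎ P E Q S a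

  data Credits (R : Sub → ℕ → Set) : List Sub → ℕ → Set where
    []  : Credits R [] 0
    _∷_ : ∀ {S 𝒯 a b} → R S a → Credits R 𝒯 b → Credits R (S ∷ 𝒯) (a + b)

  Credits-map : ∀ {R R′ : Sub → ℕ → Set} {𝒯 s} → (∀ {S a} → R S a → R′ S a) → Credits R 𝒯 s → Credits R′ 𝒯 s
  Credits-map f [] = []
  Credits-map f (r ∷ rs) = f r ∷ Credits-map f rs

  Disjoint : Sub → Sub → Set
  Disjoint S S′ = ∀ w → In S w → ¬ In S′ w

  -- `d` is the depth of the top chosen last. By `low` every unfinished top is at least as deep,
  -- which makes the successive allowances nonincreasing. `shallow` keeps the subtractions from `B`
  -- from truncating.
  record State (P : List Vertex → List Vertex → Sub → ℕ → Set) (m : ℕ) (E : List Vertex) (𝒯 : List Sub) : Set where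
    field
      closed   : Closed E
      root∈    : [] ∈ E
      shallow  : ∀ {v} → v ∈ E → depth v ≤ B
      {Q}      : List Vertex
      {G d s}  : ℕ
      root∈Q   : [] ∈ Q
      credits  : Credits (Status P E Q) 𝒯 s
      disjoint : AllPairs Disjoint 𝒯
      covered  : ∀ {w} → Valid T w → w ∉ E → Any (λ S → In S w) 𝒯
      low      : Allᴸ (λ S → ∃[ w ] Pending S E w → d ≤ depth (top S)) 𝒯
      compared : Compared m E G (B ∸ d) Q
      funded   : 2 * G + 2 * length Q + s ≤ 6 * count E

  Live-Q : ∀ {E Q Q′ S a} → Q ⊆ Q′ → Live E Q S a → Live E Q′ S a
  Live-Q s l = record { Live l ; above∈ = λ le → s (Live.above∈ l le) }

  Ready-Q : ∀ {E Q Q′ S a} → Q ⊆ Q′ → Ready E Q S a → Ready E Q′ S a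
  Ready-Q s l = record { Ready l ; above∈ = λ le → s (Ready.above∈ l le) }

  Status-map : ∀ {P P′ : List Vertex → List Vertex → Sub → ℕ → Set} {E Q Q′ S a} →
    (P E Q S a → P′ E Q′ S a) → Status P E Q S a → Status P′ E Q′ S a
  Status-map f (status wf t∈ c) = status wf t∈ ([ inj₁ , (λ x → inj₂ (f x)) ]′ c)

  -- Preparation

  prepareOne : List Vertex → Sub → Sub
  prepareOne E S = if hasUnexpl E (vertsS T S) then descend T E (size T) S else S

  record Narrower (E : List Vertex) (S S′ : Sub) : Set where
    field
      inside : ∀ {w} → In S′ w → In S w
      keeps  : ∀ {w} → Pending S E w → In S′ w
      deeper : depth (top S) ≤ depth (top S′)

  -- In `s` steps the room and the list both shrink by `s`, which frees `2 s + 3 s` credits. The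
  -- part `3 s` covers the loan because `p` is at most `s` levels below the old top, and `2 s` pays
  -- for the enlargement of `Q`.
  prepare-arith : ∀ r r′ d p s a A A′ Q Q′ → r′ + s ≡ r → p ≤ s + d → Q′ ≤ s + Q → s + A′ ≤ A → 2 * r + 3 * d + 3 * A ≤ a + 3 * p →
    2 * Q′ + (2 * r′ + 3 * A′) ≤ 2 * Q + a
  prepare-arith r r′ d p s a A A′ Q Q′ refl p≤ Q≤ A≤ h = +-cancelʳ-≤ (3 * s + 3 * d) _ _ (begin
    2 * Q′ + (2 * r′ + 3 * A′) + (3 * s + 3 * d)        ≤⟨ +-monoˡ-≤ (3 * s + 3 * d) (+-monoˡ-≤ (2 * r′ + 3 * A′) (*-monoʳ-≤ 2 Q≤)) ⟩
    2 * (s + Q) + (2 * r′ + 3 * A′) + (3 * s + 3 * d)   ≡⟨ e₁ Q A′ r′ s d ⟩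
    2 * Q + (2 * (r′ + s) + 3 * d + 3 * (s + A′))       ≤⟨ +-monoʳ-≤ (2 * Q) (+-monoʳ-≤ (2 * (r′ + s) + 3 * d) (*-monoʳ-≤ 3 A≤)) ⟩
    2 * Q + (2 * (r′ + s) + 3 * d + 3 * A)              ≤⟨ +-monoʳ-≤ (2 * Q) h ⟩
    2 * Q + (a + 3 * p)                                 ≤⟨ +-monoʳ-≤ (2 * Q) (+-monoʳ-≤ a (*-monoʳ-≤ 3 p≤)) ⟩
    2 * Q + (a + 3 * (s + d))                           ≡⟨ e₂ Q a s d ⟩
    2 * Q + a + (3 * s + 3 * d)                         ∎)
    where
    open ≤-Reasoning
    e₁ : ∀ Q A′ r′ s d → 2 * (s + Q) + (2 * r′ + 3 * A′) + (3 * s + 3 * d) ≡ 2 * Q + (2 * (r′ + s) + 3 * d + 3 * (s + A′))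
    e₁ = solve-∀
    e₂ : ∀ Q a s d → 2 * Q + (a + 3 * (s + d)) ≡ 2 * Q + a + (3 * s + 3 * d)
    e₂ = solve-∀

  module _ {E : List Vertex} (closed : Closed E) (shallow : ∀ {v} → v ∈ E → depth v ≤ B) where

    prepareOne-spec : ∀ {Q S a} → Status Live E Q S a → ∃[ Q′ ] ∃[ a′ ] Q ⊆ Q′ ×
      Status Ready E Q′ (prepareOne E S) a′ × 2 * length Q′ + a′ ≤ 2 * length Q + a × Narrower E S (prepareOne E S)
    prepareOne-spec {Q} {S} {a} (status wf t∈ c) with hasUnexpl E (vertsS T S) in h
    ... | false = Q , a , id , status wf t∈ (inj₁ (finished h)) , ≤-refl , record { inside = id ; keeps = proj₁ ; deeper = ≤-refl }
    ... | true with unfinished wf t∈ h | c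
    ...   | w , w∈ , w∉ | inj₁ fin = contradiction (fin w w∈) w∉
    ...   | w , pend | inj₂ l = D.Q′ , _ , D.Q⊆ ,
        status D.wf D.top∈ (inj₂ (record { covers = D.covers ; sides = D.sides ; above∈ = D.above∈ ; stuck = D.stuck ; credit = ≤-refl })) ,
        prepare-arith (room S) (room S′) (depth (top S)) (depth L.p) D.s a (length L.A) (length D.A′) (length Q) (length D.Q′)
          room-≡ (subst (depth L.p ≤_) D.top-depth p≤) D.Q′-≤ D.A′-≤ L.credit ,
        record { inside = D.narrower ; keeps = D.keeps ; deeper = subst (depth (top S) ≤_) (sym D.top-depth) (m≤n+m _ D.s) }
      where
      module L = Live l
      S′ : Sub
      S′ = descend T E (size T) S
      desc : Descended E L.A Q S S′
      desc = descend-spec closed (size T) S (m≤m+n (size T) _) wf t∈ (w , pend) L.covers L.sides L.above∈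
      module D = Descended desc
      p≤ : depth L.p ≤ depth (top S′)
      p≤ = stuck-depth closed {S′} D.stuck (w , D.keeps pend , proj₂ pend) (λ x (x∈ , x∉) → L.all-below x (D.narrower x∈ , x∉)) L.p∈
      -- Exact because the new top is explored and thus has depth at most `B`.
      room-≡ : room S′ + D.s ≡ room S
      room-≡ = trans (cong (λ k → B ∸ k + D.s) (trans D.top-depth (+-comm D.s _)))
        (trans (cong (_+ D.s) (sym (∸-+-assoc B (depth (top S)) D.s)))
          (m∸n+n≡m (m+n≤o⇒m≤o∸n D.s (subst (_≤ B) D.top-depth (shallow D.top∈)))))

    prepare-spec : ∀ {Q 𝒯 s} → Credits (Status Live E Q) 𝒯 s → ∃[ Q′ ] ∃[ s′ ] Q ⊆ Q′ ×
      Credits (Status Ready E Q′) (prepare T E 𝒯) s′ × 2 * length Q′ + s′ ≤ 2 * length Q + s × Pointwise (Narrower E) 𝒯 (prepare T E 𝒯)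
    prepare-spec {Q} [] = Q , 0 , id , [] , ≤-refl , []
    prepare-spec {Q} (_∷_ {a = a} {b} c cs) with prepareOne-spec c
    ... | Q₁ , a′ , Q⊆ , c′ , le₁ , nar with prepare-spec (Credits-map (Status-map (Live-Q Q⊆)) cs)
    ...   | Q₂ , b′ , Q₁⊆ , cs′ , le₂ , nars = Q₂ , a′ + b′ , (λ z → Q₁⊆ (Q⊆ z)) , Status-map (Ready-Q Q₁⊆) c′ ∷ cs′ , le , nar ∷ nars
      where
      open ≤-Reasoning
      le : 2 * length Q₂ + (a′ + b′) ≤ 2 * length Q + (a + b)
      le = begin
        2 * length Q₂ + (a′ + b′)     ≡⟨ e₁ (2 * length Q₂) a′ b′ ⟩
        a′ + (2 * length Q₂ + b′)     ≤⟨ +-monoʳ-≤ a′ le₂ ⟩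
        a′ + (2 * length Q₁ + b)      ≡⟨ e₂ a′ (2 * length Q₁) b ⟩
        (2 * length Q₁ + a′) + b      ≤⟨ +-monoˡ-≤ b le₁ ⟩
        (2 * length Q + a) + b        ≡⟨ +-assoc (2 * length Q) a b ⟩
        2 * length Q + (a + b)        ∎
        where
        e₁ : ∀ q a b → q + (a + b) ≡ a + (q + b)
        e₁ = solve-∀
        e₂ : ∀ a q b → a + (q + b) ≡ (q + a) + b
        e₂ = solve-∀

  module _ {E : List Vertex} where
    open Narrower

    narrow-All : ∀ {S 𝒯 𝒯′} → Pointwise (Narrower E) 𝒯 𝒯′ → Allᴸ (Disjoint S) 𝒯 → Allᴸ (Disjoint S) 𝒯′
    narrow-All [] [] = []
    narrow-All (n ∷ ns) (x ∷ xs) = (λ w a b → x w a (inside n b)) ∷ narrow-All ns xs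

    narrow-disjoint : ∀ {𝒯 𝒯′} → Pointwise (Narrower E) 𝒯 𝒯′ → AllPairs Disjoint 𝒯 → AllPairs Disjoint 𝒯′
    narrow-disjoint [] [] = []
    narrow-disjoint (n ∷ ns) (x ∷ xs) = All.map (λ f w a b → f w (inside n a) b) (narrow-All ns x) ∷ narrow-disjoint ns xs

    narrow-covered : ∀ {𝒯 𝒯′ w} → Pointwise (Narrower E) 𝒯 𝒯′ → w ∉ E → Any (λ S → In S w) 𝒯 → Any (λ S → In S w) 𝒯′
    narrow-covered (n ∷ ns) w∉ (here w∈) = here (keeps n (w∈ , w∉))
    narrow-covered (n ∷ ns) w∉ (there a) = there (narrow-covered ns w∉ a)

    narrow-low : ∀ {𝒯 𝒯′ d} → Pointwise (Narrower E) 𝒯 𝒯′ →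
      Allᴸ (λ S → ∃[ w ] Pending S E w → d ≤ depth (top S)) 𝒯 → Allᴸ (λ S → ∃[ w ] Pending S E w → d ≤ depth (top S)) 𝒯′
    narrow-low [] [] = []
    narrow-low (n ∷ ns) (l ∷ ls) = (λ (w , w∈ , w∉) → ≤-trans (l (w , inside n w∈ , w∉)) (deeper n)) ∷ narrow-low ns ls

  prepare-State : ∀ {m E 𝒯} → State Live m E 𝒯 → State Ready m E (prepare T E 𝒯)
  prepare-State {m} {E} {𝒯} st with prepare-spec (State.closed st) (State.shallow st) (State.credits st)
  ... | Q′ , s′ , Q⊆ , cs , le , nars = record
    { closed = closed ; root∈ = root∈ ; shallow = shallow ; root∈Q = Q⊆ root∈Q ; credits = cs
    ; disjoint = narrow-disjoint nars disjoint
    ; covered = λ val w∉ → narrow-covered nars w∉ (covered val w∉)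
    ; low = narrow-low nars low
    ; compared = Compared-Q Q⊆ compared
    ; funded = ≤-trans (≤-reflexive (+-assoc (2 * G) _ s′)) (≤-trans (+-monoʳ-≤ (2 * G) le) (≤-trans (≤-reflexive (sym (+-assoc (2 * G) _ s))) funded)) }
    where open State st

  -- Replacing one subtree

  -- A run elsewhere leaves the vertices of this subtree as they were, so its active vertices can
  -- only become fewer. The marker is the top itself, that is, there is no loan.
  Ready⇒Live : ∀ {E E′ Q S a} → E ⊆ E′ → (∀ {w} → In S w → w ∈ E′ → w ∈ E) →
    Status Ready E Q S a → Status Live E′ Q S a
  Ready⇒Live {E} {E′} {Q} {S} sub same (status wf t∈ (inj₁ fin)) = status wf (sub t∈) (inj₁ λ w w∈ → sub (fin w w∈))
  Ready⇒Live {E} {E′} {Q} {S} {a} sub same (status wf t∈ (inj₂ r)) = status wf (sub t∈) (inj₂ (record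
    { covers = λ x → R.covers (back x)
    ; sides = λ x → [ (λ d → inj₁ (Done-mono {S} {dir = true} sub d)) , (λ d → inj₂ (Done-mono {S} {dir = false} sub d)) ]′ (R.sides (back x))
    ; above∈ = R.above∈
    ; all-below = λ w p → top⊑In (proj₁ p)
    ; p∈ = sub t∈
    ; credit = subst (_≤ a + 3 * depth (top S)) (swap (2 * room S) (3 * length R.A) (3 * depth (top S))) (+-monoˡ-≤ (3 * depth (top S)) R.credit) }))
    where
    module R = Ready r
    back : ∀ {v} → Active S E′ v → Active S E v
    back (v∈ , v∈E , w , p , le) = v∈ , same v∈ v∈E , w , Pending-mono sub p , le
    swap : ∀ a b c → a + b + c ≡ a + c + b
    swap = solve-∀

  module _ {E Q : List Vertex} {S : Sub} where

    -- Only vertices of `S` are added, and the other subtrees are disjoint from `S`, so their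
    -- credits carry over. The replacement is left open: one subtree after a single run, two after a
    -- division.
    credits-replace : ∀ j {𝒯 s} → nth j 𝒯 ≡ just S → AllPairs Disjoint 𝒯 → Credits (Status Ready E Q) 𝒯 s →
      ∃[ a ] ∃[ s′ ] s ≡ a + s′ × Status Ready E Q S a ×
        (∀ {new b E′} → E ⊆ E′ → (∀ {v} → v ∈ E′ → v ∈ E ⊎ In S v) →
         Credits (Status Live E′ Q) new b → Credits (Status Live E′ Q) (replaceAt j new 𝒯) (b + s′))
    credits-replace zero refl (x ∷ _) (_∷_ {a = a} {b} c cs) = a , b , refl , c , λ sub new → append (others sub new x cs)
      where
      append : ∀ {E′ new b 𝒯 s} → Credits (Status Live E′ Q) 𝒯 s → Credits (Status Live E′ Q) new b → Credits (Status Live E′ Q) (new ++ 𝒯) (b + s)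
      append cs [] = cs
      append {s = s} cs (_∷_ {a = a} {b} d ds) = subst (Credits _ _) (sym (+-assoc a b s)) (d ∷ append cs ds)
      others : ∀ {E′ 𝒯 s} → E ⊆ E′ → (∀ {v} → v ∈ E′ → v ∈ E ⊎ In S v) → Allᴸ (Disjoint S) 𝒯 →
        Credits (Status Ready E Q) 𝒯 s → Credits (Status Live E′ Q) 𝒯 s
      others sub new [] [] = []
      others sub new (x ∷ xs) (c ∷ cs) = Ready⇒Live sub (λ w∈ z → [ id , (λ w∈S → contradiction w∈ (x _ w∈S)) ]′ (new z)) c ∷ others sub new xs cs
    credits-replace (suc j) {S₀ ∷ 𝒯} eq (x ∷ xs) (_∷_ {a = a₀} {b₀} c cs) with credits-replace j eq xs cs
    ... | a , s′ , refl , cS , rebuild = a , a₀ + s′ , swap a₀ a s′ , cS ,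
      λ {new} {b} sub nw ns → subst (Credits _ _) (swap a₀ b s′)
        (Ready⇒Live sub (λ w∈ z → [ id , (λ w∈S → contradiction w∈S (All.lookup x (nth-∈ j eq) _ w∈)) ]′ (nw z)) c ∷ rebuild sub nw ns)
      where
      swap : ∀ a b c → a + (b + c) ≡ b + (a + c)
      swap = solve-∀

  replace-All : ∀ {P : Sub → Set} j {𝒯 new} → Allᴸ P 𝒯 → Allᴸ P new → Allᴸ P (replaceAt j new 𝒯)
  replace-All j [] ns = []
  replace-All zero (x ∷ xs) ns = All.++⁺ ns xs
  replace-All (suc j) (x ∷ xs) ns = x ∷ replace-All j xs ns

  replace-Any : ∀ {P : Sub → Set} {S} j {𝒯 new} → nth j 𝒯 ≡ just S → (P S → Any P new) → Any P 𝒯 → Any P (replaceAt j new 𝒯)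
  replace-Any zero refl f (here p) = Any.++⁺ˡ (f p)
  replace-Any zero {new = new} refl f (there a) = Any.++⁺ʳ new a
  replace-Any (suc j) eq f (here p) = here p
  replace-Any (suc j) eq f (there a) = there (replace-Any j eq f a)

  replace-disjoint : ∀ {S} j {𝒯 new} → nth j 𝒯 ≡ just S → Allᴸ (λ S′ → ∀ {w} → In S′ w → In S w) new →
    AllPairs Disjoint new → AllPairs Disjoint 𝒯 → AllPairs Disjoint (replaceAt j new 𝒯)
  replace-disjoint zero refl ins ds (x ∷ xs) = AllPairs.++⁺ ds xs (All.map (λ i → All.map (λ f w a b → f w (i a) b) x) ins)
  replace-disjoint (suc j) eq ins ds (x ∷ xs) =
    replace-All j x (All.map (λ i w a b → All.lookup x (nth-∈ j eq) w a (i b)) ins) ∷ replace-disjoint j eq ins ds xs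

  replace-same : ∀ {S} j {𝒯} → nth j 𝒯 ≡ just S → replaceAt j (S ∷ []) 𝒯 ≡ 𝒯
  replace-same zero {S ∷ 𝒯} refl = refl
  replace-same (suc j) {S ∷ 𝒯} eq = cong (S ∷_) (replace-same j eq)

  -- The value of the algorithm

  record Competitive (k : ℕ) (E : List Vertex) : Set where
    field
      bound : ∀ rs → length rs ≤ k → Allᴸ (Route T B) rs → count (concat (map ([] ∷_) rs)) ≤ 3 * count E

  ∈-routes⁻ : ∀ (rs : List (List Vertex)) {v : Vertex} → v ∈ concat (map ([] ∷_) rs) → v ≡ [] ⊎ ∃[ r ] r ∈ rs × v ∈ r
  ∈-routes⁻ (r ∷ rs) (here refl) = inj₁ refl
  ∈-routes⁻ (r ∷ rs) (there v∈) with ∈-++⁻ r v∈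
  ... | inj₁ v∈r = inj₂ (r , here refl , v∈r)
  ... | inj₂ v∈′ with ∈-routes⁻ rs v∈′
  ...   | inj₁ eq = inj₁ eq
  ...   | inj₂ (r′ , r′∈ , v∈r′) = inj₂ (r′ , there r′∈ , v∈r′)

  competitive-compared : ∀ {m E G g Q} → Compared m E G g Q → [] ∈ Q → 2 * G + 2 * length Q ≤ 6 * count E → Competitive m E
  competitive-compared {m} {E} {G} {g} {Q} c root∈Q funded .Competitive.bound rs len rts with Compared.routes c rs len rts
  ... | X , lenX , sub = begin
    count (concat (map ([] ∷_) rs))  ≤⟨ count≤length {concat (map ([] ∷_) rs)} {Q ++ X} (λ v∈ → [ (λ { refl → ∈-++⁺ˡ root∈Q }) , (λ (r , r∈ , v∈r) → sub r∈ v∈r) ]′ (∈-routes⁻ rs v∈)) ⟩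
    length (Q ++ X)                  ≡⟨ length-++ Q ⟩
    length Q + length X              ≤⟨ +-monoʳ-≤ (length Q) (≤-trans (m≤m+n (length X) _) lenX) ⟩
    length Q + G                     ≤⟨ *-cancelˡ-≤ 2 (≤-trans (≤-reflexive (e₁ (length Q) G)) (≤-trans funded (≤-reflexive (e₂ (count E))))) ⟩
    3 * count E                      ∎
    where
    open ≤-Reasoning
    e₁ : ∀ q g → 2 * (q + g) ≡ 2 * g + 2 * q
    e₁ = solve-∀
    e₂ : ∀ c → 6 * c ≡ 2 * (3 * c)
    e₂ = solve-∀

  competitive-explored : ∀ {k E} → (∀ {w} → Valid T w → w ∈ E) → Competitive k E
  competitive-explored {k} {E} all∈ .Competitive.bound rs len rts =
    ≤-trans (count-mono {concat (map ([] ∷_) rs)} {E} visited) (m≤m+n (count E) _)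
    where
    visited : concat (map ([] ∷_) rs) ⊆ E
    visited v∈ with ∈-routes⁻ rs v∈
    ... | inj₁ refl = all∈ {[]} (Valid-[] {T})
    ... | inj₂ (r , r∈ , v∈r) = all∈ (chain-valid (proj₁ (All.lookup rts r∈)) v∈r)

  -- The effect of one run on the credit of its subtree

  Live-mono : ∀ {E E′ Q S a} → E ⊆ E′ → (∀ {w} → In S w → w ∈ E′ → w ∈ E) → Status Live E Q S a → Status Live E′ Q S a
  Live-mono sub same (status wf t∈ (inj₁ fin)) = status wf (sub t∈) (inj₁ λ w w∈ → sub (fin w w∈))
  Live-mono {E} {E′} {Q} {S} sub same (status wf t∈ (inj₂ l)) = status wf (sub t∈) (inj₂ (record
    { covers = λ x → L.covers (back x)
    ; sides = λ x → [ (λ d → inj₁ (Done-mono {S} {dir = true} sub d)) , (λ d → inj₂ (Done-mono {S} {dir = false} sub d)) ]′ (L.sides (back x))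
    ; above∈ = L.above∈ ; all-below = AllBelow-mono {S} sub L.all-below ; p∈ = sub L.p∈ ; credit = L.credit }))
    where
    module L = Live l
    back : ∀ {v} → Active S E′ v → Active S E v
    back (v∈ , v∈E , w , p , le) = v∈ , same v∈ v∈E , w , Pending-mono sub p , le

  run-arith : ∀ c c′ e r d A A′ p′ a → a + 3 * p′ ≡ 2 * r + 3 * d + 3 * A′ → 6 * c + 3 * e + 3 * A′ + 3 * d ≤ 6 * c′ + 3 * A + 3 * p′ →
    6 * c + 3 * e + a ≤ 6 * c′ + 3 * A + 2 * r
  run-arith c c′ e r d A A′ p′ a eq h = +-cancelʳ-≤ (3 * p′) _ _ (begin
    6 * c + 3 * e + a + 3 * p′                    ≡⟨ +-assoc (6 * c + 3 * e) a (3 * p′) ⟩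
    6 * c + 3 * e + (a + 3 * p′)                  ≡⟨ cong (6 * c + 3 * e +_) eq ⟩
    6 * c + 3 * e + (2 * r + 3 * d + 3 * A′)      ≡⟨ e₁ c e r d A′ ⟩
    6 * c + 3 * e + 3 * A′ + 3 * d + 2 * r        ≤⟨ +-monoˡ-≤ (2 * r) h ⟩
    6 * c′ + 3 * A + 3 * p′ + 2 * r               ≡⟨ e₂ c′ A p′ r ⟩
    6 * c′ + 3 * A + 2 * r + 3 * p′               ∎)
    where
    open ≤-Reasoning
    e₁ : ∀ c e r d A → 6 * c + 3 * e + (2 * r + 3 * d + 3 * A) ≡ 6 * c + 3 * e + 3 * A + 3 * d + 2 * r
    e₁ = solve-∀
    e₂ : ∀ c A p r → 6 * c + 3 * A + 3 * p + 2 * r ≡ 6 * c + 3 * A + 2 * r + 3 * p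
    e₂ = solve-∀

  -- Vertices found by this run have nothing pending on the side it sweeps; older active vertices
  -- keep the side they had.
  run-sides : ∀ {dir S e E E′} → Searched dir S e B E E′ → Sides S E → Sides S E′
  run-sides {dir} {S} {e} {E} {E′} r sd {v} (v∈ , v∈E , w , p , le) with Searched.new-done r v∈E
  ... | inj₁ v∈E₀ = [ (λ d → inj₁ (Done-mono {S} {dir = true} ext d)) , (λ d → inj₂ (Done-mono {S} {dir = false} ext d)) ]′
                    (sd (v∈ , v∈E₀ , w , Pending-mono ext p , le))
    where
    ext : E ⊆ E′
    ext = Searched.extends r
  ... | inj₂ d = side dir d
    where
    side : ∀ dir → Done S E′ dir v → Done S E′ true v ⊎ Done S E′ false v
    side true = inj₁
    side false = inj₂

  run-credit : ∀ {dir F S A e E E′ Q} → WellFormed S → top S ∈ E → Sides S E → (∀ {u} → u ⊑ top S → u ∈ Q) →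
    Outcome dir F S A e E E′ →
    (Finished S E′ × Status Live E′ Q S 0) ⊎
    (∃[ a ] Status Live E′ Q S a × 6 * count E + 3 * e + a ≤ 6 * count E′ + 3 * length A + 2 * room S)
  run-credit wf t∈ sd ab (r , inj₁ fin) = inj₁ (fin , status wf (Searched.extends r t∈) (inj₁ fin))
  run-credit {dir} {F} {S} {A} {e} {E} {E′} wf t∈ sd ab (r , inj₂ (A′ , p′ , cov , ab′ , p∈ , _ , len , ineq)) =
    inj₂ (a , status wf (Searched.extends r t∈) (inj₂ (record
        { covers = cov ; sides = run-sides r sd ; above∈ = ab ; all-below = ab′ ; p∈ = p∈ ; credit = ≤-reflexive (sym a≡) })) ,
      run-arith (count E) (count E′) e (room S) (depth (top S)) (length A) (length A′) (depth p′) a a≡ ineq)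
    where
    total : ℕ
    total = 2 * room S + 3 * depth (top S) + 3 * length A′
    -- The least store that `Live` permits. The bound on the depth of the marker makes this
    -- subtraction exact.
    a : ℕ
    a = total ∸ 3 * depth p′
    a≡ : a + 3 * depth p′ ≡ total
    a≡ = m∸n+n≡m (begin
      3 * depth p′                                     ≤⟨ *-monoʳ-≤ 3 len ⟩
      3 * (depth (top S) + length A′)                  ≡⟨ *-distribˡ-+ 3 (depth (top S)) (length A′) ⟩
      3 * depth (top S) + 3 * length A′                ≤⟨ m≤n+m _ (2 * room S) ⟩
      2 * room S + (3 * depth (top S) + 3 * length A′) ≡⟨ +-assoc (2 * room S) _ _ ⟨
      total                                            ∎)
      where open ≤-Reasoning

  -- Leftmost and rightmost unexplored vertices

  First : Bool → Sub → List Vertex → Maybe Vertex → Set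
  First dir S E nothing = Finished S E
  First dir S E (just v) = ∃[ u ] ∃[ x ] v ≡ u ∷ʳ x × Pending S E v × u ∈ E × Done S E dir v

  KidsValid : Sub → List Tree → Vertex → Set
  KidsValid S ts = KidPath (λ i → i ∈ℕ kids S) 0 ts

  first-sub : ∀ dir {S E ts} m → at T (top S) ≡ node ts → WellFormed S →
    FirstSpec dir E (top S) (KidsValid S ts) m → First dir S E m
  first-sub dir {S} {E} {ts} m at≡ wf spec = convert m spec
    where
    to : ∀ {r} → KidsValid S ts r → In S (top S ++ r)
    to (j , t , q , n , ok , refl , v) = j , q , refl , ∈ℕ-true ok ,
      Valid-at T (top S) (j ∷ q) (top-valid wf) (subst (λ s → Valid s (j ∷ q)) (sym at≡) (Valid-∷⁺ ts j q n v))
    from : ∀ {w} → In S w → ∃[ r ] w ≡ top S ++ r × KidsValid S ts r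
    from (i , q , refl , i∈ , v) with Valid-∷⁻ ts i q (subst (λ s → Valid s (i ∷ q)) at≡ (Valid-at⁻ T (top S) (i ∷ q) v))
    ... | t , n , v′ = i ∷ q , refl , i , t , q , n , ∈ℕ-intro i∈ , refl , v′
    convert : ∀ m → FirstSpec dir E (top S) (KidsValid S ts) m → First dir S E m
    convert nothing spec w w∈ with from w∈
    ... | r , refl , k = spec r k
    convert (just v) (r , x , k , refl , v∉ , r∈ , bef) = top S ++ r , x , sym (++-assoc (top S) r (x ∷ [])) , (to k , v∉) , r∈ , done′
      where
      done′ : Done S E dir (top S ++ (r ∷ʳ x))
      done′ w (w∈ , w∉) b with from w∈
      ... | r′ , refl , k′ = w∉ (bef r′ k′ (Before-++⁻ (top S) b))

  leftmost-first : ∀ {S E} → WellFormed S → top S ∈ E → First true S E (leftmost T E S)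
  leftmost-first {S} {E} wf t∈ with at T (top S) in eq
  ... | node ts = first-sub true (firstUnexpl E (lseqK (λ i → i ∈ℕ kids S) (top S) 0 ts)) eq wf (lseqK-first _ (top S) 0 ts t∈)

  rightmost-first : ∀ {S E} → WellFormed S → top S ∈ E → First false S E (rightmost T E S)
  rightmost-first {S} {E} wf t∈ with at T (top S) in eq
  ... | node ts = first-sub false (firstUnexpl E (rseqK (λ i → i ∈ℕ kids S) (top S) 0 ts)) eq wf (rseqK-first _ (top S) 0 ts t∈)

  -- The distance test

  depth-In : ∀ {S u x} → In S (u ∷ʳ x) → depth (top S) ≤ depth u
  depth-In {S} {u} {x} (i , q , eq , _) = ≤-pred (begin
    suc (depth (top S))          ≤⟨ s≤s (m≤m+n _ (length q)) ⟩
    suc (depth (top S) + length q) ≡⟨ +-suc (depth (top S)) (length q) ⟨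
    depth (top S) + suc (length q) ≡⟨ length-++ (top S) ⟨
    depth (top S ++ i ∷ q)       ≡⟨ cong length eq ⟨
    depth (u ∷ʳ x)               ≡⟨ length-∷ʳ′ u x ⟩
    suc (depth u)                ∎)
    where open ≤-Reasoning

  dist-≡ : ∀ {S u x} → In S (u ∷ʳ x) → depth (u ∷ʳ x) ∸ depth (top S) ≡ suc (depth u ∸ depth (top S))
  dist-≡ {S} {u} {x} v∈ = trans (cong (_∸ depth (top S)) (length-∷ʳ′ u x)) (+-∸-assoc 1 (depth-In v∈))

  -- The test concerns the unexplored vertex, one level below `u`; hence `3 y` is at most `3 ⊔ g`
  -- minus 3, which is at most `g` in both cases of the maximum. The energy on arrival at `u` is
  -- `g ∸ y`.
  close-energy : ∀ {S u x} → In S (u ∷ʳ x) → closeEnough B S (u ∷ʳ x) ≡ true → 2 * room S ≤ 3 * (B ∸ depth u)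
  close-energy {S} {u} {x} v∈ close = subst (λ k → 2 * g ≤ 3 * k) energy
    (subst (2 * g ≤_) (sym (*-distribˡ-∸ 3 g y)) (m+n≤o⇒m≤o∸n (2 * g) (≤-trans (+-monoʳ-≤ (2 * g) 3y≤g) (≤-reflexive (e₁ g)))))
    where
    g y : ℕ
    g = room S
    y = depth u ∸ depth (top S)
    e₁ : ∀ g → 2 * g + g ≡ 3 * g
    e₁ = solve-∀
    energy : g ∸ y ≡ B ∸ depth u
    energy = trans (∸-+-assoc B (depth (top S)) y) (cong (B ∸_) (m+[n∸m]≡n (depth-In v∈)))
    test : 3 + 3 * y ≤ 3 ⊔ g
    test = subst (_≤ 3 ⊔ g) (trans (cong (3 *_) (dist-≡ v∈)) (*-suc 3 y)) (≤ᵇ⇒≤ _ _ (true⇒T close))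
    3y≤g : 3 * y ≤ g
    3y≤g with ≤-total 3 g
    ... | inj₁ 3≤g = ≤-trans (m≤n+m (3 * y) 3) (subst (3 + 3 * y ≤_) (m≤n⇒m⊔n≡n 3≤g) test)
    ... | inj₂ g≤3 = ≤-trans (+-cancelˡ-≤ 3 (3 * y) 0 (subst (3 + 3 * y ≤_) (m≥n⇒m⊔n≡m g≤3) test)) z≤n

  -- A failed test beats both arguments of the maximum: exceeding `g` makes the frontier deep, and
  -- exceeding 3 places the parent `u` strictly below the top.
  far-bounds : ∀ {S u x} → In S (u ∷ʳ x) → closeEnough B S (u ∷ʳ x) ≡ false →
    room S ≤ 3 + 3 * (depth u ∸ depth (top S)) × suc (depth (top S)) ≤ depth u
  far-bounds {S} {u} {x} v∈ far = ≤-trans (m≤n⊔m 3 g) (≤-trans (n≤1+n _) test) , deep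
    where
    g y : ℕ
    g = room S
    y = depth u ∸ depth (top S)
    test : suc (3 ⊔ g) ≤ 3 + 3 * y
    test = subst (suc (3 ⊔ g) ≤_) (trans (cong (3 *_) (dist-≡ v∈)) (*-suc 3 y))
      (≰⇒> λ le → false≢true far (T⇒true (≤⇒≤ᵇ le)))
    deep : suc (depth (top S)) ≤ depth u
    deep with depth u ≤? depth (top S)
    ... | no gt = ≰⇒> gt
    ... | yes le = contradiction (subst (λ k → suc (3 ⊔ g) ≤ 3 + 3 * k) (m≤n⇒m∸n≡0 le) test) (<⇒≱ (s≤s (m≤m⊔n 3 g)))

  Credits-lookup : ∀ {R : Sub → ℕ → Set} {𝒯 s S} → Credits R 𝒯 s → S ∈ 𝒯 → ∃[ a ] R S a
  Credits-lookup (c ∷ cs) (here refl) = _ , c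
  Credits-lookup (c ∷ cs) (there S∈) = Credits-lookup cs S∈

  -- One round of the main loop

  single-arith : ∀ G g Q a s c c′ a′ A → 2 * G + 2 * Q + (a + s) ≤ 6 * c → 2 * g + 3 * A ≤ a → 6 * c + a′ ≤ 6 * c′ + 3 * A →
    2 * (G + g) + 2 * Q + (a′ + s) ≤ 6 * c′
  single-arith G g Q a s c c′ a′ A h₁ h₂ h₃ = +-cancelʳ-≤ (3 * A) _ _ (begin
    2 * (G + g) + 2 * Q + (a′ + s) + 3 * A        ≡⟨ e₁ G g Q a′ s A ⟩
    (2 * G + 2 * Q + (2 * g + 3 * A + s)) + a′    ≤⟨ +-monoˡ-≤ a′ (+-monoʳ-≤ (2 * G + 2 * Q) (+-monoˡ-≤ s h₂)) ⟩
    (2 * G + 2 * Q + (a + s)) + a′                ≤⟨ +-monoˡ-≤ a′ h₁ ⟩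
    6 * c + a′                                    ≤⟨ h₃ ⟩
    6 * c′ + 3 * A                                ∎)
    where
    open ≤-Reasoning
    e₁ : ∀ G g Q a s A → 2 * (G + g) + 2 * Q + (a + s) + 3 * A ≡ (2 * G + 2 * Q + (2 * g + 3 * A + s)) + a
    e₁ = solve-∀

  -- The two allowances cost `4 g`: the released store of `S` gives `2 g`, and each run contributes
  -- a surplus of `g`. The list of `S` is shared out between the two parts.
  divide-arith : ∀ G g Q a s c c₁ c₂ a₁ a₂ A A₁ A₂ → 2 * G + 2 * Q + (a + s) ≤ 6 * c → 2 * g + 3 * A ≤ a → A₁ + A₂ ≤ A →
    6 * c + g + a₁ ≤ 6 * c₁ + 3 * A₁ → 6 * c₁ + g + a₂ ≤ 6 * c₂ + 3 * A₂ →
    2 * (G + g + g) + 2 * Q + (a₁ + (a₂ + 0) + s) ≤ 6 * c₂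
  divide-arith G g Q a s c c₁ c₂ a₁ a₂ A A₁ A₂ h₁ h₂ h₃ h₄ h₅ = +-cancelʳ-≤ (3 * A₁ + 3 * A₂ + 6 * c₁) _ _ (begin
    2 * (G + g + g) + 2 * Q + (a₁ + (a₂ + 0) + s) + (3 * A₁ + 3 * A₂ + 6 * c₁)  ≡⟨ e₁ G g Q a₁ a₂ s A₁ A₂ c₁ ⟩
    (2 * G + 2 * Q + (2 * g + 3 * (A₁ + A₂) + s)) + (g + a₁) + (6 * c₁ + g + a₂) ≤⟨ +-monoˡ-≤ (6 * c₁ + g + a₂) (+-monoˡ-≤ (g + a₁) (+-monoʳ-≤ (2 * G + 2 * Q) (+-monoˡ-≤ s (≤-trans (+-monoʳ-≤ (2 * g) (*-monoʳ-≤ 3 h₃)) h₂)))) ⟩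
    (2 * G + 2 * Q + (a + s)) + (g + a₁) + (6 * c₁ + g + a₂)                     ≤⟨ +-monoˡ-≤ (6 * c₁ + g + a₂) (+-monoˡ-≤ (g + a₁) h₁) ⟩
    6 * c + (g + a₁) + (6 * c₁ + g + a₂)                                         ≡⟨ cong (_+ (6 * c₁ + g + a₂)) (sym (+-assoc (6 * c) g a₁)) ⟩
    6 * c + g + a₁ + (6 * c₁ + g + a₂)                                           ≤⟨ +-mono-≤ h₄ h₅ ⟩
    6 * c₁ + 3 * A₁ + (6 * c₂ + 3 * A₂)                                          ≡⟨ e₂ c₁ A₁ c₂ A₂ ⟩
    6 * c₂ + (3 * A₁ + 3 * A₂ + 6 * c₁)                                          ∎)
    where
    open ≤-Reasoning
    e₁ : ∀ G g Q a₁ a₂ s A₁ A₂ c₁ → 2 * (G + g + g) + 2 * Q + (a₁ + (a₂ + 0) + s) + (3 * A₁ + 3 * A₂ + 6 * c₁) ≡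
      (2 * G + 2 * Q + (2 * g + 3 * (A₁ + A₂) + s)) + (g + a₁) + (6 * c₁ + g + a₂)
    e₁ = solve-∀
    e₂ : ∀ c₁ A₁ c₂ A₂ → 6 * c₁ + 3 * A₁ + (6 * c₂ + 3 * A₂) ≡ 6 * c₂ + (3 * A₁ + 3 * A₂ + 6 * c₁)
    e₂ = solve-∀

  _⊑?_ : ∀ u v → Dec (u ⊑ v)
  [] ⊑? v = yes (v , refl)
  (x ∷ u) ⊑? [] = no λ { (_ , ()) }
  (x ∷ u) ⊑? (y ∷ v) with x ≟ y | u ⊑? v
  ... | yes refl | yes (q , refl) = yes (q , refl)
  ... | no x≢y | _ = no λ { (q , refl) → x≢y refl }
  ... | _ | no u⋢v = no λ { (q , refl) → u⋢v (q , refl) }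

  module Round {m E 𝒯} (st : State Ready m E 𝒯) {j S} (nth≡ : nth j 𝒯 ≡ just S) (pend : ∃[ w ] Pending S E w)
               (least : ∀ {S′} → S′ ∈ 𝒯 → ∃[ w ] Pending S′ E w → depth (top S) ≤ depth (top S′)) where
    open State st

    g : ℕ
    g = room S

    chosen : ∃[ a ] ∃[ s′ ] s ≡ a + s′ × Status Ready E Q S a ×
        (∀ {new b E′} → E ⊆ E′ → (∀ {v} → v ∈ E′ → v ∈ E ⊎ In S v) →
         Credits (Status Live E′ Q) new b → Credits (Status Live E′ Q) (replaceAt j new 𝒯) (b + s′))
    chosen = credits-replace j nth≡ disjoint credits

    a s′ : ℕ
    a = proj₁ chosen
    s′ = proj₁ (proj₂ chosen)

    private
      stat : Status Ready E Q S a
      stat = proj₁ (proj₂ (proj₂ (proj₂ chosen)))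

    wf : WellFormed S
    wf = Status.wf stat

    top∈ : top S ∈ E
    top∈ = Status.top∈ stat

    ready : Ready E Q S a
    ready with Status.credit stat
    ... | inj₁ fin = contradiction (fin _ (proj₁ (proj₂ pend))) (proj₂ (proj₂ pend))
    ... | inj₂ r = r

    module R = Ready ready

    funded′ : 2 * G + 2 * length Q + (a + s′) ≤ 6 * count E
    funded′ = subst (λ k → 2 * G + 2 * length Q + k ≤ 6 * count E) (proj₁ (proj₂ (proj₂ chosen))) funded

    g≤ : g ≤ B ∸ d
    g≤ = ∸-monoʳ-≤ B (All.lookup low (nth-∈ j nth≡) pend)

    far : ∀ {r} → Route T B r → ∃[ w ] (w ∈ r × w ∉ E) → ∃[ N ] length N ≤ g × r ⊆ Q ++ N
    far rt (w , w∈ , w∉) with find (covered (chain-valid (proj₁ rt) w∈) w∉)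
    ... | S′ , S′∈ , w∈S with Credits-lookup credits S′∈
    ...   | _ , status _ _ (inj₁ fin) = contradiction (fin w w∈S) w∉
    ...   | _ , status _ _ (inj₂ r) with route-outside rt w∈ (top⊑In w∈S) (Ready.above∈ r)
    ...     | N , len , sub′ = N , ≤-trans len (∸-monoʳ-≤ B (least S′∈ (w , w∈S , w∉))) , sub′

    shallow-run : ∀ {dir S e E₀ E′} → Searched dir S e B E₀ E′ → (∀ {v} → v ∈ E₀ → depth v ≤ B) → ∀ {v} → v ∈ E′ → depth v ≤ B
    shallow-run r sh v∈ = [ sh , id ]′ (Searched.shallow r v∈)

    rebuild : ∀ {m′ E′ G′ new b} → E ⊆ E′ → Closed E′ → (∀ {v} → v ∈ E′ → depth v ≤ B) → (∀ {v} → v ∈ E′ → v ∈ E ⊎ In S v) →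
      Credits (Status Live E′ Q) new b → AllPairs Disjoint new →
      Allᴸ (λ S′ → ∀ {w} → In S′ w → In S w) new → Allᴸ (λ S′ → top S′ ≡ top S) new →
      (∀ {w} → In S w → Any (λ S′ → In S′ w) new) →
      Compared m′ E′ G′ g Q → 2 * G′ + 2 * length Q + (b + s′) ≤ 6 * count E′ →
      State Live m′ E′ (replaceAt j new 𝒯)
    rebuild ext cl sh new cs ds ins tops cov cmp fund = record
      { closed = cl ; root∈ = ext root∈ ; shallow = sh ; root∈Q = root∈Q
      ; credits = proj₂ (proj₂ (proj₂ (proj₂ chosen))) ext new cs
      ; disjoint = replace-disjoint j nth≡ ins ds disjoint
      ; covered = λ val w∉ → replace-Any j nth≡ cov (covered val (λ w∈ → w∉ (ext w∈)))
      ; low = replace-All j (All.tabulate λ S′∈ (w , p) → least S′∈ (w , Pending-mono ext p))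
                            (All.map (λ { eq _ → ≤-reflexive (cong depth (sym eq)) }) tops)
      ; compared = cmp
      ; funded = fund }

    -- A route that leaves the larger set `E₀` also leaves `E`, so the bound for the chosen subtree
    -- still holds for the second agent of a division.
    after-run : ∀ {dir e E₀ S₀ E′ m G g₀} → E ⊆ E₀ → e ≤ g → g ≤ g₀ → Searched dir S₀ e B E₀ E′ → Compared m E₀ G g₀ Q → Compared (suc m) E′ (G + g) g Q
    after-run {E₀ = E₀} ext e≤ g≤ r cmp = Compared-step {E₀} (λ rt (w , w∈ , w∉) → far rt (w , w∈ , λ z → w∉ (ext z))) cmp g≤
      (λ v∈ → [ inj₁ , (λ x → inj₂ (proj₁ x)) ]′ (Searched.new r v∈)) (≤-trans (Searched.fresh-≤ r) e≤)

    single : ∀ {dir F e E′} → e ≤ g → 2 * g ≤ 3 * e → Outcome dir F S R.A e E E′ → State Live (suc m) E′ 𝒯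
    single {dir} {F} {e} {E′} e≤ 2g≤ out@(r , _) = subst (State Live (suc m) E′) (replace-same j nth≡)
      (rebuild (Searched.extends r) (Searched.closed r) (shallow-run r shallow)
        (λ v∈ → [ inj₁ , (λ x → inj₂ (proj₂ x)) ]′ (Searched.new r v∈))
        (proj₁ (proj₂ credit) ∷ []) ([] ∷ []) (id ∷ []) (refl ∷ []) here
        (after-run id e≤ g≤ r compared)
        (subst (λ k → 2 * (G + g) + 2 * length Q + (k + s′) ≤ 6 * count E′) (sym (+-identityʳ (proj₁ credit)))
          (single-arith G g (length Q) a s′ (count E) (count E′) (proj₁ credit) (length R.A) funded′ R.credit (proj₂ (proj₂ credit)))))
      where
      credit : ∃[ a′ ] Status Live E′ Q S a′ × 6 * count E + a′ ≤ 6 * count E′ + 3 * length R.A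
      credit with run-credit {A = R.A} wf top∈ R.sides R.above∈ out
      ... | inj₁ (_ , l) = 0 , l , ≤-trans (≤-reflexive (+-identityʳ _)) (≤-trans (*-monoʳ-≤ 6 (count-mono {E} (Searched.extends r))) (m≤m+n _ _))
      ... | inj₂ (a′ , l , h) = a′ , l , +-cancelʳ-≤ (3 * e) _ _ (begin
        6 * count E + a′ + 3 * e                   ≡⟨ swap (6 * count E) a′ (3 * e) ⟩
        6 * count E + 3 * e + a′                   ≤⟨ h ⟩
        6 * count E′ + 3 * length R.A + 2 * g      ≤⟨ +-monoʳ-≤ (6 * count E′ + 3 * length R.A) 2g≤ ⟩
        6 * count E′ + 3 * length R.A + 3 * e      ∎)
        where
        open ≤-Reasoning
        swap : ∀ a b c → a + b + c ≡ a + c + b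
        swap = solve-∀

    run-close : ∀ dir {u x} → In S (u ∷ʳ x) → u ∷ʳ x ∉ E → u ∈ E → Done S E dir (u ∷ʳ x) →
      closeEnough B S (u ∷ʳ x) ≡ true → State Live (suc m) (runDFS T B dir S (u ∷ʳ x) E) 𝒯
    run-close dir v∈ v∉ u∈ v-done close =
      single (∸-monoʳ-≤ B (depth-In v∈)) (close-energy v∈ close)
        (run-from-first wf closed root∈ top∈ R.covers dir v∈ v∉ u∈ v-done R.sides)

    -- A run from the top either uses the whole energy or completes a subtree
    -- whose frontier was deep.
    fresh-credit : ∀ {dir F S₀ A E₀ E′ u x} → top S₀ ≡ top S → WellFormed S₀ → top S₀ ∈ E₀ → Sides S₀ E₀ → Closed E₀ → Covers S₀ E₀ A →
      In S₀ (u ∷ʳ x) → u ∷ʳ x ∉ E₀ → u ∈ E₀ → g ≤ 3 + 3 * (depth u ∸ depth (top S)) →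
      Outcome dir F S₀ A g E₀ E′ → ∃[ a′ ] Status Live E′ Q S₀ a′ × 6 * count E₀ + g + a′ ≤ 6 * count E′ + 3 * length A
    fresh-credit {S₀ = S₀} {A} {E₀} {E′} {u} {x} refl wf₀ t∈ sd cl cov v∈ v∉ u∈ deep out@(r , _) with run-credit {A = A} wf₀ t∈ sd R.above∈ out
    ... | inj₂ (a′ , l , h) = a′ , l , +-cancelʳ-≤ (2 * g) _ _ (≤-trans (≤-reflexive (e₁ (6 * count E₀) g a′)) h)
      where
      e₁ : ∀ c g a → c + g + a + 2 * g ≡ c + 3 * g + a
      e₁ = solve-∀
    ... | inj₁ (fin , l) = 0 , l , (begin
      6 * count E₀ + g + 0                                   ≡⟨ +-identityʳ _ ⟩
      -- One new vertex is certain and gives 6 credits, of which 3 are needed here; the rest of the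
      -- bound on `g` is 3 credits for each active vertex on the path to `u`.
      6 * count E₀ + g                                       ≤⟨ +-monoʳ-≤ (6 * count E₀) (≤-trans deep (≤-trans (+-monoʳ-≤ 3 (*-monoʳ-≤ 3 long)) (+-monoˡ-≤ (3 * length A) (s≤s (s≤s (s≤s (z≤n {3}))))))) ⟩
      6 * count E₀ + (6 + 3 * length A)                      ≡⟨ e₂ (count E₀) (length A) ⟩
      6 * suc (count E₀) + 3 * length A                      ≤⟨ +-monoˡ-≤ (3 * length A) (*-monoʳ-≤ 6 (count-grows v∉ (fin _ v∈) (Searched.extends r))) ⟩
      6 * count E′ + 3 * length A                            ∎)
      where
      open ≤-Reasoning
      e₂ : ∀ c a → 6 * c + (6 + 3 * a) ≡ 6 * suc c + 3 * a
      e₂ = solve-∀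
      pos-u : Pos S₀ u
      pos-u with Pos-parent v∈
      ... | u′ , x′ , eq′ , pos = subst (Pos S₀) (sym (∷ʳ-injectiveˡ u u′ eq′)) pos
      long : depth u ∸ depth (top S₀) ≤ length A
      long = m≤n+o⇒m∸n≤o (depth u) (depth (top S₀))
        (path-length pos-u (λ y∈ y⊑u → cov (y∈ , cl y⊑u u∈ , u ∷ʳ x , (v∈ , v∉) , ⊑-trans y⊑u ⊑-∷ʳ)))

    module Divide {uL xL uR xR}
      (vL∈ : In S (uL ∷ʳ xL)) (vL∉ : uL ∷ʳ xL ∉ E) (uL∈ : uL ∈ E) (vL-done : Done S E true (uL ∷ʳ xL)) (farL : closeEnough B S (uL ∷ʳ xL) ≡ false)
      (vR∈ : In S (uR ∷ʳ xR)) (vR∉ : uR ∷ʳ xR ∉ E) (uR∈ : uR ∈ E) (vR-done : Done S E false (uR ∷ʳ xR)) (farR : closeEnough B S (uR ∷ʳ xR) ≡ false) where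

      vL vR : Vertex
      vL = uL ∷ʳ xL
      vR = uR ∷ʳ xR

      v : ℕ
      v = proj₁ vR∈

      v-nth : nth (depth (top S)) vR ≡ just v
      v-nth = let (i , q , eq , _) = vR∈ in trans (cong (nth (depth (top S))) eq) (nth-++ (top S))

      S₁ S₂ : Sub
      S₁ = mkSub (top S) (filterᵇ (λ i → not (i ≡ᵇ v)) (kids S))
      S₂ = mkSub (top S) (v ∷ [])

      ∈-kids₁ : ∀ {i} → i ∈ kids S → i ≢ v → i ∈ kids S₁
      ∈-kids₁ {i} i∈ i≢v = ∈-filterᵇ⁺ _ i∈ (test i≢v)
        where
        test : i ≢ v → not (i ≡ᵇ v) ≡ true
        test i≢v with i ≡ᵇ v in eq
        ... | true = contradiction (≡ᵇ-true i v eq) i≢v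
        ... | false = refl

      kids₁⁻ : ∀ {i} → i ∈ kids S₁ → i ∈ kids S × i ≢ v
      kids₁⁻ {i} i∈ with ∈-filterᵇ⁻ (λ i → not (i ≡ᵇ v)) i∈
      ... | i∈S , ne = i∈S , λ { refl → false≢true (cong not (≡ᵇ-intro {i} refl)) ne }

      In₁⇒In : ∀ {w} → In S₁ w → In S w
      In₁⇒In (i , q , eq , i∈ , val) = i , q , eq , proj₁ (kids₁⁻ i∈) , val

      v∈kids : v ∈ kids S
      v∈kids = let (_ , _ , _ , i∈ , _) = vR∈ in i∈

      In₂⇒In : ∀ {w} → In S₂ w → In S w
      In₂⇒In (i , q , eq , here refl , val) = i , q , eq , v∈kids , val

      In-split : ∀ {w} → In S w → Any (λ S′ → In S′ w) (S₁ ∷ S₂ ∷ [])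
      In-split (i , q , eq , i∈ , val) with i ≟ v
      ... | yes refl = there (here (i , q , eq , here refl , val))
      ... | no i≢v = here (i , q , eq , ∈-kids₁ i∈ i≢v , val)

      disjoint₁₂ : Disjoint S₁ S₂
      disjoint₁₂ w (i , q , eq , i∈ , _) (.v , q′ , eq′ , here refl , _) =
        proj₂ (kids₁⁻ i∈) (proj₁ (∷-injective (++-cancelˡ (top S) _ _ (trans (sym eq) eq′))))

      wf₁ : WellFormed S₁
      wf₁ = record { top-valid = WellFormed.top-valid wf ; sorted = AllPairs.filter⁺ _ (WellFormed.sorted wf)
                   ; kids-valid = λ i∈ → WellFormed.kids-valid wf (proj₁ (kids₁⁻ i∈)) }

      wf₂ : WellFormed S₂
      wf₂ = record { top-valid = WellFormed.top-valid wf ; sorted = [] ∷ [] ; kids-valid = λ { (here refl) → WellFormed.kids-valid wf v∈kids } }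

      vR∈₂ : In S₂ vR
      vR∈₂ = let (i , q , eq , _ , val) = vR∈ in i , q , eq , here refl , val

      -- If both extreme vertices were below the same child, every pending vertex would be: one in
      -- an earlier child would precede the leftmost, one in a later child the rightmost. That child
      -- is explored because `vL` is far, so the top would not be stuck.
      vL-kid≢v : proj₁ vL∈ ≢ v
      vL-kid≢v kid≡v = R.stuck v only
        where
        vi∈E : top S ∷ʳ v ∈ E
        vi∈E with ⊑-∷ʳ⁻ {top S ∷ʳ v} {uL} {xL} (let (i , q , eq , _) = vL∈ in
                    q , trans eq (trans (cong (λ k → top S ++ k ∷ q) kid≡v) (sym (∷ʳ-++ (top S) v q))))
        ... | inj₂ le = closed le uL∈
        ... | inj₁ e = contradiction (proj₂ (far-bounds {S} vL∈ farL)) (<⇒≱ (s≤s (≤-reflexive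
                  (suc-injective (trans (sym (length-∷ʳ′ uL xL)) (trans (cong length (sym e)) (length-∷ʳ′ (top S) v)))))))
        only : ∀ w → Pending S E w → ∃[ i ] ∃[ q ] w ≡ top S ++ v ∷ i ∷ q
        only w p@((k , q , refl , k∈ , val) , w∉) with <-cmp k v
        ... | tri< lt _ _ = contradiction (subst (Before true _) (sym (proj₁ (proj₂ (proj₂ vL∈)))) (Before-++ (top S) (here (subst (k <_) (sym kid≡v) lt)))) (vL-done _ p)
        ... | tri> _ _ gt = contradiction (subst (Before false _) (sym (proj₁ (proj₂ (proj₂ vR∈)))) (Before-++ (top S) (here gt))) (vR-done _ p)
        only w p@((k , [] , refl , k∈ , val) , w∉) | tri≈ _ refl _ = contradiction vi∈E w∉
        only w p@((k , i ∷ q , refl , k∈ , val) , w∉) | tri≈ _ refl _ = i , q , refl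

      vL∈₁ : In S₁ vL
      vL∈₁ = let (i , q , eq , i∈ , val) = vL∈ in i , q , eq , ∈-kids₁ i∈ vL-kid≢v , val

      A₁ A₂ : List Vertex
      A₁ = filter (¬? ∘ ((top S ∷ʳ v) ⊑?_)) R.A
      A₂ = filter ((top S ∷ʳ v) ⊑?_) R.A

      A-split : length A₁ + length A₂ ≤ length R.A
      A-split = ≤-reflexive (trans (+-comm (length A₁) _) (length-split ((top S ∷ʳ v) ⊑?_) R.A))

      active₁ : ∀ {y} → Active S₁ E y → Active S E y
      active₁ (y∈ , y∈E , w , (w∈ , w∉) , le) = In₁⇒In y∈ , y∈E , w , (In₁⇒In w∈ , w∉) , le

      active₂ : ∀ {y} → Active S₂ E y → Active S E y
      active₂ (y∈ , y∈E , w , (w∈ , w∉) , le) = In₂⇒In y∈ , y∈E , w , (In₂⇒In w∈ , w∉) , le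

      covers₁ : Covers S₁ E A₁
      covers₁ {y} act@((i , q , eq , i∈ , _) , _) = ∈-filter⁺ (¬? ∘ ((top S ∷ʳ v) ⊑?_)) (R.covers (active₁ act))
        λ (q′ , eq′) → proj₂ (kids₁⁻ i∈) (proj₁ (∷-injective (++-cancelˡ (top S) _ _ (trans (sym eq) (trans eq′ (∷ʳ-++ (top S) v q′))))))

      covers₂ : Covers S₂ E A₂
      covers₂ {y} act@((.v , q , eq , here refl , _) , _) = ∈-filter⁺ ((top S ∷ʳ v) ⊑?_) (R.covers (active₂ act))
        (q , trans eq (sym (∷ʳ-++ (top S) v q)))

      -- Every pending vertex of `S₁` lies left of the rightmost child `v`, as `vR` is rightmost. An
      -- active vertex of `S₁` therefore has `vR` pending on its right, and its clear side must be
      -- the left one. `far₂` is the mirror image with `vL`.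
      far₁ : ∀ {y} → Active S₁ E y → Done S₁ E true y
      far₁ {y} act@((k , q , refl , k∈ , _) , _ , w , (w∈ , w∉) , (r , refl)) with R.sides (active₁ act)
      ... | inj₁ d = λ z (z∈ , z∉) → d z (In₁⇒In z∈ , z∉)
      ... | inj₂ d with <-cmp k v
      ...   | tri≈ _ k≡v _ = contradiction k≡v (proj₂ (kids₁⁻ k∈))
      ...   | tri< lt _ _ = contradiction (subst (λ z → Before false z _) (sym (proj₁ (proj₂ (proj₂ vR∈)))) (Before-++ (top S) (here lt))) (d vR (vR∈ , vR∉))
      ...   | tri> _ _ gt = contradiction
              (Before-⊑ (r , refl) ⊑-refl (subst (Before false _) (sym (proj₁ (proj₂ (proj₂ vR∈)))) (Before-++ (top S) (here gt))))
              (vR-done w (In₁⇒In w∈ , w∉))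

      far₂ : ∀ {y} → Active S₂ E y → Done S₂ E false y
      far₂ {y} act@((.v , q , refl , here refl , _) , _ , w , (w∈ , w∉) , (r , refl)) with R.sides (active₂ act)
      ... | inj₂ d = λ z (z∈ , z∉) → d z (In₂⇒In z∈ , z∉)
      ... | inj₁ d with <-cmp (proj₁ vL∈) v
      ...   | tri≈ _ e _ = contradiction e vL-kid≢v
      ...   | tri< lt _ _ = contradiction (subst (λ z → Before true z _) (sym (proj₁ (proj₂ (proj₂ vL∈)))) (Before-++ (top S) (here lt))) (d vL (vL∈ , vL∉))
      ...   | tri> _ _ gt = contradiction
              (Before-⊑ (r , refl) ⊑-refl (subst (Before true _) (sym (proj₁ (proj₂ (proj₂ vL∈)))) (Before-++ (top S) (here gt))))
              (vL-done w (In₂⇒In w∈ , w∉))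

      E₁ E₂ : List Vertex
      E₁ = runDFS T B false S₁ (top S) E
      E₂ = runDFS T B true S₂ (top S) E₁

      out₁ : Outcome false (Done S₁ E true) S₁ A₁ g E E₁
      out₁ = run-from-top wf₁ closed root∈ top∈ covers₁ false (shallow top∈) far₁ id

      module R₁ = Searched (proj₁ out₁)

      same₂ : ∀ {w} → In S₂ w → w ∈ E₁ → w ∈ E
      same₂ w∈₂ w∈ = [ id , (λ x → contradiction w∈₂ (disjoint₁₂ _ (proj₂ x))) ]′ (R₁.new w∈)

      active₂′ : ∀ {y} → Active S₂ E₁ y → Active S₂ E y
      active₂′ (y∈ , y∈E , w , p , le) = y∈ , same₂ y∈ y∈E , w , Pending-mono R₁.extends p , le

      out₂ : Outcome true (Done S₂ E₁ false) S₂ A₂ g E₁ E₂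
      out₂ = run-from-top wf₂ R₁.closed (R₁.extends root∈) (R₁.extends top∈) (λ x → covers₂ (active₂′ x)) true (shallow top∈)
        (λ x → Done-mono {S₂} {dir = false} R₁.extends (far₂ (active₂′ x))) id

      module R₂ = Searched (proj₁ out₂)

      sides₁ : Sides S₁ E
      sides₁ x = inj₁ (far₁ x)

      sides₂ : Sides S₂ E₁
      sides₂ x = inj₂ (Done-mono {S₂} {dir = false} R₁.extends (far₂ (active₂′ x)))

      credit₁ : ∃[ a′ ] Status Live E₁ Q S₁ a′ × 6 * count E + g + a′ ≤ 6 * count E₁ + 3 * length A₁
      credit₁ = fresh-credit refl wf₁ top∈ sides₁ closed covers₁ vL∈₁ vL∉ uL∈ (proj₁ (far-bounds vL∈ farL)) out₁

      credit₂ : ∃[ a′ ] Status Live E₂ Q S₂ a′ × 6 * count E₁ + g + a′ ≤ 6 * count E₂ + 3 * length A₂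
      credit₂ = fresh-credit refl wf₂ (R₁.extends top∈) sides₂ R₁.closed (λ x → covers₂ (active₂′ x))
        vR∈₂ (λ z → vR∉ (same₂ vR∈₂ z)) (R₁.extends uR∈) (proj₁ (far-bounds vR∈ farR)) out₂

      compared₁ : Compared (suc m) E₁ (G + g) g Q
      compared₁ = after-run id ≤-refl g≤ (proj₁ out₁) compared

      -- The agents may run out between the two runs of a division. With one allowance to pay, the
      -- released store of `S` suffices, without any surplus from the run.
      competitive₁ : Competitive (suc m) E₁
      competitive₁ = competitive-compared compared₁ root∈Q (begin
        2 * (G + g) + 2 * length Q       ≡⟨ e₁ G g (length Q) ⟩
        2 * G + 2 * length Q + 2 * g     ≤⟨ +-monoʳ-≤ (2 * G + 2 * length Q) (≤-trans (m≤m+n (2 * g) _) (≤-trans R.credit (m≤m+n a s′))) ⟩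
        2 * G + 2 * length Q + (a + s′)  ≤⟨ funded′ ⟩
        6 * count E                      ≤⟨ *-monoʳ-≤ 6 (count-mono {E} R₁.extends) ⟩
        6 * count E₁                     ∎)
        where
        open ≤-Reasoning
        e₁ : ∀ G g q → 2 * (G + g) + 2 * q ≡ 2 * G + 2 * q + 2 * g
        e₁ = solve-∀

      state₂ : State Live (suc (suc m)) E₂ (replaceAt j (S₁ ∷ S₂ ∷ []) 𝒯)
      state₂ = rebuild (λ z → R₂.extends (R₁.extends z)) R₂.closed (shallow-run (proj₁ out₂) (shallow-run (proj₁ out₁) shallow))
        (λ z → [ (λ z₁ → [ inj₁ , (λ x → inj₂ (In₁⇒In (proj₂ x))) ]′ (R₁.new z₁)) , (λ x → inj₂ (In₂⇒In (proj₂ x))) ]′ (R₂.new z))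
        (Live-mono R₂.extends (λ w∈₁ z → [ id , (λ x → contradiction (proj₂ x) (disjoint₁₂ _ w∈₁)) ]′ (R₂.new z)) (proj₁ (proj₂ credit₁))
          ∷ proj₁ (proj₂ credit₂) ∷ [])
        ((disjoint₁₂ ∷ []) ∷ [] ∷ []) (In₁⇒In ∷ In₂⇒In ∷ []) (refl ∷ refl ∷ []) In-split
        (after-run R₁.extends ≤-refl ≤-refl (proj₁ out₂) compared₁)
        (divide-arith G g (length Q) a s′ (count E) (count E₁) (count E₂) (proj₁ credit₁) (proj₁ credit₂) (length R.A) (length A₁) (length A₂)
          funded′ R.credit A-split (proj₂ (proj₂ credit₁)) (proj₂ (proj₂ credit₂)))

  -- The choice of a subtree

  indexed⁻ : ∀ {X : Set} i {xs : List X} {j x} → (j , x) ∈ indexed i xs → ∃[ k ] j ≡ i + k × nth k xs ≡ just x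
  indexed⁻ i {y ∷ xs} (here refl) = 0 , sym (+-identityʳ i) , refl
  indexed⁻ i {y ∷ xs} (there p) with indexed⁻ (suc i) p
  ... | k , eq , n = suc k , trans eq (sym (+-suc i k)) , n

  indexed⁺ : ∀ {X : Set} i {xs : List X} {x} → x ∈ xs → ∃[ j ] (j , x) ∈ indexed i xs
  indexed⁺ i (here refl) = i , here refl
  indexed⁺ i (there x∈) with indexed⁺ (suc i) x∈
  ... | j , p = j , there p

  minimum-≤ : ∀ xs {x} → x ∈ xs → minimum xs ≤ x
  minimum-≤ (x ∷ []) (here refl) = ≤-refl
  minimum-≤ (x ∷ y ∷ xs) (here refl) = m⊓n≤m x _
  minimum-≤ (x ∷ y ∷ xs) (there z∈) = ≤-trans (m⊓n≤n x _) (minimum-≤ (y ∷ xs) z∈)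

  minimum-∈ : ∀ x xs → minimum (x ∷ xs) ∈ x ∷ xs
  minimum-∈ x [] = here refl
  minimum-∈ x (y ∷ xs) with ⊓-sel x (minimum (y ∷ xs))
  ... | inj₁ eq = here eq
  ... | inj₂ eq = there (subst (_∈ y ∷ xs) (sym eq) (minimum-∈ y xs))

  pick-just : ∀ n ms {j} → pick n ms ≡ just j → j ∈ ms
  pick-just n ms eq with nth n ms in e
  pick-just n ms refl | just j = nth-∈ n e
  pick-just n (m ∷ ms) refl | nothing = here refl

  pick-nothing : ∀ n ms → pick n ms ≡ nothing → ms ≡ []
  pick-nothing n [] eq = refl
  pick-nothing n (m ∷ ms) eq with nth n (m ∷ ms)
  pick-nothing n (m ∷ ms) () | just _
  pick-nothing n (m ∷ ms) () | nothing

  module _ (E : List Vertex) (𝒯 : List Sub) where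

    unfinishedᵇ : ℕ × Sub → Bool
    unfinishedᵇ p = hasUnexpl E (vertsS T (proj₂ p))

    topDepth : ℕ × Sub → ℕ
    topDepth p = depth (top (proj₂ p))

    candidates : List (ℕ × Sub)
    candidates = filterᵇ unfinishedᵇ (indexed 0 𝒯)

    minsOf⁻ : ∀ {j} → j ∈ minsOf T E 𝒯 → ∃[ S ] nth j 𝒯 ≡ just S × hasUnexpl E (vertsS T S) ≡ true ×
      (∀ {S′} → S′ ∈ 𝒯 → hasUnexpl E (vertsS T S′) ≡ true → depth (top S) ≤ depth (top S′))
    minsOf⁻ j∈ with ∈-map⁻ proj₁ j∈
    ... | (j , S) , p∈ , refl with ∈-filterᵇ⁻ (λ p → topDepth p ≡ᵇ minimum (map topDepth candidates)) {candidates} p∈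
    ...   | c∈ , isMin with ∈-filterᵇ⁻ unfinishedᵇ {indexed 0 𝒯} c∈
    ...     | i∈ , unf with indexed⁻ 0 i∈
    ...       | k , refl , n = S , n , unf , λ {S′} S′∈ unf′ → let (j′ , p′) = indexed⁺ 0 S′∈ in
                subst (_≤ depth (top S′)) (sym (≡ᵇ-true (depth (top S)) _ isMin))
                  (minimum-≤ (map topDepth candidates) (∈-map⁺ topDepth (∈-filterᵇ⁺ unfinishedᵇ p′ unf′)))

    minsOf-∃ : ∀ {S} → S ∈ 𝒯 → hasUnexpl E (vertsS T S) ≡ true → minsOf T E 𝒯 ≢ []
    minsOf-∃ S∈ unf eq = go candidates refl (∈-filterᵇ⁺ unfinishedᵇ (proj₂ (indexed⁺ 0 S∈)) unf)
      where
      go : ∀ cs → cs ≡ candidates → ∀ {p} → p ∈ candidates → ⊥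
      go [] e p∈ with subst (_ ∈_) (sym e) p∈
      ... | ()
      go (c ∷ cs) e _ with ∈-map⁻ topDepth (subst (λ z → minimum (map topDepth z) ∈ map topDepth z) e (minimum-∈ (topDepth c) (map topDepth cs)))
      ... | q , q∈ , min≡ = contradiction (subst (proj₁ q ∈_) eq (∈-map⁺ proj₁ (∈-filterᵇ⁺ (λ p → topDepth p ≡ᵇ minimum (map topDepth candidates)) q∈ (≡ᵇ-intro (sym min≡))))) λ ()

  -- The main loop

  explored? : ∀ E → (∀ {w} → Valid T w → w ∈ E) ⊎ ∃[ w ] (Valid T w × w ∉ E)
  explored? E with hasUnexpl E (vertsT [] T) in h
  ... | false = inj₁ λ {w} val → hasUnexpl-false (vertsT [] T) h (∈-vertsT⁺ T w val)
  ... | true with hasUnexpl-true (vertsT [] T) h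
  ...   | w , w∈ , w∉ with ∈-vertsT⁻ T w∈
  ...     | q , refl , val = inj₂ (q , val , w∉)

  competitive-State : ∀ {P m E 𝒯} → State P m E 𝒯 → Competitive m E
  competitive-State st = competitive-compared compared root∈Q (≤-trans (m≤m+n _ s) funded)
    where open State st

  choose-≡ : ∀ {tb n E 𝒯 j S} → pick (tb E 𝒯) (minsOf T E 𝒯) ≡ just j → nth j 𝒯 ≡ just S →
    choose T B tb n E 𝒯 ≡ act T B tb n E 𝒯 j S (leftmost T E S) (rightmost T E S)
  choose-≡ eq₁ eq₂ rewrite eq₁ | eq₂ = refl

  module _ (tb : TieBreak) where

    mutual
      -- The invariant is required only while something is unexplored: agents that finish the whole
      -- tree early may not earn their allowances, but then the comparison with any routes is
      -- immediate.
      loop-competitive : ∀ n {m E 𝒯} → (∃[ w ] (Valid T w × w ∉ E) → State Live m E 𝒯) → Competitive (m + n) (loop T B tb n E 𝒯)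
      loop-competitive zero {m} {E} {𝒯} st with explored? E
      ... | inj₁ all∈ = competitive-explored all∈
      ... | inj₂ un = subst (λ k → Competitive k E) (sym (+-identityʳ m)) (competitive-State (st un))
      loop-competitive (suc n) {m} {E} {𝒯} st with hasUnexpl E (vertsT [] T) in h
      ... | false = competitive-explored λ {w} val → hasUnexpl-false (vertsT [] T) h (∈-vertsT⁺ T w val)
      ... | true with hasUnexpl-true (vertsT [] T) h
      ...   | w , w∈ , w∉ with ∈-vertsT⁻ T w∈
      ...     | q , refl , val = subst (λ k → Competitive k (choose T B tb n E (prepare T E 𝒯))) (sym (+-suc m n))
                  (choose-competitive n (prepare-State (st (q , val , w∉))) val w∉)

      choose-competitive : ∀ n {m E 𝒯 w} → State Ready m E 𝒯 → Valid T w → w ∉ E → Competitive (suc (m + n)) (choose T B tb n E 𝒯)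
      choose-competitive n {m} {E} {𝒯} {w} st val w∉ = go (pick (tb E 𝒯) (minsOf T E 𝒯)) refl
        where
        status-of : ∀ {S} → S ∈ 𝒯 → WellFormed S × top S ∈ E
        status-of S∈ with Credits-lookup (State.credits st) S∈
        ... | _ , status wf t∈ _ = wf , t∈
        pending⇒ : ∀ {S} → ∃[ w ] Pending S E w → hasUnexpl E (vertsS T S) ≡ true
        pending⇒ {S} (w , w∈ , w∉) = hasUnexpl-intro (∈-vertsS⁺ {S} w∈) w∉
        go : ∀ p → pick (tb E 𝒯) (minsOf T E 𝒯) ≡ p → Competitive (suc (m + n)) (choose T B tb n E 𝒯)
        go nothing eq with find (State.covered st val w∉)
        ... | S , S∈ , w∈ = contradiction (pick-nothing (tb E 𝒯) (minsOf T E 𝒯) eq) (minsOf-∃ E 𝒯 S∈ (pending⇒ {S} (w , w∈ , w∉)))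
        go (just j) eq with minsOf⁻ E 𝒯 (pick-just (tb E 𝒯) (minsOf T E 𝒯) eq)
        ... | S , n≡ , unf , least with status-of (nth-∈ j n≡)
        ...   | wf , t∈ = subst (Competitive (suc (m + n))) (sym (choose-≡ {tb} {n} {E} {𝒯} eq n≡))
                  (act-competitive n st n≡ (unfinished wf t∈ unf) (λ {S′} S′∈ p → least S′∈ (pending⇒ {S′} p)) wf t∈ _ _
                    (leftmost-first wf t∈) (rightmost-first wf t∈))

      act-competitive : ∀ n {m E 𝒯 j S} → State Ready m E 𝒯 → nth j 𝒯 ≡ just S → ∃[ w ] Pending S E w →
        (∀ {S′} → S′ ∈ 𝒯 → ∃[ w ] Pending S′ E w → depth (top S) ≤ depth (top S′)) → WellFormed S → top S ∈ E →
        ∀ mL mR → First true S E mL → First false S E mR → Competitive (suc (m + n)) (act T B tb n E 𝒯 j S mL mR)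
      act-competitive n st n≡ (w , w∈ , w∉) least wf t∈ nothing mR fin _ = contradiction (fin w w∈) w∉
      act-competitive n {m} {E} {𝒯} {j} {S} st n≡ pend least wf t∈ (just vL) mR (uL , xL , refl , (vL∈ , vL∉) , uL∈ , vL-done) fR
        with closeEnough B S (uL ∷ʳ xL) in closeL
      ... | true = loop-competitive n λ _ → Round.run-close st n≡ pend least true vL∈ vL∉ uL∈ vL-done closeL
      act-competitive n st n≡ (w , w∈ , w∉) least wf t∈ (just vL) nothing _ fin | false = contradiction (fin w w∈) w∉
      act-competitive n {m} {E} {𝒯} {j} {S} st n≡ pend least wf t∈ (just vL) (just vR) (uL , xL , refl , (vL∈ , vL∉) , uL∈ , vL-done)
        (uR , xR , refl , (vR∈ , vR∉) , uR∈ , vR-done) | false with closeEnough B S (uR ∷ʳ xR) in closeR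
      ... | true = loop-competitive n λ _ → Round.run-close st n≡ pend least false vR∈ vR∉ uR∈ vR-done closeR
      ... | false rewrite Round.Divide.v-nth st n≡ pend least vL∈ vL∉ uL∈ vL-done closeL vR∈ vR∉ uR∈ vR-done closeR
          = second-competitive n (Round.Divide.competitive₁ st n≡ pend least vL∈ vL∉ uL∈ vL-done closeL vR∈ vR∉ uR∈ vR-done closeR)
              (Round.Divide.state₂ st n≡ pend least vL∈ vL∉ uL∈ vL-done closeL vR∈ vR∉ uR∈ vR-done closeR)

      second-competitive : ∀ n {m E S₂ 𝒯} → Competitive (suc m) E → State Live (suc (suc m)) (runDFS T B true S₂ (top S₂) E) 𝒯 →
        Competitive (suc (m + n)) (second T B tb n E S₂ 𝒯)
      second-competitive zero {m} {E} c st = subst (λ k → Competitive k E) (cong suc (sym (+-identityʳ m))) c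
      second-competitive (suc n) {m} {E} {S₂} {𝒯} c st =
        subst (λ k → Competitive k (loop T B tb n (runDFS T B true S₂ (top S₂) E) 𝒯)) (cong suc (sym (+-suc m n)))
          (loop-competitive n λ _ → st)

  -- The first two agents

  S₀ : Sub
  S₀ = fullSub T []

  wf₀ : WellFormed S₀
  wf₀ = fullSub-WF (Valid-[] {T})

  Searching₀ : Searching true (λ _ → ⊥) S₀ ([] ∷ []) [] [] []
  Searching₀ = record
    { closed = λ { {[]} _ _ → here refl ; {x ∷ u} (_ , ()) (here refl) }
    ; pos = inj₁ refl ; cur∈ = here refl
    ; path = λ { (_ , _ , refl , _) (_ , ()) }
    ; covers = λ { ((_ , _ , refl , _) , here () , _) ; ((_ , _ , refl , _) , there () , _) }
    ; cur-done = λ { w _ () }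
    ; sides = λ { ((_ , _ , refl , _) , here () , _) ; ((_ , _ , refl , _) , there () , _) }
    ; far-done = λ ()
    ; all-below = λ w _ → w , refl
    ; p⊑cur = [] , refl }

  E₁ E₂ : List Vertex
  E₁ = runDFS T B true S₀ [] []
  E₂ = runDFS T B false S₀ [] E₁

  outcome₁ : Outcome true (λ _ → ⊥) S₀ [] B ([] ∷ []) E₁
  outcome₁ = dfs-search wf₀ B Searching₀ (here refl)

  module R₁ = Searched (proj₁ outcome₁)

  all-explored : ∀ {E} → [] ∈ E → Finished S₀ E → ∀ {w} → Valid T w → w ∈ E
  all-explored root∈ fin {[]} val = root∈
  all-explored root∈ fin {i ∷ q} val = fin (i ∷ q) (In-fullSub {[]} {i} {q} val)

  Compared₀ : Compared 0 ([] ∷ []) 0 B ([] ∷ [])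
  Compared₀ = record { explored = [] , z≤n , id ; routes = λ { [] z≤n [] → [] , z≤n , λ () } }

  Compared-run : ∀ {dir m E E′ G} → Searched dir S₀ B B E E′ → Compared m E G B ([] ∷ []) → Compared (suc m) E′ (G + B) B ([] ∷ [])
  Compared-run {E = E} r c = Compared-step {E} (λ {rt} (_ , len) _ → rt , len , there) c ≤-refl
    (λ v∈ → [ inj₁ , (λ x → inj₂ (proj₁ x)) ]′ (Searched.new r v∈)) (Searched.fresh-≤ r)

  -- No earlier run has left active vertices, so `F` is empty, the marker stays at the root, and the
  -- first agent takes no loan.
  run₁-credit : Finished S₀ E₁ ⊎ ∃[ A ] Covers S₀ E₁ A × 6 + 3 * B + 3 * length A ≤ 6 * count E₁
  run₁-credit with proj₂ outcome₁
  ... | inj₁ fin = inj₁ fin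
  ... | inj₂ (A , .[] , cov , _ , _ , inj₁ refl , _ , h) = inj₂ (A , cov , +-cancelʳ-≤ 0 _ _ (≤-trans h (≤-reflexive (+-identityʳ _))))

  competitive₁ : Competitive 1 E₁
  competitive₁ with run₁-credit
  ... | inj₁ fin = competitive-explored (all-explored (R₁.extends (here refl)) fin)
  ... | inj₂ (A , _ , h) = competitive-compared (Compared-run (proj₁ outcome₁) Compared₀) (here refl)
      (≤-trans (≤-trans (+-mono-≤ (*-monoˡ-≤ B (s≤s (s≤s (z≤n {1})))) (s≤s (s≤s (z≤n {4})))) (≤-trans (≤-reflexive (+-comm (3 * B) 6)) (m≤m+n (6 + 3 * B) _))) h)

  outcome₂ : ∀ {A} → Covers S₀ E₁ A → Outcome false (Done S₀ E₁ true) S₀ A B E₁ E₂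
  outcome₂ cov = run-from-top wf₀ R₁.closed root∈ root∈ cov false z≤n left-done id
    where
    root∈ : [] ∈ E₁
    root∈ = R₁.extends (here refl)
    left-done : ∀ {v} → Active S₀ E₁ v → Done S₀ E₁ true v
    left-done (v∈ , v∈E , _) with R₁.new-done v∈E
    ... | inj₁ (here refl) = contradiction refl (In≢top v∈)
    ... | inj₂ d = d

  -- Both runs start at the root with full energy and earn `6 B`: the store of the tree takes `2 B`,
  -- the two allowances `4 B`. Of the 6 credits of the root, 2 pay for its place in `Q`.
  first-two-arith : ∀ B A c₁ c₂ a → 6 + 3 * B + 3 * A ≤ 6 * c₁ → 6 * c₁ + 3 * B + a ≤ 6 * c₂ + 3 * A + 2 * B →
    2 * (B + B) + 2 + (a + 0) ≤ 6 * c₂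
  first-two-arith B A c₁ c₂ a h₁ h₂ = +-cancelʳ-≤ (3 * A + 2 * B) _ _ (begin
    2 * (B + B) + 2 + (a + 0) + (3 * A + 2 * B)   ≤⟨ m≤n+m _ 4 ⟩
    4 + (2 * (B + B) + 2 + (a + 0) + (3 * A + 2 * B)) ≡⟨ e₁ B A a ⟩
    6 + 3 * B + 3 * A + 3 * B + a                 ≤⟨ +-monoˡ-≤ a (+-monoˡ-≤ (3 * B) h₁) ⟩
    6 * c₁ + 3 * B + a                            ≤⟨ h₂ ⟩
    6 * c₂ + 3 * A + 2 * B                        ≡⟨ +-assoc (6 * c₂) (3 * A) (2 * B) ⟩
    6 * c₂ + (3 * A + 2 * B)                      ∎)
    where
    open ≤-Reasoning
    e₁ : ∀ B A a → 4 + (2 * (B + B) + 2 + (a + 0) + (3 * A + 2 * B)) ≡ 6 + 3 * B + 3 * A + 3 * B + a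
    e₁ = solve-∀

  state₂ : ∃[ w ] (Valid T w × w ∉ E₂) → State Live 2 E₂ (S₀ ∷ [])
  state₂ (w , val , w∉) with run₁-credit
  ... | inj₁ fin = contradiction (R₂.extends (all-explored (R₁.extends (here refl)) fin val)) w∉
    where
    -- In a finished tree nothing is active, so the empty list covers; the second run is consulted
    -- only for `E₁ ⊆ E₂`.
    module R₂ = Searched (proj₁ (outcome₂ {[]} λ (_ , _ , y , (y∈ , y∉) , _) → contradiction (fin y y∈) y∉))
  ... | inj₂ (A , cov , h₁) with run-credit {A = A} {Q = [] ∷ []} wf₀ (R₁.extends (here refl)) sides above∈ (outcome₂ cov)
    where
    sides : Sides S₀ E₁
    sides (v∈ , v∈E , _) with R₁.new-done v∈E
    ... | inj₁ (here refl) = contradiction refl (In≢top v∈)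
    ... | inj₂ d = inj₁ d
    above∈ : ∀ {u} → u ⊑ [] → u ∈ [] ∷ []
    above∈ {[]} _ = here refl
    above∈ {x ∷ u} (_ , ())
  ...   | inj₁ (fin , _) = contradiction (all-explored (R₂.extends (R₁.extends (here refl))) fin val) w∉
    where
    module R₂ = Searched (proj₁ (outcome₂ cov))
  ...   | inj₂ (a , live , h₂) = record
    { closed = R₂.closed ; root∈ = R₂.extends (R₁.extends (here refl))
    ; shallow = λ v∈ → [ (λ v∈₁ → [ (λ { (here refl) → z≤n }) , id ]′ (R₁.shallow v∈₁)) , id ]′ (R₂.shallow v∈)
    ; d = 0 ; root∈Q = here refl ; credits = live ∷ [] ; disjoint = [] ∷ []
    ; covered = λ { {[]} _ r∉ → contradiction (R₂.extends (R₁.extends (here refl))) r∉ ; {i ∷ q} v _ → here (In-fullSub {[]} {i} {q} v) }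
    ; low = (λ _ → z≤n) ∷ []
    ; compared = Compared-run (proj₁ (outcome₂ cov)) (Compared-run (proj₁ outcome₁) Compared₀)
    ; funded = first-two-arith B (length A) (count E₁) (count E₂) a h₁ h₂ }
    where
    module R₂ = Searched (proj₁ (outcome₂ cov))

  divideExplore-competitive : ∀ k tb → Competitive k (divideExplore T k B tb)
  divideExplore-competitive zero tb .Competitive.bound [] _ _ = z≤n
  divideExplore-competitive (suc zero) tb = competitive₁
  divideExplore-competitive (suc (suc n)) tb = loop-competitive tb n state₂

theorem1 : (tb : TieBreak) (T : Tree) (k B : ℕ) (ws : Vec (List Vertex) k)
    → All (Route T B) ws
    → optValueOf ws ≤ 3 * algValue T k B tb
theorem1 tb T k B ws routes =
  bound (toList ws) (≤-reflexive (Vec.length-toList ws)) (Vec.toList⁺ routes)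
  where open Exploration.Competitive (Exploration.divideExplore-competitive T B k tb)
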